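{- Let $\mathsf N^k$ be a partial nightrider with $k$ basic moves ($1\le k\le4$). For each $i\ge0$, the coefficient $q!\gamma_i$ of $n^{2q-i}$ in $o_{\mathsf N^k}(q;n)$ is a polynomial in $q$ (whose coefficients are periodic functions of $n$) with leading term $$\Big(-\frac{5k}{24}\Big)^i\frac{q^{2i}}{i!}.$$
   Context: A partial nightrider $\mathsf N^k$ is a rider whose basic moves are any $k$ of the four vectors $(1,2),(2,1),(1,-2),(2,-1)$. On the $n\times n$ board $[n]^2$, two pieces at positions $z,z'$ attack each other if $z'-z$ is an integer multiple of a basic move (including $z=z'$). $u_{\mathsf P}(q;n)$ is the number of placements of $q$ unlabelled pieces on $[n]^2$ with no two attacking, and $o_{\mathsf P}(q;n)=q!\,u_{\mathsf P}(q;n)$ is the labelled count. $u_{\mathsf P}(q;n)$ is a quasipolynomial in $n$ of degree $2q$, written $u_{\mathsf P}(q;n)=\sum_{i=0}^{2q}\gamma_i(n)n^{2q-i}$ with $\gamma_i(n)$ periodic in $n$. -}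

module Defs where

open import Data.Fin.Base as Fin using (Fin; toℕ)
open import Data.Fin.Patterns using (0F; 1F; 2F; 3F)
open import Data.Fin.Properties using (any?)
open import Data.Fin.Subset using (Subset; _∈_)
open import Data.Fin.Subset.Properties using (_∈?_)
open import Data.Integer.Base as ℤ using (ℤ; +_; -[1+_])
import Data.Integer.Properties as ℤ
open import Data.List.Base using (List; []; _∷_; _++_; map; length; filter; allFin; cartesianProduct)
open import Data.List.Relation.Unary.AllPairs using (AllPairs; allPairs?)
open import Data.Nat.Base as ℕ using (ℕ; zero; suc; _∸_; _≤_; _<_)
open import Data.Product.Base using (_×_; _,_; ∃-syntax)
open import Data.Product.Properties using (≡-dec)
open import Data.Rational.Base as ℚ using (ℚ; 0ℚ; _/_; _*_)
import Data.Rational.Properties as ℚ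
open import Relation.Binary.Definitions using (Decidable)
open import Relation.Binary.PropositionalEquality using (_≡_; sym; trans; cong)
open import Relation.Nullary.Decidable using (Dec; map′; _×-dec_; ¬?)
open import Relation.Nullary.Negation using (¬_)
open import Algebra.Definitions.RawSemiring ℚ.+-*-rawSemiring public using (_^_)
open import Algebra.Properties.CommutativeMonoid.Sum ℚ.+-0-commutativeMonoid public using (sum-syntax)

knightMove : Fin 4 → ℤ × ℤ
knightMove 0F = + 1 , + 2
knightMove 1F = + 2 , + 1
knightMove 2F = + 1 , -[1+ 1 ]
knightMove 3F = + 2 , -[1+ 0 ]

PartialNightrider : Set
PartialNightrider = Subset 4

-- Only differences of positions matter, so coordinates 0, …, n − 1 are used in
-- place of 1, …, n.
Square : ℕ → Set
Square n = Fin n × Fin n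

displacement : ∀ {n} → Square n → Square n → ℤ × ℤ
displacement (x , y) (x′ , y′) = + toℕ x′ ℤ.- + toℕ x , + toℕ y′ ℤ.- + toℕ y

_·_ : ℤ → ℤ × ℤ → ℤ × ℤ
c · (a , b) = c ℤ.* a , c ℤ.* b

IsMultipleOf : ℤ × ℤ → ℤ × ℤ → Set
IsMultipleOf m d = ∃[ c ] d ≡ c · m

Attacks : PartialNightrider → ∀ {n} → Square n → Square n → Set
Attacks N z z′ = ∃[ j ] (j ∈ N × IsMultipleOf (knightMove j) (displacement z z′))

-- Each move has a coordinate ±1, from which the only possible multiplier is read off.
multiplier : Fin 4 → ℤ × ℤ → ℤ
multiplier 0F (x , y) = x
multiplier 1F (x , y) = y
multiplier 2F (x , y) = x
multiplier 3F (x , y) = ℤ.- y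

multiplier-· : ∀ j c → multiplier j (c · knightMove j) ≡ c
multiplier-· 0F c = ℤ.*-identityʳ c
multiplier-· 1F c = ℤ.*-identityʳ c
multiplier-· 2F c = ℤ.*-identityʳ c
multiplier-· 3F c = trans (ℤ.neg-distribʳ-* c -[1+ 0 ]) (ℤ.*-identityʳ c)

isMultipleOf? : ∀ j d → Dec (IsMultipleOf (knightMove j) d)
isMultipleOf? j d =
  map′ (λ e → multiplier j d , e)
       (λ (c , e) → trans e (cong (_· knightMove j)
                               (sym (trans (cong (multiplier j) e) (multiplier-· j c)))))
       (≡-dec ℤ._≟_ ℤ._≟_ d (multiplier j d · knightMove j))

attacks? : ∀ N {n} → Decidable (Attacks N {n})
attacks? N z z′ = any? λ j → (j ∈? N) ×-dec isMultipleOf? j (displacement z z′)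

-- The sublists of length q.  On a list without repetitions these represent each
-- q-element subset exactly once.
combinations : ∀ {A : Set} → ℕ → List A → List (List A)
combinations zero    _        = [] ∷ []
combinations (suc q) []       = []
combinations (suc q) (x ∷ xs) = map (x ∷_) (combinations q xs) ++ combinations (suc q) xs

board : ∀ n → List (Square n)
board n = cartesianProduct (allFin n) (allFin n)

NonAttacking : PartialNightrider → ∀ {n} → List (Square n) → Set
NonAttacking N = AllPairs (λ z z′ → ¬ Attacks N z z′)

nonAttacking? : ∀ N {n} (zs : List (Square n)) → Dec (NonAttacking N zs)
nonAttacking? N = allPairs? (λ z z′ → ¬? (attacks? N z z′))

-- The number of nonattacking placements of q unlabelled pieces.
u : PartialNightrider → ℕ → ℕ → ℕ
u N q n = length (filter (nonAttacking? N) (combinations q (board n)))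

fromℕ : ℕ → ℚ
fromℕ m = + m / 1

Periodic : (ℕ → ℚ) → Set
Periodic f = ∃[ p ] (1 ≤ p × (∀ n → f (n ℕ.+ p) ≡ f n))

-- f (n) = γ₀(n) nᵈ + γ₁(n) nᵈ⁻¹ + ⋯ + γ_d(n) for all n ≥ 1, with periodic γᵢ.  There are
-- no negative powers of n, so the coefficient γᵢ is 0 when i > d.  These conditions
-- determine every γᵢ(n).
record IsQuasipolynomial (f : ℕ → ℕ) (d : ℕ) (γ : ℕ → ℕ → ℚ) : Set where
  field
    periodic  : ∀ i → Periodic (γ i)
    vanishing : ∀ i → d < i → ∀ n → γ i n ≡ 0ℚ
    expansion : ∀ n → 1 ≤ n →
                fromℕ (f n) ≡ (∑[ i < suc d ] (γ (toℕ i) n * fromℕ (n ℕ.^ (d ∸ toℕ i))))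

-- g q n is a polynomial in q whose coefficients are periodic functions of n and whose
-- term of highest degree is c qᵈ, with c a nonzero constant.
record IsPolynomialWithLeadingTerm (g : ℕ → ℕ → ℚ) (c : ℚ) (d : ℕ) : Set where
  field
    coefficient : Fin (suc d) → ℕ → ℚ
    periodic    : ∀ j → Periodic (coefficient j)
    evaluation  : ∀ q n → g q n ≡ (∑[ j < suc d ] (coefficient j n * fromℕ (q ℕ.^ toℕ j)))
    leading     : ∀ n → coefficient (Fin.fromℕ d) n ≡ c
    nonzero     : ¬ c ≡ 0ℚ

{-# OPTIONS --safe #-}

-- Let o(q) be the number of labelled placements, a sum over all q-tuples of squares, and
-- let W(s) = Σ_t (−1)^(s−t) C(s,t) n^(2(s−t)) o(t), where C is the binomial coefficient.
-- The coefficient of n^(2s−i) in W(s) is the s-th difference at q = 0 of q ↦ q! γᵢ.  On the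
-- other hand W(s) is the sum over all s-tuples z of f(z) = Σ (−1)^(s−|T|) [T nonattacking],
-- T running through the subtuples of z.  If some entry of z attacks no other entry then
-- adding or removing it shows f(z) = 0; the remaining tuples are O(n^⌊3s/2⌋) in number.
-- Hence the s-th difference is 0 for s > 2i, and Newton interpolation makes q! γᵢ a
-- polynomial in q whose coefficient of q^(2i) is the coefficient of n^(3i) in W(2i), divided
-- by (2i)!.  Up to O(n^(3i−1)) only perfect matchings contribute to W(2i), so that
-- W(2i+2) ≈ −(2i+1) a W(2i), where a is the number of ordered pairs of attacking squares.
-- Each move contributes 5n³/12 + O(n²) to a.

module Submission where

open import Defs
open import Algebra.Bundles using (CommutativeSemiring)
open import Data.Bool.Base using (if_then_else_; true; false)
open import Data.Fin.Base as Fin using (Fin; toℕ; zero; suc)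
open import Data.Fin.Patterns using (0F; 1F; 2F; 3F)
import Data.Fin.Properties as Fin
open import Data.Fin.Subset as Subset using (Subset; inside; outside; Nonempty) renaming (∣_∣ to size; _∈_ to _∈ₛ_)
import Data.Fin.Subset.Properties as Subset
open import Data.Fin.Subset.Properties using (_∈?_)
open import Data.Integer.Base as ℤ using (ℤ; +_; -[1+_]; +[1+_]; +0; 0ℤ; 1ℤ)
import Data.Integer.Properties as ℤ
import Data.Integer.Tactic.RingSolver as ℤ-solver
open import Data.List.Base using (List; []; _∷_; _++_; map; length; filter; allFin; tabulate; cartesianProduct)
open import Data.List.Membership.Propositional using (_∈_; find; lose)
open import Data.List.Membership.Propositional.Properties using (∈-allFin)
import Data.List.Properties as List
open import Data.List.Relation.Binary.Permutation.Propositional as ↭ using (_↭_; ↭-refl; ↭-prep; ↭-swap; ↭-trans; ↭-sym; ↭⇒↭ₛ)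
open import Data.List.Relation.Binary.Permutation.Propositional.Properties using (∈-resp-↭; Any-resp-↭; drop-∷; ↭-length; shift)
import Data.List.Relation.Binary.Permutation.Setoid.Properties as Permutation
open import Data.List.Relation.Unary.All as All using (All; []; _∷_)
open import Data.List.Relation.Unary.All.Properties using (¬Any⇒All¬)
open import Data.List.Relation.Unary.AllPairs using (AllPairs; []; _∷_; allPairs?)
open import Data.List.Relation.Unary.Any using (Any; here; there; any?)
open import Data.List.Relation.Unary.Any.Properties using (++⁻)
open import Data.Nat.Base as ℕ using (ℕ; zero; suc; _≤_; z≤n; s≤s; NonZero; _!; _∸_)
import Data.Nat.Properties as ℕ
import Data.Nat.Tactic.RingSolver as ℕ-solver
open import Data.Product.Base using (_×_; _,_; ∃-syntax; proj₁; proj₂)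
open import Data.Product.Properties using (,-injective)
open import Data.Rational.Base as ℚ using (ℚ; mkℚ; 0ℚ; 1ℚ; _/_; toℚᵘ)
import Data.Rational.Properties as ℚ
open import Data.Rational.Unnormalised.Base as ℚᵘ using (mkℚᵘ; *≡*; *≤*)
import Data.Rational.Unnormalised.Properties as ℚᵘ
open import Data.Sum.Base using (_⊎_; inj₁; inj₂; [_,_]′)
open import Data.Vec.Base using ([]; _∷_)
open import Function.Base using (_∘_; id)
open import Level using (0ℓ)
open import Relation.Binary.Definitions using (Decidable; Reflexive; Symmetric)
open import Relation.Binary.PropositionalEquality as ≡ using (_≡_)
open import Relation.Nullary.Decidable using (Dec; yes; no; does; ¬?; _×-dec_; _⊎-dec_; _→-dec_; dec-true; dec-false; from-yes)
open import Relation.Nullary.Decidable.Core using (dec⇒maybe)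
open import Relation.Nullary.Negation using (¬_; contradiction)
open import Tactic.RingSolver using (solve-∀)
open import Tactic.RingSolver.Core.AlmostCommutativeRing using (AlmostCommutativeRing; fromCommutativeRing)
open import Algebra.Properties.AbelianGroup ℤ.+-0-abelianGroup using (inverseˡ-unique)
open import Algebra.Properties.AbelianGroup ℚ.+-0-abelianGroup using (x∙y⁻¹≈ε⇒x≈y)
open import Algebra.Properties.CommutativeMonoid.Sum ℚ.+-0-commutativeMonoid using (sum-cong-≗)

-- Sums over lists, over tuples, and over the entries of a tuple

-- The number q! γᵢ is the coefficient of n^(-i) in o(q) / n^(2q), so a difference in q acts on each
-- coefficient separately; multiplying through by n^(2s) gives W(s), with factors n² in place of
-- divisions. The family γ is arbitrary apart from its hypothesis, whereas W(s) is accessible only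
-- through integer estimates. The link is that a quasipolynomial of size O(n^(m-1)) has zero
-- coefficients at n^m and above, since on one residue class it is a polynomial. The threshold s >
-- 2i comes from 2s - i > ⌊3s/2⌋. At s = 2i both exponents are 3i, so the growth bound no longer
-- kills the coefficient and the main term has to be found. A pair of attacking entries has about n³
-- choices, but three connected entries only n⁴, less than n^(9/2); hence matchings dominate. There
-- are (2i - 1)!! of them, and (2i - 1)!! (5k/12)^i / (2i)! = (5k/24)^i / i!. An error O(n^(m-1)) is
-- written as n · |error| ≤ C n^m, and factors 12^i clear denominators, which keeps the estimates
-- for W in ℕ and ℤ.

module ListSum (R : CommutativeSemiring 0ℓ 0ℓ) where
  open CommutativeSemiring R
  open import Algebra.Definitions.RawMonoid +-rawMonoid public using () renaming (_×_ to _⊗_)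
  open import Algebra.Properties.CommutativeSemigroup +-commutativeSemigroup using (interchange; x∙yz≈y∙xz)
  open import Algebra.Properties.CommutativeMonoid.Mult +-commutativeMonoid using (×-congʳ; ×-distrib-+; ×-assocˡ)
  open import Relation.Binary.Reasoning.Setoid setoid

  private
    variable
      A B : Set

  ∑ : List A → (A → Carrier) → Carrier
  ∑ []       φ = 0#
  ∑ (x ∷ xs) φ = φ x + ∑ xs φ

  ∑ᵗ : ℕ → List A → (List A → Carrier) → Carrier
  ∑ᵗ zero    V φ = φ []
  ∑ᵗ (suc q) V φ = ∑ V λ z → ∑ᵗ q V λ zs → φ (z ∷ zs)

  -- ∑ φ (zᵢ , zs without zᵢ) over the positions i of zs.
  ∑ᵖ : List A → (A → List A → Carrier) → Carrier
  ∑ᵖ []       φ = 0#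
  ∑ᵖ (z ∷ zs) φ = φ z zs + ∑ᵖ zs λ y ys → φ y (z ∷ ys)

  ∑-cong : (V : List A) {φ ψ : A → Carrier} → (∀ z → φ z ≈ ψ z) → ∑ V φ ≈ ∑ V ψ
  ∑-cong []      e = refl
  ∑-cong (x ∷ V) e = +-cong (e x) (∑-cong V e)

  ∑-zero : (V : List A) → ∑ V (λ _ → 0#) ≈ 0#
  ∑-zero []      = refl
  ∑-zero (x ∷ V) = trans (+-identityˡ _) (∑-zero V)

  ∑-+ : (V : List A) (φ ψ : A → Carrier) → ∑ V (λ z → φ z + ψ z) ≈ ∑ V φ + ∑ V ψ
  ∑-+ []      φ ψ = sym (+-identityˡ _)
  ∑-+ (x ∷ V) φ ψ = trans (+-congˡ (∑-+ V φ ψ)) (interchange _ _ _ _)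

  ∑-* : (V : List A) (c : Carrier) (φ : A → Carrier) → ∑ V (λ z → c * φ z) ≈ c * ∑ V φ
  ∑-* []      c φ = sym (zeroʳ c)
  ∑-* (x ∷ V) c φ = trans (+-congˡ (∑-* V c φ)) (sym (distribˡ c _ _))

  ∑-*ʳ : (V : List A) (c : Carrier) (φ : A → Carrier) → ∑ V (λ z → φ z * c) ≈ ∑ V φ * c
  ∑-*ʳ V c φ = trans (∑-cong V λ z → *-comm (φ z) c) (trans (∑-* V c φ) (*-comm c _))

  ⊗-zero : ∀ n → n ⊗ 0# ≈ 0#
  ⊗-zero zero    = refl
  ⊗-zero (suc n) = trans (+-identityˡ _) (⊗-zero n)

  ∑-⊗ : (V : List A) (n : ℕ) (φ : A → Carrier) → ∑ V (λ z → n ⊗ φ z) ≈ n ⊗ ∑ V φ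
  ∑-⊗ V zero    φ = ∑-zero V
  ∑-⊗ V (suc n) φ = trans (∑-+ V φ _) (+-congˡ (∑-⊗ V n φ))

  ∑-++ : (V W : List A) (φ : A → Carrier) → ∑ (V ++ W) φ ≈ ∑ V φ + ∑ W φ
  ∑-++ []      W φ = sym (+-identityˡ _)
  ∑-++ (x ∷ V) W φ = trans (+-congˡ (∑-++ V W φ)) (sym (+-assoc _ _ _))

  ∑-comm : (V : List A) (W : List B) (φ : A → B → Carrier) →
           ∑ V (λ x → ∑ W (φ x)) ≈ ∑ W (λ y → ∑ V (λ x → φ x y))
  ∑-comm []      W φ = sym (∑-zero W)
  ∑-comm (x ∷ V) W φ = trans (+-congˡ (∑-comm V W φ)) (sym (∑-+ W _ _))

  ∑-map : (f : B → A) (V : List B) (φ : A → Carrier) → ∑ (map f V) φ ≈ ∑ V (φ ∘ f)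
  ∑-map f []      φ = refl
  ∑-map f (x ∷ V) φ = +-congˡ (∑-map f V φ)

  ∑ᵗ-cong : ∀ q (V : List A) {φ ψ : List A → Carrier} →
            (∀ zs → length zs ≡ q → φ zs ≈ ψ zs) → ∑ᵗ q V φ ≈ ∑ᵗ q V ψ
  ∑ᵗ-cong zero    V e = e [] ≡.refl
  ∑ᵗ-cong (suc q) V e = ∑-cong V λ z → ∑ᵗ-cong q V λ zs l → e (z ∷ zs) (≡.cong suc l)

  ∑ᵗ-zero : ∀ q (V : List A) → ∑ᵗ q V (λ _ → 0#) ≈ 0#
  ∑ᵗ-zero zero    V = refl
  ∑ᵗ-zero (suc q) V = trans (∑-cong V λ z → ∑ᵗ-zero q V) (∑-zero V)

  ∑ᵗ-+ : ∀ q (V : List A) (φ ψ : List A → Carrier) →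
         ∑ᵗ q V (λ z → φ z + ψ z) ≈ ∑ᵗ q V φ + ∑ᵗ q V ψ
  ∑ᵗ-+ zero    V φ ψ = refl
  ∑ᵗ-+ (suc q) V φ ψ = trans (∑-cong V λ z → ∑ᵗ-+ q V _ _) (∑-+ V _ _)

  ∑ᵗ-* : ∀ q (V : List A) (c : Carrier) (φ : List A → Carrier) →
         ∑ᵗ q V (λ z → c * φ z) ≈ c * ∑ᵗ q V φ
  ∑ᵗ-* zero    V c φ = refl
  ∑ᵗ-* (suc q) V c φ = trans (∑-cong V λ z → ∑ᵗ-* q V c _) (∑-* V c _)

  ∑ᵗ-⊗ : ∀ q (V : List A) (n : ℕ) (φ : List A → Carrier) →
         ∑ᵗ q V (λ z → n ⊗ φ z) ≈ n ⊗ ∑ᵗ q V φ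
  ∑ᵗ-⊗ zero    V n φ = refl
  ∑ᵗ-⊗ (suc q) V n φ = trans (∑-cong V λ z → ∑ᵗ-⊗ q V n _) (∑-⊗ V n _)

  ∑ᵖ-cong : (zs : List A) {φ ψ : A → List A → Carrier} →
            (∀ w ws → zs ↭ w ∷ ws → φ w ws ≈ ψ w ws) → ∑ᵖ zs φ ≈ ∑ᵖ zs ψ
  ∑ᵖ-cong []       e = refl
  ∑ᵖ-cong (z ∷ zs) e = +-cong (e z zs ↭-refl)
    (∑ᵖ-cong zs λ w ws p → e w (z ∷ ws) (↭-trans (↭-prep z p) (↭-swap z w ↭-refl)))

  ∑ᵖ-zero : (zs : List A) → ∑ᵖ zs (λ _ _ → 0#) ≈ 0#
  ∑ᵖ-zero []       = refl
  ∑ᵖ-zero (z ∷ zs) = trans (+-identityˡ _) (∑ᵖ-zero zs)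

  ∑ᵖ-↭ : {zs zs′ : List A} {φ : A → List A → Carrier} →
         (∀ w {ws ws′} → ws ↭ ws′ → φ w ws ≈ φ w ws′) → zs ↭ zs′ → ∑ᵖ zs φ ≈ ∑ᵖ zs′ φ
  ∑ᵖ-↭ inv ↭.refl          = refl
  ∑ᵖ-↭ inv (↭.prep x p)    = +-cong (inv x p) (∑ᵖ-↭ (λ w q → inv w (↭-prep x q)) p)
  ∑ᵖ-↭ {φ = φ} inv (↭.swap {xs} {ys} x y p) = begin
    φ x (y ∷ xs) + (φ y (x ∷ xs) + ∑ᵖ xs (λ w ws → φ w (x ∷ y ∷ ws)))
      ≈⟨ x∙yz≈y∙xz _ _ _ ⟩
    φ y (x ∷ xs) + (φ x (y ∷ xs) + ∑ᵖ xs (λ w ws → φ w (x ∷ y ∷ ws)))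
      ≈⟨ +-cong (inv y (↭-prep x p)) (+-cong (inv x (↭-prep y p))
           (trans (∑ᵖ-↭ (λ w q → inv w (↭-prep x (↭-prep y q))) p)
                  (∑ᵖ-cong ys λ w ws _ → inv w (↭-swap x y ↭-refl)))) ⟩
    φ y (x ∷ ys) + (φ x (y ∷ ys) + ∑ᵖ ys (λ w ws → φ w (y ∷ x ∷ ws))) ∎
  ∑ᵖ-↭ inv (↭.trans p₁ p₂) = trans (∑ᵖ-↭ inv p₁) (∑ᵖ-↭ inv p₂)

  -- Exchanging summations moves the chosen entry to the outside, so all `suc q` positions
  -- contribute equally. This turns a choice of partner inside a tuple into a free sum over squares.
  ∑ᵗ-∑ᵖ : ∀ q (V : List A) (φ : A → List A → Carrier) →
          ∑ᵗ (suc q) V (λ zs → ∑ᵖ zs φ) ≈ suc q ⊗ ∑ V (λ w → ∑ᵗ q V (φ w))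
  ∑ᵗ-∑ᵖ zero    V φ = trans (∑-cong V λ z → +-identityʳ _) (sym (+-identityʳ _))
  ∑ᵗ-∑ᵖ (suc q) V φ = begin
    ∑ V (λ z → ∑ᵗ (suc q) V λ zs → φ z zs + ∑ᵖ zs λ y ys → φ y (z ∷ ys))
      ≈⟨ ∑-cong V (λ z → ∑ᵗ-+ (suc q) V (φ z) (λ zs → ∑ᵖ zs λ y ys → φ y (z ∷ ys))) ⟩
    ∑ V (λ z → ∑ᵗ (suc q) V (φ z) + ∑ᵗ (suc q) V λ zs → ∑ᵖ zs λ y ys → φ y (z ∷ ys))
      ≈⟨ ∑-+ V _ _ ⟩
    _ + ∑ V (λ z → ∑ᵗ (suc q) V λ zs → ∑ᵖ zs λ y ys → φ y (z ∷ ys))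
      ≈⟨ +-congˡ (∑-cong V λ z → ∑ᵗ-∑ᵖ q V _) ⟩
    _ + ∑ V (λ z → suc q ⊗ ∑ V λ w → ∑ᵗ q V λ ys → φ w (z ∷ ys))
      ≈⟨ +-congˡ (trans (∑-⊗ V (suc q) _) (×-congʳ (suc q) (∑-comm V V _))) ⟩
    suc (suc q) ⊗ ∑ V (λ w → ∑ᵗ (suc q) V (φ w)) ∎

  ∑-cartesianProduct : (V : List A) (W : List B) (φ : A × B → Carrier) →
                       ∑ (cartesianProduct V W) φ ≈ ∑ V λ x → ∑ W λ y → φ (x , y)
  ∑-cartesianProduct []      W φ = refl
  ∑-cartesianProduct (x ∷ V) W φ =
    trans (∑-++ (map (x ,_) W) _ φ) (+-cong (∑-map (x ,_) W φ) (∑-cartesianProduct V W φ))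

  ∑ᵗ-∑-comm : ∀ q (V : List A) (W : List B) (φ : List A → B → Carrier) →
              ∑ᵗ q V (λ zs → ∑ W (φ zs)) ≈ ∑ W (λ y → ∑ᵗ q V (λ zs → φ zs y))
  ∑ᵗ-∑-comm zero    V W φ = refl
  ∑ᵗ-∑-comm (suc q) V W φ =
    trans (∑-cong V λ z → ∑ᵗ-∑-comm q V W λ zs → φ (z ∷ zs)) (∑-comm V W _)

  -- These two properties of the nonattacking indicator make every q-subset count q! times among
  -- q-tuples. By symmetry the two leading entries in `diagonal` stand for any two entries.
  record SymmetricOffDiagonal (φ : List A → Carrier) : Set where
    field
      symmetric   : ∀ {zs zs′} → zs ↭ zs′ → φ zs ≈ φ zs′
      diagonal : ∀ x zs → φ (x ∷ x ∷ zs) ≈ 0#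

  module _ where
    open SymmetricOffDiagonal

    link : ∀ {φ : List A → Carrier} x → SymmetricOffDiagonal φ → SymmetricOffDiagonal (φ ∘ (x ∷_))
    link x S .symmetric p      = symmetric S (↭-prep x p)
    link x S .diagonal y zs =
      trans (symmetric S (↭-trans (↭-swap x y ↭-refl) (↭-prep y (↭-swap x y ↭-refl)))) (diagonal S y (x ∷ zs))

    -- A tuple that uses the new element `x` twice contributes nothing, so `x` occupies no position
    -- or exactly one of `suc q`, and by symmetry it may be moved to the front.
    ∑ᵗ-∷ : ∀ q x (xs : List A) {φ} → SymmetricOffDiagonal φ →
           ∑ᵗ (suc q) (x ∷ xs) φ ≈ ∑ᵗ (suc q) xs φ + suc q ⊗ ∑ᵗ q xs (φ ∘ (x ∷_))
    ∑ᵗ-∷ zero    x xs S = trans (+-comm _ _) (+-congˡ (sym (+-identityʳ _)))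
    ∑ᵗ-∷ (suc q) x xs {φ} S = begin
      ∑ᵗ (suc q) (x ∷ xs) (φ ∘ (x ∷_)) + ∑ xs (λ a → ∑ᵗ (suc q) (x ∷ xs) (φ ∘ (a ∷_)))
        ≈⟨ +-cong left right ⟩
      X + (∑ᵗ (suc (suc q)) xs φ + suc q ⊗ X)
        ≈⟨ x∙yz≈y∙xz _ _ _ ⟩
      ∑ᵗ (suc (suc q)) xs φ + suc (suc q) ⊗ X ∎
      where
      X = ∑ᵗ (suc q) xs (φ ∘ (x ∷_))
      left : ∑ᵗ (suc q) (x ∷ xs) (φ ∘ (x ∷_)) ≈ X
      left = begin
        _ ≈⟨ ∑ᵗ-∷ q x xs (link x S) ⟩
        X + suc q ⊗ ∑ᵗ q xs (λ zs → φ (x ∷ x ∷ zs))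
          ≈⟨ +-congˡ (sym (∑ᵗ-⊗ q xs (suc q) _)) ⟩
        X + ∑ᵗ q xs (λ zs → suc q ⊗ φ (x ∷ x ∷ zs))
          ≈⟨ +-congˡ (∑ᵗ-cong q xs λ zs _ → trans (×-congʳ (suc q) (diagonal S x zs)) (⊗-zero (suc q))) ⟩
        X + ∑ᵗ q xs (λ _ → 0#)
          ≈⟨ trans (+-congˡ (∑ᵗ-zero q xs)) (+-identityʳ _) ⟩
        X ∎
      right : ∑ xs (λ a → ∑ᵗ (suc q) (x ∷ xs) (φ ∘ (a ∷_))) ≈ ∑ᵗ (suc (suc q)) xs φ + suc q ⊗ X
      right = begin
        _ ≈⟨ ∑-cong xs (λ a → ∑ᵗ-∷ q x xs (link a S)) ⟩
        ∑ xs (λ a → ∑ᵗ (suc q) xs (φ ∘ (a ∷_)) + suc q ⊗ ∑ᵗ q xs (λ zs → φ (a ∷ x ∷ zs)))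
          ≈⟨ trans (∑-+ xs _ _) (+-congˡ (∑-⊗ xs (suc q) _)) ⟩
        ∑ᵗ (suc (suc q)) xs φ + suc q ⊗ ∑ xs (λ a → ∑ᵗ q xs (λ zs → φ (a ∷ x ∷ zs)))
          ≈⟨ +-congˡ (×-congʳ (suc q) (∑-cong xs λ a → ∑ᵗ-cong q xs λ zs _ → symmetric S (↭-swap a x ↭-refl))) ⟩
        ∑ᵗ (suc (suc q)) xs φ + suc q ⊗ X ∎

    -- Both sides obey the same recursion in `xs`: `combinations` by definition, tuples by `∑ᵗ-∷`.
    -- This converts unlabelled into labelled counts.
    ∑-combinations : ∀ q (xs : List A) {φ} → SymmetricOffDiagonal φ →
                     (q !) ⊗ ∑ (combinations q xs) φ ≈ ∑ᵗ q xs φ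
    ∑-combinations zero    xs       S = trans (+-identityʳ _) (+-identityʳ _)
    ∑-combinations (suc q) []       S = ⊗-zero (suc q !)
    ∑-combinations (suc q) (x ∷ xs) {φ} S = begin
      (suc q !) ⊗ ∑ (map (x ∷_) (combinations q xs) ++ combinations (suc q) xs) φ
        ≈⟨ ×-congʳ (suc q !) (trans (∑-++ (map (x ∷_) (combinations q xs)) _ φ)
                                    (+-congʳ (∑-map (x ∷_) (combinations q xs) φ))) ⟩
      (suc q !) ⊗ (∑ (combinations q xs) (φ ∘ (x ∷_)) + ∑ (combinations (suc q) xs) φ)
        ≈⟨ ×-distrib-+ _ _ (suc q !) ⟩
      (suc q !) ⊗ ∑ (combinations q xs) (φ ∘ (x ∷_)) + (suc q !) ⊗ ∑ (combinations (suc q) xs) φ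
        ≈⟨ +-cong (sym (×-assocˡ _ (suc q) (q !))) (∑-combinations (suc q) xs S) ⟩
      suc q ⊗ ((q !) ⊗ ∑ (combinations q xs) (φ ∘ (x ∷_))) + ∑ᵗ (suc q) xs φ
        ≈⟨ +-congʳ (×-congʳ (suc q) (∑-combinations q xs (link x S))) ⟩
      suc q ⊗ ∑ᵗ q xs (φ ∘ (x ∷_)) + ∑ᵗ (suc q) xs φ
        ≈⟨ +-comm _ _ ⟩
      ∑ᵗ (suc q) xs φ + suc q ⊗ ∑ᵗ q xs (φ ∘ (x ∷_))
        ≈⟨ ∑ᵗ-∷ q x xs S ⟨
      ∑ᵗ (suc q) (x ∷ xs) φ ∎

open ≡

-- Alternating sums over the nonattacking subtuples of a tuple

module ℕΣ = ListSum ℕ.+-*-commutativeSemiring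
module ℤΣ = ListSum ℤ.+-*-commutativeSemiring

𝟙 : {P : Set} → Dec P → ℕ
𝟙 d = if does d then 1 else 0

𝟙-yes : {P : Set} (d : Dec P) → P → 𝟙 d ≡ 1
𝟙-yes d p = cong (if_then 1 else 0) (dec-true d p)

𝟙-no : {P : Set} (d : Dec P) → ¬ P → 𝟙 d ≡ 0
𝟙-no d ¬p = cong (if_then 1 else 0) (dec-false d ¬p)

𝟙-⇔ : {P Q : Set} (d : Dec P) (e : Dec Q) → (P → Q) → (Q → P) → 𝟙 d ≡ 𝟙 e
𝟙-⇔ d e f g with d
... | yes p = sym (𝟙-yes e (f p))
... | no ¬p = sym (𝟙-no e (¬p ∘ g))

𝟙-× : {P Q : Set} (d : Dec P) (d′ : Dec Q) → 𝟙 (d ×-dec d′) ≡ 𝟙 d ℕ.* 𝟙 d′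
𝟙-× (yes _) d′ = sym (ℕ.+-identityʳ _)
𝟙-× (no _)  d′ = refl

𝟙≤ : {P : Set} (d : Dec P) {m : ℕ} → (P → 1 ℕ.≤ m) → 𝟙 d ℕ.≤ m
𝟙≤ (yes p) b = b p
𝟙≤ (no _)  b = z≤n

≤𝟙 : {P : Set} (d : Dec P) {m : ℕ} → (P → m ℕ.≤ 1) → (¬ P → m ℕ.≤ 0) → m ℕ.≤ 𝟙 d
≤𝟙 (yes p) b c = b p
≤𝟙 (no ¬p) b c = c ¬p

module _ {A : Set} where

  ∑-mono : (V : List A) {φ ψ : A → ℕ} → (∀ z → φ z ℕ.≤ ψ z) → ℕΣ.∑ V φ ℕ.≤ ℕΣ.∑ V ψ
  ∑-mono []      e = z≤n
  ∑-mono (x ∷ V) e = ℕ.+-mono-≤ (e x) (∑-mono V e)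

  ∑-const : (V : List A) (c : ℕ) → ℕΣ.∑ V (λ _ → c) ≡ length V ℕ.* c
  ∑-const []      c = refl
  ∑-const (x ∷ V) c = cong (c ℕ.+_) (∑-const V c)

  ∑-bound : (V : List A) {φ : A → ℕ} (c : ℕ) → (∀ z → φ z ℕ.≤ c) → ℕΣ.∑ V φ ℕ.≤ length V ℕ.* c
  ∑-bound V c e = ℕ.≤-trans (∑-mono V e) (ℕ.≤-reflexive (∑-const V c))

  ∑ᵗ-mono : ∀ q (V : List A) {φ ψ : List A → ℕ} →
            (∀ zs → length zs ≡ q → φ zs ℕ.≤ ψ zs) → ℕΣ.∑ᵗ q V φ ℕ.≤ ℕΣ.∑ᵗ q V ψ
  ∑ᵗ-mono zero    V e = e [] refl
  ∑ᵗ-mono (suc q) V e = ∑-mono V λ z → ∑ᵗ-mono q V λ zs l → e (z ∷ zs) (cong suc l)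

  ∈⇒≤∑ : {V : List A} {x : A} (φ : A → ℕ) → x ∈ V → φ x ℕ.≤ ℕΣ.∑ V φ
  ∈⇒≤∑ φ (here refl) = ℕ.m≤m+n _ _
  ∈⇒≤∑ φ (there x∈V) = ℕ.≤-trans (∈⇒≤∑ φ x∈V) (ℕ.m≤n+m _ _)

  -- `φ` is quantified inside the existential so that a single decomposition of `zs` serves both the
  -- rearrangement and every later estimate.
  ∈⇒≤∑ᵖ : {zs : List A} {w : A} → w ∈ zs →
          ∃[ ws ] (zs ↭ w ∷ ws × (∀ (φ : A → List A → ℕ) → φ w ws ℕ.≤ ℕΣ.∑ᵖ zs φ))
  ∈⇒≤∑ᵖ {z ∷ zs} (here refl) = zs , ↭-refl , λ φ → ℕ.m≤m+n _ _
  ∈⇒≤∑ᵖ {z ∷ zs} (there w∈zs) with ws , p , b ← ∈⇒≤∑ᵖ w∈zs =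
    z ∷ ws , ↭-trans (↭-prep z p) (↭-swap z _ ↭-refl) , λ φ → ℕ.≤-trans (b λ y ys → φ y (z ∷ ys)) (ℕ.m≤n+m _ _)

  ∣∑∣≤ : (V : List A) (φ : A → ℤ) → ℤ.∣ ℤΣ.∑ V φ ∣ ℕ.≤ ℕΣ.∑ V (λ z → ℤ.∣ φ z ∣)
  ∣∑∣≤ []      φ = z≤n
  ∣∑∣≤ (x ∷ V) φ = ℕ.≤-trans (ℤ.∣i+j∣≤∣i∣+∣j∣ (φ x) _) (ℕ.+-monoʳ-≤ ℤ.∣ φ x ∣ (∣∑∣≤ V φ))

  ∣∑ᵗ∣≤ : ∀ q (V : List A) (φ : List A → ℤ) → ℤ.∣ ℤΣ.∑ᵗ q V φ ∣ ℕ.≤ ℕΣ.∑ᵗ q V (λ zs → ℤ.∣ φ zs ∣)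
  ∣∑ᵗ∣≤ zero    V φ = ℕ.≤-refl
  ∣∑ᵗ∣≤ (suc q) V φ = ℕ.≤-trans (∣∑∣≤ V _) (∑-mono V λ z → ∣∑ᵗ∣≤ q V _)

  ∣∑ᵖ∣≤ : (zs : List A) {φ : A → List A → ℤ} (c : ℕ) →
          (∀ w ws → length zs ≡ suc (length ws) → ℤ.∣ φ w ws ∣ ℕ.≤ c) → ℤ.∣ ℤΣ.∑ᵖ zs φ ∣ ℕ.≤ length zs ℕ.* c
  ∣∑ᵖ∣≤ []       c b = z≤n
  ∣∑ᵖ∣≤ (z ∷ zs) {φ} c b = ℕ.≤-trans (ℤ.∣i+j∣≤∣i∣+∣j∣ (φ z zs) _)
    (ℕ.+-mono-≤ (b z zs refl) (∣∑ᵖ∣≤ zs c λ w ws l → b w (z ∷ ws) (cong suc l)))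

  ∑-pos : (V : List A) (φ : A → ℕ) → + ℕΣ.∑ V φ ≡ ℤΣ.∑ V (λ z → + φ z)
  ∑-pos []      φ = refl
  ∑-pos (x ∷ V) φ = cong (λ s → + φ x ℤ.+ s) (∑-pos V φ)

  ∑ᵖ≡0⊎∃≢0 : (zs : List A) (φ : A → List A → ℤ) →
             ℤΣ.∑ᵖ zs φ ≡ 0ℤ ⊎ ∃[ w ] ∃[ ws ] (zs ↭ w ∷ ws × φ w ws ≢ 0ℤ)
  ∑ᵖ≡0⊎∃≢0 []       φ = inj₁ refl
  ∑ᵖ≡0⊎∃≢0 (z ∷ zs) φ with φ z zs ℤ.≟ 0ℤ | ∑ᵖ≡0⊎∃≢0 zs (λ y ys → φ y (z ∷ ys))
  ... | no ≢0 | _                       = inj₂ (z , zs , ↭-refl , ≢0)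
  ... | yes _ | inj₂ (w , ws , p , ≢0)  = inj₂ (w , z ∷ ws , ↭-trans (↭-prep z p) (↭-swap z w ↭-refl) , ≢0)
  ... | yes e | inj₁ e′                 = inj₁ (cong₂ ℤ._+_ e e′)

⊗≡* : ∀ n x → n ℕΣ.⊗ x ≡ n ℕ.* x
⊗≡* zero    x = refl
⊗≡* (suc n) x = cong (x ℕ.+_) (⊗≡* n x)

⊗≡+* : ∀ n x → n ℤΣ.⊗ x ≡ + n ℤ.* x
⊗≡+* zero    x = sym (ℤ.*-zeroˡ x)
⊗≡+* (suc n) x = trans (cong (λ s → x ℤ.+ s) (⊗≡+* n x)) (sym (ℤ.suc-* (+ n) x))

-- ⌊3s/2⌋
deg : ℕ → ℕ
deg 0             = 0
deg 1             = 1
deg (suc (suc s)) = 3 ℕ.+ deg s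

1+deg≤deg-suc : ∀ s → suc (deg s) ℕ.≤ deg (suc s)
1+deg≤deg-suc 0             = s≤s z≤n
1+deg≤deg-suc 1             = s≤s (s≤s z≤n)
1+deg≤deg-suc (suc (suc s)) = ℕ.+-monoʳ-≤ 3 (1+deg≤deg-suc s)

∷↭∷⁻ : {A : Set} {x v : A} {zs rest : List A} → x ∷ zs ↭ v ∷ rest →
       (v ≡ x × zs ↭ rest) ⊎ ∃[ rest′ ] (rest ↭ x ∷ rest′ × zs ↭ v ∷ rest′)
∷↭∷⁻ {x = x} {v} {zs} p with ∈-resp-↭ (↭-sym p) (here refl)
... | here refl = inj₁ (refl , drop-∷ p)
... | there v∈zs with rest′ , q , _ ← ∈⇒≤∑ᵖ v∈zs = inj₂ (rest′ , drop-∷ (↭-trans (↭-sym p) (↭-trans (↭-prep x q) (↭-swap x v ↭-refl))) , q)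

-- For l = `length zs`, the first summand bounds `f (z ∷ zs)`, and the second bounds the l terms of
-- the partner sum in `defect`.
defectBound : ℕ → ℕ
defectBound l = 2 ℕ.^ suc l ℕ.+ l ℕ.* 2 ℕ.^ l

module Reflexive-Symmetric {A : Set} {_~_ : A → A → Set} (_~?_ : Decidable _~_)
                           (~-refl : Reflexive _~_) (~-sym : Symmetric _~_) where

  Independent : List A → Set
  Independent = AllPairs λ z w → ¬ z ~ w

  independent? : (zs : List A) → Dec (Independent zs)
  independent? = allPairs? λ z w → ¬? (z ~? w)

  ι : List A → ℤ
  ι zs = + 𝟙 (independent? zs)

  Independent-resp-↭ : ∀ {zs zs′} → zs ↭ zs′ → Independent zs → Independent zs′
  Independent-resp-↭ p = Permutation.AllPairs-resp-↭ (setoid A) (_∘ ~-sym) ((λ { refl → λ x → x }) , (λ { refl → λ x → x })) (↭⇒↭ₛ p)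

  ι-resp-↭ : ∀ {zs zs′} → zs ↭ zs′ → ι zs ≡ ι zs′
  ι-resp-↭ {zs} {zs′} p = cong +_ (𝟙-⇔ (independent? zs) (independent? zs′) (Independent-resp-↭ p) (Independent-resp-↭ (↭-sym p)))

  ι≡0 : ∀ {zs} → ¬ Independent zs → ι zs ≡ 0ℤ
  ι≡0 {zs} ¬i = cong +_ (𝟙-no (independent? zs) ¬i)

  ι-symmetricOffDiagonal : ℤΣ.SymmetricOffDiagonal ι
  ι-symmetricOffDiagonal = record
    { symmetric = ι-resp-↭
    ; diagonal  = λ x zs → ι≡0 {x ∷ x ∷ zs} λ { ((x≁x ∷ _) ∷ _) → x≁x ~-refl }
    }

  -- The alternating sum of ι (ys ++ T) over the sublists T of zs, with sign + for T = zs.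
  h : List A → List A → ℤ
  h ys []       = ι ys
  h ys (z ∷ zs) = h (z ∷ ys) zs ℤ.- h ys zs

  h-resp-↭ˡ : ∀ {ys ys′} → ys ↭ ys′ → ∀ zs → h ys zs ≡ h ys′ zs
  h-resp-↭ˡ p []       = ι-resp-↭ p
  h-resp-↭ˡ p (z ∷ zs) = cong₂ ℤ._-_ (h-resp-↭ˡ (↭-prep z p) zs) (h-resp-↭ˡ p zs)

  h-resp-↭ : ∀ {zs zs′} ys → zs ↭ zs′ → h ys zs ≡ h ys zs′
  h-resp-↭ ys _↭_.refl          = refl
  h-resp-↭ ys (_↭_.prep x p)    = cong₂ ℤ._-_ (h-resp-↭ (x ∷ ys) p) (h-resp-↭ ys p)
  h-resp-↭ ys (_↭_.trans p₁ p₂) = trans (h-resp-↭ ys p₁) (h-resp-↭ ys p₂)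
  h-resp-↭ ys (_↭_.swap {xs} {xs′} a b p)
    rewrite h-resp-↭ˡ (↭-swap b a (↭-refl {x = ys})) xs
          | h-resp-↭ (a ∷ b ∷ ys) p | h-resp-↭ (a ∷ ys) p | h-resp-↭ (b ∷ ys) p | h-resp-↭ ys p
    = lemma (h (a ∷ b ∷ ys) xs′) (h (a ∷ ys) xs′) (h (b ∷ ys) xs′) (h ys xs′)
    where
    lemma : ∀ p q r s → (p ℤ.- q) ℤ.- (r ℤ.- s) ≡ (p ℤ.- r) ℤ.- (q ℤ.- s)
    lemma = ℤ-solver.solve-∀

  h-dependent : ∀ {ys} → ¬ Independent ys → ∀ zs → h ys zs ≡ 0ℤ
  h-dependent d []       = ι≡0 d
  h-dependent d (z ∷ zs) = cong₂ ℤ._-_ (h-dependent (λ { (_ ∷ i) → d i }) zs) (h-dependent d zs)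

  -- Inserting an entry that attacks none of the others changes the independence of no subtuple, so
  -- the two alternating sums agree term by term.
  h-isolated : ∀ {v} ys zs → All (λ y → ¬ v ~ y) ys → All (λ z → ¬ v ~ z) zs → h (v ∷ ys) zs ≡ h ys zs
  h-isolated ys []       vy vz       = cong +_ (𝟙-⇔ (independent? (_ ∷ ys)) (independent? ys) (λ { (_ ∷ i) → i }) (λ i → vy ∷ i))
  h-isolated ys (z ∷ zs) vy (v≁z ∷ vz) = cong₂ ℤ._-_
    (trans (h-resp-↭ˡ (↭-swap z _ ↭-refl) zs) (h-isolated (z ∷ ys) zs (v≁z ∷ vy) vz))
    (h-isolated ys zs vy vz)

  ∣h∣≤ : ∀ ys zs → ℤ.∣ h ys zs ∣ ℕ.≤ 2 ℕ.^ length zs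
  ∣h∣≤ ys []       with independent? ys
  ... | yes _ = ℕ.≤-refl
  ... | no  _ = z≤n
  ∣h∣≤ ys (z ∷ zs) = ℕ.≤-trans (ℤ.∣i-j∣≤∣i∣+∣j∣ (h (z ∷ ys) zs) (h ys zs))
    (ℕ.+-mono-≤ (∣h∣≤ (z ∷ ys) zs) (ℕ.≤-trans (∣h∣≤ ys zs) (ℕ.m≤m+n _ 0)))

  f : List A → ℤ
  f = h []

  -- Every entry of zs is attacked by an entry of ys or by another entry of zs.
  Covered : List A → List A → Set
  Covered ys zs = ∀ {v rest} → zs ↭ v ∷ rest → Any (v ~_) (ys ++ rest)

  Covered-resp-↭ : ∀ {ys zs zs′} → zs ↭ zs′ → Covered ys zs → Covered ys zs′
  Covered-resp-↭ p c q = c (↭-trans p q)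

  Covered-shift : ∀ {ys z zs} → Covered ys (z ∷ zs) → Covered (z ∷ ys) zs
  Covered-shift {ys} {z} {zs} c {v} {rest} q =
    Any-resp-↭ (shift z ys rest) (c (↭-trans (↭-prep z q) (↭-swap z v ↭-refl)))

  Covered-pair : ∀ {z w ws} → z ~ w → Covered [] ws → Covered [] (z ∷ w ∷ ws)
  Covered-pair z~w c p with ∷↭∷⁻ p
  ... | inj₁ (refl , q) = Any-resp-↭ q (here z~w)
  ... | inj₂ (rest′ , r , q) with ∷↭∷⁻ q
  ...   | inj₁ (refl , _)       = Any-resp-↭ (↭-sym r) (here (~-sym z~w))
  ...   | inj₂ (rest″ , r′ , q′) = Any-resp-↭ (↭-sym r) (there (Any-resp-↭ (↭-sym r′) (there (c q′))))

  -- If some entry `v` attacks no other, move it to the front: `f` becomes the difference of the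
  -- sums with and without `v`, and `h-isolated` makes them equal.
  f≢0⇒Covered : ∀ {zs} → f zs ≢ 0ℤ → Covered [] zs
  f≢0⇒Covered {zs} f≢0 {v} {rest} p with any? (v ~?_) rest
  ... | yes a = a
  ... | no ¬a = contradiction f≡0 f≢0
    where
    f≡0 : f zs ≡ 0ℤ
    f≡0 = trans (h-resp-↭ [] p)
      (ℤ.i≡j⇒i-j≡0 (h-isolated [] rest [] (¬Any⇒All¬ rest ¬a)))

  -- Sort the subtuples by what they keep of the pair. Keeping both gives 0 because they attack each
  -- other; keeping only `z`, only `w`, or neither gives -`f ws`, -`f ws` and +`f ws`.
  f-edge : ∀ {z w} ws → z ~ w → All (λ v → ¬ z ~ v) ws → All (λ v → ¬ w ~ v) ws → f (z ∷ w ∷ ws) ≡ ℤ.- f ws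
  f-edge {z} {w} ws z~w zs ws′
    rewrite h-dependent {w ∷ z ∷ []} (λ { ((w≁z ∷ _) ∷ _) → w≁z (~-sym z~w) }) ws
          | h-isolated [] ws [] zs | h-isolated [] ws [] ws′ = lemma (f ws)
    where
    lemma : ∀ x → (0ℤ ℤ.- x) ℤ.- (x ℤ.- x) ≡ ℤ.- x
    lemma = ℤ-solver.solve-∀

  -- An upper bound for the indicator of Covered ys zs, where m ≥ length zs is fuel: the first
  -- entry of zs is attacked from ys, or it attacks another entry of zs.
  κ : ℕ → List A → List A → ℕ
  κ m       ys []       = 1
  κ zero    ys (z ∷ zs) = 0
  κ (suc m) ys (z ∷ zs) = ℕΣ.∑ ys (λ y → 𝟙 (y ~? z) ℕ.* κ m (z ∷ ys) zs)
                    ℕ.+ ℕΣ.∑ᵖ zs (λ w ws → 𝟙 (z ~? w) ℕ.* κ m (w ∷ z ∷ ys) ws)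

  1≤𝟙* : ∀ {z w x} → z ~ w → 1 ℕ.≤ x → 1 ℕ.≤ 𝟙 (z ~? w) ℕ.* x
  1≤𝟙* {z} {w} {x} z~w 1≤x rewrite 𝟙-yes (z ~? w) z~w = ℕ.≤-trans 1≤x (ℕ.m≤m+n x 0)

  -- An entry whose attacker has been found joins `ys`, since it may still be the attacker of a
  -- later entry; `Covered-shift` says that the rest stays covered. The attacker itself joins as
  -- well if it came from `zs`.
  Covered⇒1≤κ : ∀ m {ys} zs → length zs ℕ.≤ m → Covered ys zs → 1 ℕ.≤ κ m ys zs
  Covered⇒1≤κ zero    []       l c = ℕ.≤-refl
  Covered⇒1≤κ (suc m) []       l c = ℕ.≤-refl
  Covered⇒1≤κ (suc m) {ys} (z ∷ zs) (s≤s l) c with ++⁻ ys (c ↭-refl)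
  ... | inj₁ a with y , y∈ys , z~y ← find a =
    ℕ.≤-trans (1≤𝟙* (~-sym z~y) (Covered⇒1≤κ m zs l (Covered-shift c)))
    (ℕ.≤-trans (∈⇒≤∑ (λ y → 𝟙 (y ~? z) ℕ.* κ m (z ∷ ys) zs) y∈ys) (ℕ.m≤m+n _ _))
  ... | inj₂ a with w , w∈zs , z~w ← find a with ws , p , b ← ∈⇒≤∑ᵖ w∈zs =
    ℕ.≤-trans (1≤𝟙* z~w (Covered⇒1≤κ m ws (ℕ.≤-trans (ℕ.n≤1+n _) (subst (ℕ._≤ m) (↭-length p) l))
                          (Covered-shift (Covered-resp-↭ p (Covered-shift c)))))
    (ℕ.≤-trans (b λ w ws → 𝟙 (z ~? w) ℕ.* κ m (w ∷ z ∷ ys) ws) (ℕ.m≤n+m _ _))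

  -- A nonzero value forces the tuple to be covered, where `κ` is at least 1; the other factor is
  -- the number of signed subtuples.
  ∣f∣≤ : ∀ zs → ℤ.∣ f zs ∣ ℕ.≤ 2 ℕ.^ length zs ℕ.* κ (length zs) [] zs
  ∣f∣≤ zs with f zs ℤ.≟ 0ℤ
  ... | yes f≡0 rewrite f≡0 = z≤n
  ... | no  f≢0 = ℕ.≤-trans (∣h∣≤ [] zs) (ℕ.m≤m*n (2 ℕ.^ length zs) (κ (length zs) [] zs) {{ ℕ.>-nonZero (Covered⇒1≤κ (length zs) zs ℕ.≤-refl (f≢0⇒Covered f≢0)) }})

  -- On tuples in which z and some w attack each other and nothing else, f is minus its
  -- value on the remaining entries.  The defect measures the failure of the resulting
  -- recurrence over all tuples, and vanishes unless a third entry attacks z or w.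
  defect : A → List A → ℤ
  defect z zs = f (z ∷ zs) ℤ.+ ℤΣ.∑ᵖ zs λ w ws → + 𝟙 (z ~? w) ℤ.* f ws

  defect-resp-↭ : ∀ z {zs zs′} → zs ↭ zs′ → defect z zs ≡ defect z zs′
  defect-resp-↭ z p = cong₂ ℤ._+_ (h-resp-↭ [] (↭-prep z p))
    (ℤΣ.∑ᵖ-↭ (λ w q → cong (λ s → + 𝟙 (z ~? w) ℤ.* s) (h-resp-↭ [] q)) p)

  ∣defect∣≤ : ∀ z zs → ℤ.∣ defect z zs ∣ ℕ.≤ defectBound (length zs)
  ∣defect∣≤ z zs = ℕ.≤-trans (ℤ.∣i+j∣≤∣i∣+∣j∣ (f (z ∷ zs)) _) (ℕ.+-mono-≤ (∣h∣≤ [] (z ∷ zs))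
    (∣∑ᵖ∣≤ zs (2 ℕ.^ length zs) bound))
    where
    bound : ∀ w ws → length zs ≡ suc (length ws) → ℤ.∣ + 𝟙 (z ~? w) ℤ.* f ws ∣ ℕ.≤ 2 ℕ.^ length zs
    bound w ws l rewrite ℤ.abs-* (+ 𝟙 (z ~? w)) (f ws) | l with z ~? w
    ... | yes _ = ℕ.+-mono-≤ (∣h∣≤ [] ws) z≤n
    ... | no  _ = z≤n

  -- Some summand is nonzero. If it is a partner term, then `z` and `w` attack each other and the
  -- nonzero `f ws` covers the remaining entries.
  defect≢0⇒Covered : ∀ {z zs} → defect z zs ≢ 0ℤ → Covered [] (z ∷ zs)
  defect≢0⇒Covered {z} {zs} d≢0 with f (z ∷ zs) ℤ.≟ 0ℤ | ∑ᵖ≡0⊎∃≢0 zs (λ w ws → + 𝟙 (z ~? w) ℤ.* f ws)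
  ... | no f≢0 | _       = f≢0⇒Covered f≢0
  ... | yes e₁ | inj₁ e₂ = contradiction (cong₂ ℤ._+_ e₁ e₂) d≢0
  ... | yes _  | inj₂ (w , ws , p , t≢0) with z ~? w
  ...   | yes z~w = Covered-resp-↭ (↭-prep z (↭-sym p)) (Covered-pair z~w (f≢0⇒Covered λ f≡0 → t≢0 (cong (λ s → 1ℤ ℤ.* s) f≡0)))
  ...   | no  _   = contradiction (ℤ.*-zeroˡ (f ws)) t≢0

  -- In the partner sum only the term of `w` survives, and it cancels the value given by `f-edge`.
  defect-edge : ∀ {z w} ws → z ~ w → All (λ v → ¬ z ~ v) ws → All (λ v → ¬ w ~ v) ws → defect z (w ∷ ws) ≡ 0ℤ
  defect-edge {z} {w} ws z~w zs ws′
    rewrite f-edge ws z~w zs ws′ | 𝟙-yes (z ~? w) z~w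
          | trans (ℤΣ.∑ᵖ-cong ws {ψ = λ _ _ → 0ℤ} λ v vs p →
              cong (λ t → + t ℤ.* f (w ∷ vs)) (𝟙-no (z ~? v) (All.lookup zs (∈-resp-↭ (↭-sym p) (here refl)))))
            (ℤΣ.∑ᵖ-zero ws) = lemma (f ws)
    where
    lemma : ∀ x → ℤ.- x ℤ.+ (1ℤ ℤ.* x ℤ.+ 0ℤ) ≡ 0ℤ
    lemma = ℤ-solver.solve-∀

  -- A bound for the tuples on which `defect` can be nonzero: `z` has a partner `w`, a third entry
  -- `v` is attacked by one of the two, and the others are covered relative to these three.
  cherries : ℕ → A → List A → ℕ
  cherries m z zs = ℕΣ.∑ᵖ zs λ w ws → 𝟙 (z ~? w) ℕ.*
                    ℕΣ.∑ᵖ ws λ v vs → (𝟙 (z ~? v) ℕ.+ 𝟙 (w ~? v)) ℕ.* κ m (v ∷ w ∷ z ∷ []) vs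

  defect≢0⇒1≤cherries : ∀ m z zs → length zs ℕ.≤ m → defect z zs ≢ 0ℤ → 1 ℕ.≤ cherries m z zs
  defect≢0⇒1≤cherries m z zs l d≢0
    with c ← defect≢0⇒Covered {z} {zs} d≢0
    with w , w∈zs , z~w ← find (c ↭-refl)
    with ws , p , b ← ∈⇒≤∑ᵖ w∈zs
    with any? (λ v → (z ~? v) ⊎-dec (w ~? v)) ws
  ... | no ¬a = contradiction (trans (defect-resp-↭ z {zs} p) (defect-edge ws z~w
      (All.tabulate λ v∈ws z~v → ¬a (lose v∈ws (inj₁ z~v)))
      (All.tabulate λ v∈ws w~v → ¬a (lose v∈ws (inj₂ w~v))))) d≢0
  ... | yes a
    with v , v∈ws , zw~v ← find a
    with vs , p′ , b′ ← ∈⇒≤∑ᵖ v∈ws =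
    ℕ.≤-trans (1≤𝟙* z~w (ℕ.≤-trans (ℕ.*-mono-≤ (1≤+ zw~v) 1≤κ)
      (b′ λ v vs → (𝟙 (z ~? v) ℕ.+ 𝟙 (w ~? v)) ℕ.* κ m (v ∷ w ∷ z ∷ []) vs)))
    (b λ w ws → 𝟙 (z ~? w) ℕ.* ℕΣ.∑ᵖ ws λ v vs → (𝟙 (z ~? v) ℕ.+ 𝟙 (w ~? v)) ℕ.* κ m (v ∷ w ∷ z ∷ []) vs)
    where
    1≤+ : z ~ v ⊎ w ~ v → 1 ℕ.≤ 𝟙 (z ~? v) ℕ.+ 𝟙 (w ~? v)
    1≤+ (inj₁ z~v) rewrite 𝟙-yes (z ~? v) z~v = s≤s z≤n
    1≤+ (inj₂ w~v) rewrite 𝟙-yes (w ~? v) w~v = ℕ.m≤n+m 1 _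
    1≤κ : 1 ℕ.≤ κ m (v ∷ w ∷ z ∷ []) vs
    1≤κ = Covered⇒1≤κ m vs
      (ℕ.≤-trans (ℕ.m≤n+m _ 2) (subst (ℕ._≤ m) (trans (↭-length p) (cong suc (↭-length p′))) l))
      (Covered-shift (Covered-resp-↭ p′ (Covered-shift (Covered-resp-↭ p (Covered-shift c)))))

  ∣defect∣≤cherries : ∀ m z zs → length zs ℕ.≤ m → ℤ.∣ defect z zs ∣ ℕ.≤ defectBound (length zs) ℕ.* cherries m z zs
  ∣defect∣≤cherries m z zs l with defect z zs ℤ.≟ 0ℤ
  ... | yes d≡0 rewrite d≡0 = z≤n
  ... | no  d≢0 = ℕ.≤-trans (∣defect∣≤ z zs) (ℕ.m≤m*n (defectBound (length zs)) (cherries m z zs) {{ ℕ.>-nonZero (defect≢0⇒1≤cherries m z zs l d≢0) }})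

  -- Of the `r + s` entries, `r` are always kept and `s` are kept or dropped with signs. The
  -- labelled count is the case `s = 0` and the alternating sum is the case `r = 0`, so that the
  -- passage between them is a recursion.
  partial : List A → ℕ → ℕ → ℤ
  partial V r s = ℤΣ.∑ᵗ r V λ ys → ℤΣ.∑ᵗ s V (h ys)

  -- Split by the first of the alternating entries: if kept, it becomes one more permanent entry; if
  -- dropped, it ranges freely and contributes the factor `length V`.
  partial-suc : ∀ V r s → partial V r (suc s) ≡ partial V (suc r) s ℤ.- + length V ℤ.* partial V r s
  partial-suc V r s = begin
    ℤΣ.∑ᵗ r V (λ ys → ℤΣ.∑ V λ z → ℤΣ.∑ᵗ s V λ zs → h (z ∷ ys) zs ℤ.- h ys zs)
      ≡⟨ ℤΣ.∑ᵗ-cong r V (λ ys _ → ℤΣ.∑-cong V λ z → trans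
           (ℤΣ.∑ᵗ-cong s V λ zs _ → cong (λ t → h (z ∷ ys) zs ℤ.+ t) (sym (ℤ.-1*i≡-i (h ys zs))))
           (trans (ℤΣ.∑ᵗ-+ s V _ _) (cong (λ t → ℤΣ.∑ᵗ s V (h (z ∷ ys)) ℤ.+ t) (ℤΣ.∑ᵗ-* s V ℤ.-1ℤ (h ys))))) ⟩
    ℤΣ.∑ᵗ r V (λ ys → ℤΣ.∑ V λ z → ℤΣ.∑ᵗ s V (h (z ∷ ys)) ℤ.+ ℤ.-1ℤ ℤ.* ℤΣ.∑ᵗ s V (h ys))
      ≡⟨ ℤΣ.∑ᵗ-cong r V (λ ys _ → trans (ℤΣ.∑-+ V (λ z → ℤΣ.∑ᵗ s V (h (z ∷ ys))) _) (cong (λ t → ℤΣ.∑ V (λ z → ℤΣ.∑ᵗ s V (h (z ∷ ys))) ℤ.+ t)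
           (trans (ℤΣ.∑-* V ℤ.-1ℤ _) (cong (λ t → ℤ.-1ℤ ℤ.* t) (∑-constant V _))))) ⟩
    ℤΣ.∑ᵗ r V (λ ys → ℤΣ.∑ V (λ z → ℤΣ.∑ᵗ s V (h (z ∷ ys))) ℤ.+ ℤ.-1ℤ ℤ.* (+ length V ℤ.* ℤΣ.∑ᵗ s V (h ys)))
      ≡⟨ trans (ℤΣ.∑ᵗ-+ r V _ _) (cong₂ ℤ._+_ (ℤΣ.∑ᵗ-∑-comm r V V λ ys z → ℤΣ.∑ᵗ s V (h (z ∷ ys)))
           (trans (ℤΣ.∑ᵗ-* r V ℤ.-1ℤ _) (cong (λ t → ℤ.-1ℤ ℤ.* t) (ℤΣ.∑ᵗ-* r V (+ length V) _)))) ⟩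
    partial V (suc r) s ℤ.+ ℤ.-1ℤ ℤ.* (+ length V ℤ.* partial V r s)
      ≡⟨ cong (λ t → partial V (suc r) s ℤ.+ t) (ℤ.-1*i≡-i _) ⟩
    partial V (suc r) s ℤ.- + length V ℤ.* partial V r s ∎
    where
    open ≡-Reasoning
    ∑-constant : ∀ V c → ℤΣ.∑ V (λ _ → c) ≡ + length V ℤ.* c
    ∑-constant []      c = sym (ℤ.*-zeroˡ c)
    ∑-constant (x ∷ V) c = trans (cong (λ t → c ℤ.+ t) (∑-constant V c)) (sym (ℤ.suc-* (+ length V) c))

  partial-zero : ∀ V q → partial V q 0 ≡ + ((q !) ℕ.* length (filter independent? (combinations q V)))
  partial-zero V q = begin
    ℤΣ.∑ᵗ q V ι
      ≡⟨ ℤΣ.∑-combinations q V ι-symmetricOffDiagonal ⟨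
    (q !) ℤΣ.⊗ ℤΣ.∑ (combinations q V) ι
      ≡⟨ cong ((q !) ℤΣ.⊗_) (trans (sym (∑-pos (combinations q V) _)) (cong +_ (count (combinations q V)))) ⟩
    (q !) ℤΣ.⊗ + length (filter independent? (combinations q V))
      ≡⟨ trans (⊗≡+* (q !) _) (sym (ℤ.pos-* (q !) _)) ⟩
    + ((q !) ℕ.* length (filter independent? (combinations q V))) ∎
    where
    open ≡-Reasoning
    count : ∀ xss → ℕΣ.∑ xss (λ zs → 𝟙 (independent? zs)) ≡ length (filter independent? xss)
    count []         = refl
    count (xs ∷ xss) with does (independent? xs)
    ... | true  = cong suc (count xss)
    ... | false = count xss

-- Growth of the alternating sums

-- Arguments: degree constant, fuel, number of summed positions, number of given positions.
κBound : ℕ → ℕ → ℕ → ℕ → ℕ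
κBound δ m       zero          l = 1
κBound δ zero    (suc s)       l = 0
κBound δ (suc m) (suc zero)    l = l ℕ.* (δ ℕ.* κBound δ m zero (suc l))
κBound δ (suc m) (suc (suc s)) l = l ℕ.* (δ ℕ.* κBound δ m (suc s) (suc l))
                            ℕ.+ suc s ℕ.* (δ ℕ.* κBound δ m s (suc (suc l)))

growthBound : ℕ → ℕ → ℕ
growthBound δ s = 2 ℕ.^ s ℕ.* κBound δ s s 0

-- The factors follow a cherry: the positions of `w` and then of `v`, 2 for the attacker of `v`
-- being `z` or `w`, one δ for each of the two neighbours, and `κBound` with the three given
-- entries.
recurrenceBound : ℕ → ℕ → ℕ
recurrenceBound δ s = defectBound (suc (suc s)) ℕ.*
  ((suc (suc s) ℕ.* suc s) ℕ.* (2 ℕ.* (δ ℕ.* (δ ℕ.* κBound δ (suc (suc s)) s 3))))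

module Bounded-Degree {A : Set} {_~_ : A → A → Set} (_~?_ : Decidable _~_)
                      (~-refl : Reflexive _~_) (~-sym : Symmetric _~_)
                      (V : List A) (n δ : ℕ) .{{_ : NonZero n}} (length-V : length V ≡ n ℕ.* n)
                      (degree : ∀ z → ℕΣ.∑ V (λ w → 𝟙 (z ~? w)) ℕ.≤ δ ℕ.* n) where

  open Reflexive-Symmetric _~?_ ~-refl ~-sym
  open ℕ.≤-Reasoning

  ∑-neighbours : ∀ z {φ : A → ℕ} (c : ℕ) → (∀ w → φ w ℕ.≤ c) →
                 ℕΣ.∑ V (λ w → 𝟙 (z ~? w) ℕ.* φ w) ℕ.≤ δ ℕ.* n ℕ.* c
  ∑-neighbours z {φ} c b = begin
    ℕΣ.∑ V (λ w → 𝟙 (z ~? w) ℕ.* φ w) ≤⟨ ∑-mono V (λ w → ℕ.*-monoʳ-≤ (𝟙 (z ~? w)) (b w)) ⟩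
    ℕΣ.∑ V (λ w → 𝟙 (z ~? w) ℕ.* c)   ≡⟨ ℕΣ.∑-*ʳ V c _ ⟩
    ℕΣ.∑ V (λ w → 𝟙 (z ~? w)) ℕ.* c   ≤⟨ ℕ.*-monoˡ-≤ c (degree z) ⟩
    δ ℕ.* n ℕ.* c                     ∎

  ∑-squares : {φ : A → ℕ} (c : ℕ) → (∀ z → φ z ℕ.≤ c) → ℕΣ.∑ V φ ℕ.≤ n ℕ.* n ℕ.* c
  ∑-squares c b = ℕ.≤-trans (∑-bound V c b) (ℕ.≤-reflexive (cong (ℕ._* c) length-V))

  ∑ᵗ-∑ᵖ≤ : ∀ q (φ : A → List A → ℕ) (c : ℕ) → ℕΣ.∑ V (λ w → ℕΣ.∑ᵗ q V (φ w)) ℕ.≤ c →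
           ℕΣ.∑ᵗ (suc q) V (λ zs → ℕΣ.∑ᵖ zs φ) ℕ.≤ suc q ℕ.* c
  ∑ᵗ-∑ᵖ≤ q φ c b = begin
    ℕΣ.∑ᵗ (suc q) V (λ zs → ℕΣ.∑ᵖ zs φ)       ≡⟨ ℕΣ.∑ᵗ-∑ᵖ q V φ ⟩
    suc q ℕΣ.⊗ ℕΣ.∑ V (λ w → ℕΣ.∑ᵗ q V (φ w)) ≡⟨ ⊗≡* (suc q) _ ⟩
    suc q ℕ.* ℕΣ.∑ V (λ w → ℕΣ.∑ᵗ q V (φ w))  ≤⟨ ℕ.*-monoʳ-≤ (suc q) b ⟩
    suc q ℕ.* c                               ∎

  n^deg-step : ∀ s → n ℕ.* n ℕ.^ deg s ℕ.≤ n ℕ.^ deg (suc s)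
  n^deg-step s = ℕ.^-monoʳ-≤ n (1+deg≤deg-suc s)

  -- An entry attacked from `ys` has at most δn choices, and a new pair of attacking entries at most
  -- δn³. Since `deg` grows by at least 1 per entry and by exactly 3 per two entries, both branches
  -- of `κ` stay within n^`deg`.
  ∑ᵗ-κ≤ : ∀ m s ys → ℕΣ.∑ᵗ s V (κ m ys) ℕ.≤ κBound δ m s (length ys) ℕ.* n ℕ.^ deg s

  private
    fromGiven : ∀ m s ys →
      ℕΣ.∑ V (λ z → ℕΣ.∑ᵗ s V λ zs → ℕΣ.∑ ys λ y → 𝟙 (y ~? z) ℕ.* κ m (z ∷ ys) zs)
      ℕ.≤ length ys ℕ.* (δ ℕ.* κBound δ m s (suc (length ys))) ℕ.* n ℕ.^ deg (suc s)
    fromGiven m s ys = begin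
      ℕΣ.∑ V (λ z → ℕΣ.∑ᵗ s V λ zs → ℕΣ.∑ ys λ y → 𝟙 (y ~? z) ℕ.* κ m (z ∷ ys) zs)
        ≡⟨ ℕΣ.∑-cong V (λ z → ℕΣ.∑ᵗ-∑-comm s V ys (λ zs y → 𝟙 (y ~? z) ℕ.* κ m (z ∷ ys) zs)) ⟩
      ℕΣ.∑ V (λ z → ℕΣ.∑ ys λ y → ℕΣ.∑ᵗ s V λ zs → 𝟙 (y ~? z) ℕ.* κ m (z ∷ ys) zs)
        ≡⟨ ℕΣ.∑-comm V ys _ ⟩
      ℕΣ.∑ ys (λ y → ℕΣ.∑ V λ z → ℕΣ.∑ᵗ s V λ zs → 𝟙 (y ~? z) ℕ.* κ m (z ∷ ys) zs)
        ≡⟨ ℕΣ.∑-cong ys (λ y → ℕΣ.∑-cong V λ z → ℕΣ.∑ᵗ-* s V (𝟙 (y ~? z)) (κ m (z ∷ ys))) ⟩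
      ℕΣ.∑ ys (λ y → ℕΣ.∑ V λ z → 𝟙 (y ~? z) ℕ.* ℕΣ.∑ᵗ s V (κ m (z ∷ ys)))
        ≤⟨ ∑-bound ys (δ ℕ.* n ℕ.* (c ℕ.* n ℕ.^ deg s)) (λ y → ∑-neighbours y (c ℕ.* n ℕ.^ deg s) λ z → ∑ᵗ-κ≤ m s (z ∷ ys)) ⟩
      length ys ℕ.* (δ ℕ.* n ℕ.* (c ℕ.* n ℕ.^ deg s))
        ≡⟨ lemma (length ys) δ n c (n ℕ.^ deg s) ⟩
      length ys ℕ.* (δ ℕ.* c) ℕ.* (n ℕ.* n ℕ.^ deg s)
        ≤⟨ ℕ.*-monoʳ-≤ (length ys ℕ.* (δ ℕ.* c)) (n^deg-step s) ⟩
      length ys ℕ.* (δ ℕ.* c) ℕ.* n ℕ.^ deg (suc s) ∎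
      where
      c = κBound δ m s (suc (length ys))
      lemma : ∀ l δ n c N → l ℕ.* (δ ℕ.* n ℕ.* (c ℕ.* N)) ≡ l ℕ.* (δ ℕ.* c) ℕ.* (n ℕ.* N)
      lemma = ℕ-solver.solve-∀

    fromSummed : ∀ m s ys →
      ℕΣ.∑ V (λ z → ℕΣ.∑ᵗ (suc s) V λ zs → ℕΣ.∑ᵖ zs λ w ws → 𝟙 (z ~? w) ℕ.* κ m (w ∷ z ∷ ys) ws)
      ℕ.≤ suc s ℕ.* (δ ℕ.* κBound δ m s (suc (suc (length ys)))) ℕ.* n ℕ.^ deg (suc (suc s))
    fromSummed m s ys = begin
      _ ≤⟨ ∑-squares (suc s ℕ.* (δ ℕ.* n ℕ.* (c ℕ.* n ℕ.^ deg s))) (λ z → ∑ᵗ-∑ᵖ≤ s (λ w ws → 𝟙 (z ~? w) ℕ.* κ m (w ∷ z ∷ ys) ws) (δ ℕ.* n ℕ.* (c ℕ.* n ℕ.^ deg s)) (inner z)) ⟩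
      n ℕ.* n ℕ.* (suc s ℕ.* (δ ℕ.* n ℕ.* (c ℕ.* n ℕ.^ deg s)))
        ≡⟨ lemma (suc s) δ n c (n ℕ.^ deg s) ⟩
      suc s ℕ.* (δ ℕ.* c) ℕ.* n ℕ.^ deg (suc (suc s)) ∎
      where
      c = κBound δ m s (suc (suc (length ys)))
      inner : ∀ z → ℕΣ.∑ V (λ w → ℕΣ.∑ᵗ s V λ ws → 𝟙 (z ~? w) ℕ.* κ m (w ∷ z ∷ ys) ws) ℕ.≤ δ ℕ.* n ℕ.* (c ℕ.* n ℕ.^ deg s)
      inner z = begin
        _ ≡⟨ ℕΣ.∑-cong V (λ w → ℕΣ.∑ᵗ-* s V (𝟙 (z ~? w)) (κ m (w ∷ z ∷ ys))) ⟩
        ℕΣ.∑ V (λ w → 𝟙 (z ~? w) ℕ.* ℕΣ.∑ᵗ s V (κ m (w ∷ z ∷ ys)))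
          ≤⟨ ∑-neighbours z (c ℕ.* n ℕ.^ deg s) (λ w → ∑ᵗ-κ≤ m s (w ∷ z ∷ ys)) ⟩
        δ ℕ.* n ℕ.* (c ℕ.* n ℕ.^ deg s) ∎
      lemma : ∀ s δ n c N → n ℕ.* n ℕ.* (s ℕ.* (δ ℕ.* n ℕ.* (c ℕ.* N))) ≡ s ℕ.* (δ ℕ.* c) ℕ.* (n ℕ.* (n ℕ.* (n ℕ.* N)))
      lemma = ℕ-solver.solve-∀

  ∑ᵗ-κ≤ zero    zero          ys = ℕ.≤-refl
  ∑ᵗ-κ≤ (suc m) zero          ys = ℕ.≤-refl
  ∑ᵗ-κ≤ zero    (suc s)       ys = ℕ.≤-reflexive (trans (ℕΣ.∑-cong V λ z → ℕΣ.∑ᵗ-zero s V) (ℕΣ.∑-zero V))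
  ∑ᵗ-κ≤ (suc m) (suc zero)    ys = begin
    ℕΣ.∑ V (λ z → ℕΣ.∑ ys (λ y → 𝟙 (y ~? z) ℕ.* κ m (z ∷ ys) []) ℕ.+ 0)
      ≡⟨ ℕΣ.∑-cong V (λ z → ℕ.+-identityʳ _) ⟩
    _ ≤⟨ fromGiven m zero ys ⟩
    _ ∎
  ∑ᵗ-κ≤ (suc m) (suc (suc s)) ys = begin
    _ ≡⟨ trans (ℕΣ.∑-cong V λ z → ℕΣ.∑ᵗ-+ (suc s) V (given z) (summed z)) (ℕΣ.∑-+ V (λ z → ℕΣ.∑ᵗ (suc s) V (given z)) (λ z → ℕΣ.∑ᵗ (suc s) V (summed z))) ⟩
    ℕΣ.∑ V (λ z → ℕΣ.∑ᵗ (suc s) V (given z)) ℕ.+ ℕΣ.∑ V (λ z → ℕΣ.∑ᵗ (suc s) V (summed z))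
      ≤⟨ ℕ.+-mono-≤ (fromGiven m (suc s) ys) (fromSummed m s ys) ⟩
    length ys ℕ.* (δ ℕ.* κBound δ m (suc s) (suc (length ys))) ℕ.* n ℕ.^ deg (suc (suc s))
      ℕ.+ suc s ℕ.* (δ ℕ.* κBound δ m s (suc (suc (length ys)))) ℕ.* n ℕ.^ deg (suc (suc s))
      ≡⟨ ℕ.*-distribʳ-+ (n ℕ.^ deg (suc (suc s))) (length ys ℕ.* (δ ℕ.* κBound δ m (suc s) (suc (length ys)))) _ ⟨
    κBound δ (suc m) (suc (suc s)) (length ys) ℕ.* n ℕ.^ deg (suc (suc s)) ∎
    where
    given summed : A → List A → ℕ
    given z zs  = ℕΣ.∑ ys λ y → 𝟙 (y ~? z) ℕ.* κ m (z ∷ ys) zs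
    summed z zs = ℕΣ.∑ᵖ zs λ w ws → 𝟙 (z ~? w) ℕ.* κ m (w ∷ z ∷ ys) ws

  ∣∑ᵗ-f∣≤ : ∀ s → ℤ.∣ ℤΣ.∑ᵗ s V f ∣ ℕ.≤ growthBound δ s ℕ.* n ℕ.^ deg s
  ∣∑ᵗ-f∣≤ s = begin
    ℤ.∣ ℤΣ.∑ᵗ s V f ∣                       ≤⟨ ∣∑ᵗ∣≤ s V f ⟩
    ℕΣ.∑ᵗ s V (λ zs → ℤ.∣ f zs ∣)           ≤⟨ ∑ᵗ-mono s V (λ { zs refl → ∣f∣≤ zs }) ⟩
    ℕΣ.∑ᵗ s V (λ zs → 2 ℕ.^ s ℕ.* κ s [] zs) ≡⟨ ℕΣ.∑ᵗ-* s V (2 ℕ.^ s) (κ s []) ⟩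
    2 ℕ.^ s ℕ.* ℕΣ.∑ᵗ s V (κ s [])        ≤⟨ ℕ.*-monoʳ-≤ (2 ℕ.^ s) (∑ᵗ-κ≤ s s []) ⟩
    2 ℕ.^ s ℕ.* (κBound δ s s 0 ℕ.* n ℕ.^ deg s) ≡⟨ ℕ.*-assoc (2 ℕ.^ s) (κBound δ s s 0) _ ⟨
    growthBound δ s ℕ.* n ℕ.^ deg s ∎

  attackingPairs : ℕ
  attackingPairs = ℕΣ.∑ V λ z → ℕΣ.∑ V λ w → 𝟙 (z ~? w)

  -- The partner of `z` may stand in any of `suc s` positions; by `∑ᵗ-∑ᵖ` each position contributes
  -- the number of attacking pairs times the sum of `f` over the remaining entries.
  ∑ᵗ-defect : ∀ s → ℤΣ.∑ᵗ (suc (suc s)) V f ℤ.+ + suc s ℤ.* (+ attackingPairs ℤ.* ℤΣ.∑ᵗ s V f)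
                    ≡ ℤΣ.∑ V (λ z → ℤΣ.∑ᵗ (suc s) V (defect z))
  ∑ᵗ-defect s = trans (cong (λ t → ℤΣ.∑ᵗ (suc (suc s)) V f ℤ.+ t) (sym pairs))
    (sym (trans (ℤΣ.∑-cong V λ z → ℤΣ.∑ᵗ-+ (suc s) V (λ zs → f (z ∷ zs)) (λ zs → ℤΣ.∑ᵖ zs λ w ws → + 𝟙 (z ~? w) ℤ.* f ws))
                (ℤΣ.∑-+ V _ _)))
    where
    pairs : ℤΣ.∑ V (λ z → ℤΣ.∑ᵗ (suc s) V λ zs → ℤΣ.∑ᵖ zs λ w ws → + 𝟙 (z ~? w) ℤ.* f ws)
            ≡ + suc s ℤ.* (+ attackingPairs ℤ.* ℤΣ.∑ᵗ s V f)
    pairs = R.begin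
      ℤΣ.∑ V (λ z → ℤΣ.∑ᵗ (suc s) V λ zs → ℤΣ.∑ᵖ zs λ w ws → + 𝟙 (z ~? w) ℤ.* f ws)
        R.≡⟨ ℤΣ.∑-cong V (λ z → trans (ℤΣ.∑ᵗ-∑ᵖ s V λ w ws → + 𝟙 (z ~? w) ℤ.* f ws) (⊗≡+* (suc s) _)) ⟩
      ℤΣ.∑ V (λ z → + suc s ℤ.* ℤΣ.∑ V λ w → ℤΣ.∑ᵗ s V λ ws → + 𝟙 (z ~? w) ℤ.* f ws)
        R.≡⟨ ℤΣ.∑-* V (+ suc s) _ ⟩
      + suc s ℤ.* ℤΣ.∑ V (λ z → ℤΣ.∑ V λ w → ℤΣ.∑ᵗ s V λ ws → + 𝟙 (z ~? w) ℤ.* f ws)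
        R.≡⟨ cong (λ t → + suc s ℤ.* t) (ℤΣ.∑-cong V λ z → trans
               (ℤΣ.∑-cong V λ w → ℤΣ.∑ᵗ-* s V (+ 𝟙 (z ~? w)) f)
               (ℤΣ.∑-*ʳ V (ℤΣ.∑ᵗ s V f) λ w → + 𝟙 (z ~? w))) ⟩
      + suc s ℤ.* ℤΣ.∑ V (λ z → ℤΣ.∑ V (λ w → + 𝟙 (z ~? w)) ℤ.* ℤΣ.∑ᵗ s V f)
        R.≡⟨ cong (λ t → + suc s ℤ.* t) (ℤΣ.∑-*ʳ V (ℤΣ.∑ᵗ s V f) _) ⟩
      + suc s ℤ.* (ℤΣ.∑ V (λ z → ℤΣ.∑ V (λ w → + 𝟙 (z ~? w))) ℤ.* ℤΣ.∑ᵗ s V f)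
        R.≡⟨ cong (λ t → + suc s ℤ.* (t ℤ.* ℤΣ.∑ᵗ s V f))
               (trans (∑-pos V _) (ℤΣ.∑-cong V λ z → ∑-pos V _)) ⟨
      + suc s ℤ.* (+ attackingPairs ℤ.* ℤΣ.∑ᵗ s V f) R.∎
      where module R = ≡-Reasoning

  ∣∑ᵗ-defect∣≤ : ∀ s → ℤ.∣ ℤΣ.∑ V (λ z → ℤΣ.∑ᵗ (suc s) V (defect z)) ∣
                   ℕ.≤ defectBound (suc s) ℕ.* ℕΣ.∑ V λ z → ℕΣ.∑ᵗ (suc s) V (cherries (suc s) z)
  ∣∑ᵗ-defect∣≤ s = begin
    _ ≤⟨ ∣∑∣≤ V (λ z → ℤΣ.∑ᵗ (suc s) V (defect z)) ⟩
    ℕΣ.∑ V (λ z → ℤ.∣ ℤΣ.∑ᵗ (suc s) V (defect z) ∣)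
      ≤⟨ ∑-mono V (λ z → ∣∑ᵗ∣≤ (suc s) V (defect z)) ⟩
    ℕΣ.∑ V (λ z → ℕΣ.∑ᵗ (suc s) V λ zs → ℤ.∣ defect z zs ∣)
      ≤⟨ ∑-mono V (λ z → ∑ᵗ-mono (suc s) V λ zs l → subst (λ m → ℤ.∣ defect z zs ∣ ℕ.≤ defectBound m ℕ.* cherries (suc s) z zs) l
           (∣defect∣≤cherries (suc s) z zs (ℕ.≤-reflexive l))) ⟩
    ℕΣ.∑ V (λ z → ℕΣ.∑ᵗ (suc s) V λ zs → defectBound (suc s) ℕ.* cherries (suc s) z zs)
      ≡⟨ trans (ℕΣ.∑-cong V λ z → ℕΣ.∑ᵗ-* (suc s) V (defectBound (suc s)) (cherries (suc s) z)) (ℕΣ.∑-* V (defectBound (suc s)) _) ⟩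
    defectBound (suc s) ℕ.* ℕΣ.∑ V (λ z → ℕΣ.∑ᵗ (suc s) V (cherries (suc s) z)) ∎

  -- Here `z` is free and gives n², `w` and `v` are each attached to an earlier entry and give n
  -- each, and the others give n^`deg s`. For odd `s` the exponent is one below `deg (3 + s)`.
  ∑ᵗ-cherries≤ : ∀ m s → ℕΣ.∑ V (λ z → ℕΣ.∑ᵗ (suc (suc s)) V (cherries m z))
    ℕ.≤ (suc (suc s) ℕ.* suc s) ℕ.* (2 ℕ.* (δ ℕ.* (δ ℕ.* κBound δ m s 3))) ℕ.* n ℕ.^ (4 ℕ.+ deg s)
  ∑ᵗ-cherries≤ m s = begin
    _ ≤⟨ ∑-squares (suc (suc s) ℕ.* D₂) (λ z → ∑ᵗ-∑ᵖ≤ (suc s) (λ w ws → 𝟙 (z ~? w) ℕ.* tips z w ws) D₂ (middle z)) ⟩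
    n ℕ.* n ℕ.* (suc (suc s) ℕ.* D₂) ≡⟨ lemma (suc (suc s)) (suc s) δ n (κBound δ m s 3) (n ℕ.^ deg s) ⟩
    _ ∎
    where
    D₀ = κBound δ m s 3 ℕ.* n ℕ.^ deg s
    D₁ = suc s ℕ.* (δ ℕ.* n ℕ.* D₀ ℕ.+ δ ℕ.* n ℕ.* D₀)
    D₂ = δ ℕ.* n ℕ.* D₁
    lemma : ∀ s₂ s₁ δ n c N → n ℕ.* n ℕ.* (s₂ ℕ.* (δ ℕ.* n ℕ.* (s₁ ℕ.* (δ ℕ.* n ℕ.* (c ℕ.* N) ℕ.+ δ ℕ.* n ℕ.* (c ℕ.* N)))))
            ≡ (s₂ ℕ.* s₁) ℕ.* (2 ℕ.* (δ ℕ.* (δ ℕ.* c))) ℕ.* (n ℕ.* (n ℕ.* (n ℕ.* (n ℕ.* N))))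
    lemma = ℕ-solver.solve-∀
    inner : ∀ z w → ℕΣ.∑ V (λ v → ℕΣ.∑ᵗ s V λ vs → (𝟙 (z ~? v) ℕ.+ 𝟙 (w ~? v)) ℕ.* κ m (v ∷ w ∷ z ∷ []) vs)
                    ℕ.≤ δ ℕ.* n ℕ.* D₀ ℕ.+ δ ℕ.* n ℕ.* D₀
    inner z w = begin
      _ ≡⟨ ℕΣ.∑-cong V (λ v → trans (ℕΣ.∑ᵗ-* s V (𝟙 (z ~? v) ℕ.+ 𝟙 (w ~? v)) (κ m (v ∷ w ∷ z ∷ [])))
                                    (ℕ.*-distribʳ-+ (K v) (𝟙 (z ~? v)) (𝟙 (w ~? v)))) ⟩
      ℕΣ.∑ V (λ v → 𝟙 (z ~? v) ℕ.* K v ℕ.+ 𝟙 (w ~? v) ℕ.* K v)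
        ≡⟨ ℕΣ.∑-+ V _ _ ⟩
      ℕΣ.∑ V (λ v → 𝟙 (z ~? v) ℕ.* K v) ℕ.+ ℕΣ.∑ V (λ v → 𝟙 (w ~? v) ℕ.* K v)
        ≤⟨ ℕ.+-mono-≤ (∑-neighbours z D₀ λ v → ∑ᵗ-κ≤ m s (v ∷ w ∷ z ∷ []))
                      (∑-neighbours w D₀ λ v → ∑ᵗ-κ≤ m s (v ∷ w ∷ z ∷ [])) ⟩
      δ ℕ.* n ℕ.* D₀ ℕ.+ δ ℕ.* n ℕ.* D₀ ∎
      where
      K : A → ℕ
      K v = ℕΣ.∑ᵗ s V (κ m (v ∷ w ∷ z ∷ []))
    tips : A → A → List A → ℕ
    tips z w ws = ℕΣ.∑ᵖ ws λ v vs → (𝟙 (z ~? v) ℕ.+ 𝟙 (w ~? v)) ℕ.* κ m (v ∷ w ∷ z ∷ []) vs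
    middle : ∀ z → ℕΣ.∑ V (λ w → ℕΣ.∑ᵗ (suc s) V λ ws → 𝟙 (z ~? w) ℕ.* tips z w ws) ℕ.≤ D₂
    middle z = begin
      _ ≡⟨ ℕΣ.∑-cong V (λ w → ℕΣ.∑ᵗ-* (suc s) V (𝟙 (z ~? w)) (tips z w)) ⟩
      ℕΣ.∑ V (λ w → 𝟙 (z ~? w) ℕ.* ℕΣ.∑ᵗ (suc s) V (tips z w))
        ≤⟨ ∑-neighbours z D₁ (λ w → ∑ᵗ-∑ᵖ≤ s (λ v vs → (𝟙 (z ~? v) ℕ.+ 𝟙 (w ~? v)) ℕ.* κ m (v ∷ w ∷ z ∷ []) vs) (δ ℕ.* n ℕ.* D₀ ℕ.+ δ ℕ.* n ℕ.* D₀) (inner z w)) ⟩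
      D₂ ∎

  -- Two entries leave no room for a third one, so there are no cherries and the recurrence is
  -- exact. `∑ᵗ-f-recurrence` starts only at three entries.
  ∑ᵗ-f-base : ℤΣ.∑ᵗ 2 V f ≡ ℤ.- + attackingPairs
  ∑ᵗ-f-base = inverseˡ-unique _ _ (trans (cong (λ t → ℤΣ.∑ᵗ 2 V f ℤ.+ t) (lemma (+ attackingPairs)))
    (trans (∑ᵗ-defect 0) (ℤ.∣i∣≡0⇒i≡0 (ℕ.n≤0⇒n≡0 (begin
      _ ≤⟨ ∣∑ᵗ-defect∣≤ 0 ⟩
      defectBound 1 ℕ.* ℕΣ.∑ V (λ z → ℕΣ.∑ V λ w → 𝟙 (z ~? w) ℕ.* 0 ℕ.+ 0)
        ≡⟨ cong (defectBound 1 ℕ.*_) (trans (ℕΣ.∑-cong V λ z → trans (ℕΣ.∑-cong V λ w →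
             trans (ℕ.+-identityʳ _) (ℕ.*-zeroʳ (𝟙 (z ~? w)))) (ℕΣ.∑-zero V)) (ℕΣ.∑-zero V)) ⟩
      defectBound 1 ℕ.* 0 ≡⟨⟩
      0 ∎)))))
    where
    lemma : ∀ x → x ≡ + 1 ℤ.* (x ℤ.* + 1)
    lemma = ℤ-solver.solve-∀

  ∑ᵗ-f-recurrence : ∀ s → ℤ.∣ ℤΣ.∑ᵗ (suc (suc (suc s))) V f
                            ℤ.+ + suc (suc s) ℤ.* (+ attackingPairs ℤ.* ℤΣ.∑ᵗ (suc s) V f) ∣
                          ℕ.≤ recurrenceBound δ s ℕ.* n ℕ.^ (4 ℕ.+ deg s)
  ∑ᵗ-f-recurrence s = begin
    _ ≡⟨ cong ℤ.∣_∣ (∑ᵗ-defect (suc s)) ⟩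
    _ ≤⟨ ∣∑ᵗ-defect∣≤ (suc s) ⟩
    defectBound (suc (suc s)) ℕ.* ℕΣ.∑ V (λ z → ℕΣ.∑ᵗ (suc (suc s)) V (cherries (suc (suc s)) z))
      ≤⟨ ℕ.*-monoʳ-≤ (defectBound (suc (suc s))) (∑ᵗ-cherries≤ (suc (suc s)) s) ⟩
    _ ≡⟨ ℕ.*-assoc (defectBound (suc (suc s))) _ (n ℕ.^ (4 ℕ.+ deg s)) ⟨
    recurrenceBound δ s ℕ.* n ℕ.^ (4 ℕ.+ deg s) ∎

-- Counting attacking pairs on the board

∑< : ℕ → (ℕ → ℕ) → ℕ
∑< zero    g = 0
∑< (suc n) g = ∑< n g ℕ.+ g n

∑<-cong : ∀ n {g g′ : ℕ → ℕ} → (∀ i → i ℕ.< n → g i ≡ g′ i) → ∑< n g ≡ ∑< n g′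
∑<-cong zero    e = refl
∑<-cong (suc n) e = cong₂ ℕ._+_ (∑<-cong n λ i i<n → e i (ℕ.m<n⇒m<1+n i<n)) (e n ℕ.≤-refl)

∑<-≗ : ∀ n {g g′ : ℕ → ℕ} → (∀ i → g i ≡ g′ i) → ∑< n g ≡ ∑< n g′
∑<-≗ n e = ∑<-cong n λ i _ → e i

∑<-suc : ∀ n (g : ℕ → ℕ) → ∑< (suc n) g ≡ g 0 ℕ.+ ∑< n (g ∘ suc)
∑<-suc zero    g = sym (ℕ.+-identityʳ (g 0))
∑<-suc (suc n) g = trans (cong (ℕ._+ g (suc n)) (∑<-suc n g)) (ℕ.+-assoc (g 0) _ _)

∑<-+ : ∀ n (g g′ : ℕ → ℕ) → ∑< n (λ i → g i ℕ.+ g′ i) ≡ ∑< n g ℕ.+ ∑< n g′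
∑<-+ zero    g g′ = refl
∑<-+ (suc n) g g′ rewrite ∑<-+ n g g′ = lemma (∑< n g) (∑< n g′) (g n) (g′ n)
  where
  lemma : ∀ a b c d → a ℕ.+ b ℕ.+ (c ℕ.+ d) ≡ a ℕ.+ c ℕ.+ (b ℕ.+ d)
  lemma = ℕ-solver.solve-∀

∑<-zero : ∀ n → ∑< n (λ _ → 0) ≡ 0
∑<-zero zero    = refl
∑<-zero (suc n) = trans (ℕ.+-identityʳ _) (∑<-zero n)

∑<-const : ∀ n c → ∑< n (λ _ → c) ≡ n ℕ.* c
∑<-const zero    c = refl
∑<-const (suc n) c = trans (cong (ℕ._+ c) (∑<-const n c)) (ℕ.+-comm (n ℕ.* c) c)

∑<-bound : ∀ n {g : ℕ → ℕ} c → (∀ i → g i ℕ.≤ c) → ∑< n g ℕ.≤ n ℕ.* c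
∑<-bound zero    c b = z≤n
∑<-bound (suc n) c b = ℕ.≤-trans (ℕ.+-mono-≤ (∑<-bound n c b) (b n)) (ℕ.≤-reflexive (ℕ.+-comm (n ℕ.* c) c))

∑<-comm : ∀ m n (g : ℕ → ℕ → ℕ) → ∑< m (λ i → ∑< n (g i)) ≡ ∑< n (λ j → ∑< m (λ i → g i j))
∑<-comm zero    n g = sym (∑<-zero n)
∑<-comm (suc m) n g = trans (cong (ℕ._+ ∑< n (g m)) (∑<-comm m n g)) (sym (∑<-+ n _ (g m)))

∑<-reverse : ∀ m (g : ℕ → ℕ) → ∑< m (λ p → g (m ∸ p)) ≡ ∑< m (g ∘ suc)
∑<-reverse zero    g = refl
∑<-reverse (suc m) g = trans (∑<-suc m _)
  (trans (cong (g (suc m) ℕ.+_) (∑<-reverse m g)) (ℕ.+-comm (g (suc m)) _))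

∑<-unique : ∀ n {P : ℕ → Set} (P? : ∀ i → Dec (P i)) → (∀ {i j} → P i → P j → i ≡ j) →
            ∑< n (λ i → 𝟙 (P? i)) ℕ.≤ 1
∑<-unique zero    P? u = z≤n
∑<-unique (suc n) {P} P? u with P? n
... | no  _  = ℕ.≤-trans (ℕ.≤-reflexive (ℕ.+-identityʳ _)) (∑<-unique n P? u)
... | yes pn = ℕ.≤-reflexive (cong (ℕ._+ 1) (trans
      (∑<-cong n λ i i<n → 𝟙-no (P? i) λ pi → ℕ.<⇒≢ i<n (u pi pn)) (∑<-zero n)))

∑<-≟ : ∀ n v → ∑< n (λ r → 𝟙 (r ℕ.≟ v)) ≡ 𝟙 (v ℕ.<? n)
∑<-≟ zero    v = refl
∑<-≟ (suc n) v with n ℕ.≟ v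
... | yes refl = trans (cong₂ ℕ._+_ (trans (∑<-cong n λ i i<n → 𝟙-no (i ℕ.≟ n) (ℕ.<⇒≢ i<n)) (∑<-zero n))
                                    (𝟙-yes (n ℕ.≟ n) refl))
                       (sym (𝟙-yes (n ℕ.<? suc n) (ℕ.n<1+n n)))
... | no n≢v   = trans (cong₂ ℕ._+_ (∑<-≟ n v) (𝟙-no (n ℕ.≟ v) n≢v)) (trans (ℕ.+-identityʳ _)
                   (𝟙-⇔ (v ℕ.<? n) (v ℕ.<? suc n) ℕ.m<n⇒m<1+n λ v<1+n → ℕ.≤∧≢⇒< (ℕ.≤-pred v<1+n) (n≢v ∘ sym)))

∑<-+<? : ∀ n d → ∑< n (λ s → 𝟙 (s ℕ.+ d ℕ.<? n)) ≡ n ∸ d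
∑<-+<? zero    d = sym (ℕ.0∸n≡0 d)
∑<-+<? (suc n) d = begin
  ∑< (suc n) (λ s → 𝟙 (s ℕ.+ d ℕ.<? suc n))
    ≡⟨ ∑<-suc n _ ⟩
  𝟙 (d ℕ.<? suc n) ℕ.+ ∑< n (λ s → 𝟙 (suc s ℕ.+ d ℕ.<? suc n))
    ≡⟨ cong (𝟙 (d ℕ.<? suc n) ℕ.+_) (trans (∑<-≗ n λ s → 𝟙-⇔ (suc s ℕ.+ d ℕ.<? suc n) (s ℕ.+ d ℕ.<? n) ℕ.≤-pred s≤s) (∑<-+<? n d)) ⟩
  𝟙 (d ℕ.<? suc n) ℕ.+ (n ∸ d)
    ≡⟨ step ⟩
  suc n ∸ d ∎
  where
  open ≡-Reasoning
  step : 𝟙 (d ℕ.<? suc n) ℕ.+ (n ∸ d) ≡ suc n ∸ d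
  step with d ℕ.<? suc n
  ... | yes d<1+n = trans (cong (ℕ._+ (n ∸ d)) (𝟙-yes (d ℕ.<? suc n) d<1+n)) (sym (ℕ.+-∸-assoc 1 (ℕ.≤-pred d<1+n)))
  ... | no  d≮1+n = trans (cong₂ ℕ._+_ (𝟙-no (d ℕ.<? suc n) d≮1+n) (ℕ.m≤n⇒m∸n≡0 (ℕ.≤-trans (ℕ.n≤1+n n) (ℕ.≮⇒≥ d≮1+n)))) (sym (ℕ.m≤n⇒m∸n≡0 (ℕ.≮⇒≥ d≮1+n)))

-- The line equation r - s = 2 (q - p) rearranged over ℕ. The equation of each of the four moves has
-- this shape for some order of the coordinates.
slope : ℕ → ℕ → ℕ → ℕ → ℕ
slope p q r s = 𝟙 (r ℕ.+ 2 ℕ.* p ℕ.≟ s ℕ.+ 2 ℕ.* q)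

strip : ℕ → ℕ → ℕ → ℕ
strip n p q = ∑< n λ r → ∑< n λ s → slope p q r s

∑<-shift : ∀ n d → ∑< n (λ s → ∑< n λ r → 𝟙 (r ℕ.≟ s ℕ.+ d)) ≡ n ∸ d
∑<-shift n d = trans (∑<-≗ n λ s → ∑<-≟ n (s ℕ.+ d)) (∑<-+<? n d)

-- For columns at distance c the equation reads r = s + 2c, so the count is over those s for which s
-- + 2c still lies on the board. With `strip-sym` this settles all pairs of columns.
strip-above : ∀ n p c → strip n p (c ℕ.+ p) ≡ n ∸ 2 ℕ.* c
strip-above n p c = trans (∑<-comm n n _)
  (trans (∑<-≗ n λ s → ∑<-≗ n λ r → 𝟙-⇔ (r ℕ.+ 2 ℕ.* p ℕ.≟ s ℕ.+ 2 ℕ.* (c ℕ.+ p)) (r ℕ.≟ s ℕ.+ 2 ℕ.* c)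
           (λ eq → ℕ.+-cancelʳ-≡ (2 ℕ.* p) r _ (trans eq (lemma s c p)))
           (λ eq → trans (cong (ℕ._+ 2 ℕ.* p) eq) (sym (lemma s c p))))
         (∑<-shift n (2 ℕ.* c)))
  where
  lemma : ∀ s c p → s ℕ.+ 2 ℕ.* (c ℕ.+ p) ≡ s ℕ.+ 2 ℕ.* c ℕ.+ 2 ℕ.* p
  lemma = ℕ-solver.solve-∀

strip-sym : ∀ n p q → strip n p q ≡ strip n q p
strip-sym n p q = trans (∑<-comm n n _)
  (∑<-≗ n λ s → ∑<-≗ n λ r → 𝟙-⇔ (r ℕ.+ 2 ℕ.* p ℕ.≟ s ℕ.+ 2 ℕ.* q) (s ℕ.+ 2 ℕ.* q ℕ.≟ r ℕ.+ 2 ℕ.* p) sym sym)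

-- The number of solutions between column m and the columns below it, arranged by the distance
-- `suc c`.
P : ℕ → ℕ → ℕ
P n m = ∑< m λ c → n ∸ 2 ℕ.* suc c

∑<-strip : ∀ n m → ∑< m (λ p → strip n p m) ≡ P n m
∑<-strip n m = trans (∑<-cong m λ p p<m → trans
    (cong (strip n p) (sym (ℕ.m∸n+n≡m (ℕ.<⇒≤ p<m)))) (strip-above n p (m ∸ p)))
  (∑<-reverse m λ c → n ∸ 2 ℕ.* c)

collinearPairs : ℕ → ℕ
collinearPairs n = ∑< n λ p → ∑< n λ q → strip n p q

-- Enlarging the square of column pairs from m to m + 1 adds a row and a column, equal by symmetry,
-- and one diagonal entry of value n.
∑<-∑<-strip : ∀ n m → ∑< m (λ p → ∑< m λ q → strip n p q) ≡ m ℕ.* n ℕ.+ 2 ℕ.* ∑< m (P n)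
∑<-∑<-strip n zero    = refl
∑<-∑<-strip n (suc m) = begin
  ∑< m (λ p → ∑< m (strip n p) ℕ.+ strip n p m) ℕ.+ (∑< m (strip n m) ℕ.+ strip n m m)
    ≡⟨ cong₂ ℕ._+_ (trans (∑<-+ m _ _) (cong₂ ℕ._+_ (∑<-∑<-strip n m) (∑<-strip n m)))
         (cong₂ ℕ._+_ (trans (∑<-≗ m (strip-sym n m)) (∑<-strip n m)) (strip-above n m 0)) ⟩
  (m ℕ.* n ℕ.+ 2 ℕ.* ∑< m (P n) ℕ.+ P n m) ℕ.+ (P n m ℕ.+ n)
    ≡⟨ lemma (m ℕ.* n) (∑< m (P n)) (P n m) n ⟩
  n ℕ.+ m ℕ.* n ℕ.+ 2 ℕ.* (∑< m (P n) ℕ.+ P n m) ∎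
  where
  open ≡-Reasoning
  lemma : ∀ a b c n → (a ℕ.+ 2 ℕ.* b ℕ.+ c) ℕ.+ (c ℕ.+ n) ≡ n ℕ.+ a ℕ.+ 2 ℕ.* (b ℕ.+ c)
  lemma = ℕ-solver.solve-∀

-- Removing the first summand is the same as lowering n by 2, which is why all estimates below
-- proceed in steps of 2.
P-suc : ∀ n m → P (2 ℕ.+ n) (suc m) ≡ n ℕ.+ P n m
P-suc n m = trans (∑<-suc m _) (cong (n ℕ.+_) (∑<-≗ m λ c → cong (2 ℕ.+ n ∸_) (ℕ.*-suc 2 (suc c))))

R : ℕ → ℕ
R n = P n n

Q : ℕ → ℕ
Q n = ∑< n (P n)

-- `P-suc` leaves one summand too many, but there 2 (n + 1) exceeds n and truncated subtraction
-- gives 0.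
R-step : ∀ n → R (2 ℕ.+ n) ≡ n ℕ.+ R n
R-step n = trans (P-suc n (suc n)) (cong (n ℕ.+_) (trans (cong (R n ℕ.+_)
  (ℕ.m≤n⇒m∸n≡0 (ℕ.≤-trans (ℕ.n≤1+n n) (ℕ.m≤m+n (suc n) _)))) (ℕ.+-identityʳ (R n))))

Q-step : ∀ n → Q (2 ℕ.+ n) ≡ suc n ℕ.* n ℕ.+ (Q n ℕ.+ R n)
Q-step n = trans (∑<-suc (suc n) (P (2 ℕ.+ n))) (trans (∑<-≗ (suc n) (P-suc n))
  (trans (∑<-+ (suc n) (λ _ → n) (P n)) (cong (ℕ._+ (Q n ℕ.+ R n)) (∑<-const (suc n) n))))

-- R n = n²/4 + O(n) and Q n = 5n³/24 + O(n²), by induction in steps of 2.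
module _ where
  open ℕ.≤-Reasoning

  -- In fact 4 `R n` is (n - 1)² for odd n and (n - 1)² - 1 for even n; thus this bound is attained
  -- for odd n and `R-lower` for even n.
  R-upper : ∀ n → 4 ℕ.* R n ℕ.+ 2 ℕ.* n ℕ.≤ n ℕ.* n ℕ.+ 1
  R-upper 0 = z≤n
  R-upper 1 = ℕ.≤-refl
  R-upper (suc (suc n)) = begin
    4 ℕ.* R (2 ℕ.+ n) ℕ.+ 2 ℕ.* (2 ℕ.+ n) ≡⟨ cong (λ r → 4 ℕ.* r ℕ.+ 2 ℕ.* (2 ℕ.+ n)) (R-step n) ⟩
    4 ℕ.* (n ℕ.+ R n) ℕ.+ 2 ℕ.* (2 ℕ.+ n) ≡⟨ l n (R n) ⟩
    (4 ℕ.* R n ℕ.+ 2 ℕ.* n) ℕ.+ (4 ℕ.* n ℕ.+ 4) ≤⟨ ℕ.+-monoˡ-≤ (4 ℕ.* n ℕ.+ 4) (R-upper n) ⟩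
    (n ℕ.* n ℕ.+ 1) ℕ.+ (4 ℕ.* n ℕ.+ 4) ≡⟨ r n ⟩
    (2 ℕ.+ n) ℕ.* (2 ℕ.+ n) ℕ.+ 1 ∎
    where
    l : ∀ n R → 4 ℕ.* (n ℕ.+ R) ℕ.+ 2 ℕ.* (2 ℕ.+ n) ≡ (4 ℕ.* R ℕ.+ 2 ℕ.* n) ℕ.+ (4 ℕ.* n ℕ.+ 4)
    l = ℕ-solver.solve-∀
    r : ∀ n → (n ℕ.* n ℕ.+ 1) ℕ.+ (4 ℕ.* n ℕ.+ 4) ≡ (2 ℕ.+ n) ℕ.* (2 ℕ.+ n) ℕ.+ 1
    r = ℕ-solver.solve-∀

  R-lower : ∀ n → n ℕ.* n ℕ.≤ 4 ℕ.* R n ℕ.+ 2 ℕ.* n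
  R-lower 0 = z≤n
  R-lower 1 = s≤s z≤n
  R-lower (suc (suc n)) = begin
    (2 ℕ.+ n) ℕ.* (2 ℕ.+ n) ≡⟨ l n ⟩
    n ℕ.* n ℕ.+ (4 ℕ.* n ℕ.+ 4) ≤⟨ ℕ.+-monoˡ-≤ (4 ℕ.* n ℕ.+ 4) (R-lower n) ⟩
    (4 ℕ.* R n ℕ.+ 2 ℕ.* n) ℕ.+ (4 ℕ.* n ℕ.+ 4) ≡⟨ r n (R n) ⟩
    4 ℕ.* (n ℕ.+ R n) ℕ.+ 2 ℕ.* (2 ℕ.+ n) ≡⟨ cong (λ r → 4 ℕ.* r ℕ.+ 2 ℕ.* (2 ℕ.+ n)) (R-step n) ⟨
    4 ℕ.* R (2 ℕ.+ n) ℕ.+ 2 ℕ.* (2 ℕ.+ n) ∎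
    where
    l : ∀ n → (2 ℕ.+ n) ℕ.* (2 ℕ.+ n) ≡ n ℕ.* n ℕ.+ (4 ℕ.* n ℕ.+ 4)
    l = ℕ-solver.solve-∀
    r : ∀ n R → (4 ℕ.* R ℕ.+ 2 ℕ.* n) ℕ.+ (4 ℕ.* n ℕ.+ 4) ≡ 4 ℕ.* (n ℕ.+ R) ℕ.+ 2 ℕ.* (2 ℕ.+ n)
    r = ℕ-solver.solve-∀

  -- The constant 5/24 arises because `P n m` is about mn - m² up to m = n/2 and about n²/4
  -- afterwards; summing over m gives n³/12 + n³/8.
  Q-upper : ∀ n → 24 ℕ.* Q n ℕ.≤ 5 ℕ.* (n ℕ.* (n ℕ.* n))
  Q-upper 0 = z≤n
  Q-upper 1 = z≤n
  -- Adding 12n to both sides completes 24 `R n` to 6 (4 `R n` + 2n), the left side of `R-upper`.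
  Q-upper (suc (suc n)) = ℕ.+-cancelʳ-≤ (12 ℕ.* n) _ _ (begin
    24 ℕ.* Q (2 ℕ.+ n) ℕ.+ 12 ℕ.* n ≡⟨ cong (λ q → 24 ℕ.* q ℕ.+ 12 ℕ.* n) (Q-step n) ⟩
    24 ℕ.* (suc n ℕ.* n ℕ.+ (Q n ℕ.+ R n)) ℕ.+ 12 ℕ.* n ≡⟨ l n (Q n) (R n) ⟩
    24 ℕ.* Q n ℕ.+ 6 ℕ.* (4 ℕ.* R n ℕ.+ 2 ℕ.* n) ℕ.+ 24 ℕ.* (n ℕ.* n ℕ.+ n)
      ≤⟨ ℕ.+-monoˡ-≤ (24 ℕ.* (n ℕ.* n ℕ.+ n)) (ℕ.+-mono-≤ (Q-upper n) (ℕ.*-monoʳ-≤ 6 (R-upper n))) ⟩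
    5 ℕ.* (n ℕ.* (n ℕ.* n)) ℕ.+ 6 ℕ.* (n ℕ.* n ℕ.+ 1) ℕ.+ 24 ℕ.* (n ℕ.* n ℕ.+ n) ≤⟨ ℕ.m≤m+n _ (48 ℕ.* n ℕ.+ 34) ⟩
    5 ℕ.* (n ℕ.* (n ℕ.* n)) ℕ.+ 6 ℕ.* (n ℕ.* n ℕ.+ 1) ℕ.+ 24 ℕ.* (n ℕ.* n ℕ.+ n) ℕ.+ (48 ℕ.* n ℕ.+ 34) ≡⟨ r n ⟩
    5 ℕ.* ((2 ℕ.+ n) ℕ.* ((2 ℕ.+ n) ℕ.* (2 ℕ.+ n))) ℕ.+ 12 ℕ.* n ∎)
    where
    l : ∀ n Q R → 24 ℕ.* (suc n ℕ.* n ℕ.+ (Q ℕ.+ R)) ℕ.+ 12 ℕ.* n ≡ 24 ℕ.* Q ℕ.+ 6 ℕ.* (4 ℕ.* R ℕ.+ 2 ℕ.* n) ℕ.+ 24 ℕ.* (n ℕ.* n ℕ.+ n)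
    l = ℕ-solver.solve-∀
    r : ∀ n → 5 ℕ.* (n ℕ.* (n ℕ.* n)) ℕ.+ 6 ℕ.* (n ℕ.* n ℕ.+ 1) ℕ.+ 24 ℕ.* (n ℕ.* n ℕ.+ n) ℕ.+ (48 ℕ.* n ℕ.+ 34)
              ≡ 5 ℕ.* ((2 ℕ.+ n) ℕ.* ((2 ℕ.+ n) ℕ.* (2 ℕ.+ n))) ℕ.+ 12 ℕ.* n
    r = ℕ-solver.solve-∀

  Q-lower : ∀ n → 5 ℕ.* (n ℕ.* (n ℕ.* n)) ℕ.≤ 24 ℕ.* Q n ℕ.+ 12 ℕ.* (n ℕ.* n)
  Q-lower 0 = z≤n
  Q-lower 1 = ℕ.m≤m+n 5 7
  Q-lower (suc (suc n)) = begin
    5 ℕ.* ((2 ℕ.+ n) ℕ.* ((2 ℕ.+ n) ℕ.* (2 ℕ.+ n))) ≡⟨ l n ⟩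
    5 ℕ.* (n ℕ.* (n ℕ.* n)) ℕ.+ 6 ℕ.* (n ℕ.* n) ℕ.+ (24 ℕ.* (n ℕ.* n) ℕ.+ 60 ℕ.* n ℕ.+ 40)
      ≤⟨ ℕ.+-mono-≤ (ℕ.+-mono-≤ (Q-lower n) (ℕ.*-monoʳ-≤ 6 (R-lower n))) (ℕ.+-monoʳ-≤ (24 ℕ.* (n ℕ.* n) ℕ.+ 60 ℕ.* n) (ℕ.m≤m+n 40 8)) ⟩
    (24 ℕ.* Q n ℕ.+ 12 ℕ.* (n ℕ.* n)) ℕ.+ 6 ℕ.* (4 ℕ.* R n ℕ.+ 2 ℕ.* n) ℕ.+ (24 ℕ.* (n ℕ.* n) ℕ.+ 60 ℕ.* n ℕ.+ 48) ≡⟨ r n (Q n) (R n) ⟩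
    24 ℕ.* (suc n ℕ.* n ℕ.+ (Q n ℕ.+ R n)) ℕ.+ 12 ℕ.* ((2 ℕ.+ n) ℕ.* (2 ℕ.+ n))
      ≡⟨ cong (λ q → 24 ℕ.* q ℕ.+ 12 ℕ.* ((2 ℕ.+ n) ℕ.* (2 ℕ.+ n))) (Q-step n) ⟨
    24 ℕ.* Q (2 ℕ.+ n) ℕ.+ 12 ℕ.* ((2 ℕ.+ n) ℕ.* (2 ℕ.+ n)) ∎
    where
    l : ∀ n → 5 ℕ.* ((2 ℕ.+ n) ℕ.* ((2 ℕ.+ n) ℕ.* (2 ℕ.+ n))) ≡ 5 ℕ.* (n ℕ.* (n ℕ.* n)) ℕ.+ 6 ℕ.* (n ℕ.* n) ℕ.+ (24 ℕ.* (n ℕ.* n) ℕ.+ 60 ℕ.* n ℕ.+ 40)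
    l = ℕ-solver.solve-∀
    r : ∀ n Q R → (24 ℕ.* Q ℕ.+ 12 ℕ.* (n ℕ.* n)) ℕ.+ 6 ℕ.* (4 ℕ.* R ℕ.+ 2 ℕ.* n) ℕ.+ (24 ℕ.* (n ℕ.* n) ℕ.+ 60 ℕ.* n ℕ.+ 48)
                ≡ 24 ℕ.* (suc n ℕ.* n ℕ.+ (Q ℕ.+ R)) ℕ.+ 12 ℕ.* ((2 ℕ.+ n) ℕ.* (2 ℕ.+ n))
    r = ℕ-solver.solve-∀

private
  12*collinearPairs : ∀ n → 12 ℕ.* collinearPairs n ≡ 24 ℕ.* Q n ℕ.+ 12 ℕ.* (n ℕ.* n)
  12*collinearPairs n = trans (cong (12 ℕ.*_) (∑<-∑<-strip n n)) (lemma (n ℕ.* n) (Q n))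
    where
    lemma : ∀ a b → 12 ℕ.* (a ℕ.+ 2 ℕ.* b) ≡ 24 ℕ.* b ℕ.+ 12 ℕ.* a
    lemma = ℕ-solver.solve-∀

collinearPairs-lower : ∀ n → 5 ℕ.* (n ℕ.* (n ℕ.* n)) ℕ.≤ 12 ℕ.* collinearPairs n
collinearPairs-lower n = ℕ.≤-trans (Q-lower n) (ℕ.≤-reflexive (sym (12*collinearPairs n)))

collinearPairs-upper : ∀ n → 12 ℕ.* collinearPairs n ℕ.≤ 5 ℕ.* (n ℕ.* (n ℕ.* n)) ℕ.+ 12 ℕ.* (n ℕ.* n)
collinearPairs-upper n = ℕ.≤-trans (ℕ.≤-reflexive (12*collinearPairs n)) (ℕ.+-monoˡ-≤ (12 ℕ.* (n ℕ.* n)) (Q-upper n))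

-- The indicator that (x′ , y′) − (x , y) is a multiple of move j, with no subtraction.
onLine : Fin 4 → ℕ → ℕ → ℕ → ℕ → ℕ
onLine 0F x y x′ y′ = slope x x′ y′ y
onLine 1F x y x′ y′ = slope y y′ x′ x
onLine 2F x y x′ y′ = slope x′ x y′ y
onLine 3F x y x′ y′ = slope y′ y x′ x

private
  pos-+2* : ∀ a b → + (a ℕ.+ 2 ℕ.* b) ≡ + a ℤ.+ + 2 ℤ.* + b
  pos-+2* a b = trans (ℤ.pos-+ a (2 ℕ.* b)) (cong (λ t → + a ℤ.+ t) (ℤ.pos-* 2 b))

  rise⇒slope : ∀ c p q r s → + q ℤ.- + p ≡ c → + r ℤ.- + s ≡ + 2 ℤ.* c → r ℕ.+ 2 ℕ.* p ≡ s ℕ.+ 2 ℕ.* q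
  rise⇒slope c p q r s e₁ e₂ = ℤ.+-injective (begin
    + (r ℕ.+ 2 ℕ.* p) ≡⟨ pos-+2* r p ⟩
    + r ℤ.+ + 2 ℤ.* + p ≡⟨ l (+ r) (+ s) (+ p) ⟩
    (+ r ℤ.- + s) ℤ.+ (+ s ℤ.+ + 2 ℤ.* + p) ≡⟨ cong (λ t → t ℤ.+ (+ s ℤ.+ + 2 ℤ.* + p)) (trans e₂ (cong (λ t → + 2 ℤ.* t) (sym e₁))) ⟩
    + 2 ℤ.* (+ q ℤ.- + p) ℤ.+ (+ s ℤ.+ + 2 ℤ.* + p) ≡⟨ m (+ q) (+ s) (+ p) ⟩
    + s ℤ.+ + 2 ℤ.* + q ≡⟨ pos-+2* s q ⟨
    + (s ℕ.+ 2 ℕ.* q) ∎)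
    where
    open ≡-Reasoning
    l : ∀ r s p → r ℤ.+ + 2 ℤ.* p ≡ (r ℤ.- s) ℤ.+ (s ℤ.+ + 2 ℤ.* p)
    l = ℤ-solver.solve-∀
    m : ∀ q s p → + 2 ℤ.* (q ℤ.- p) ℤ.+ (s ℤ.+ + 2 ℤ.* p) ≡ s ℤ.+ + 2 ℤ.* q
    m = ℤ-solver.solve-∀

  slope⇒rise : ∀ p q r s → r ℕ.+ 2 ℕ.* p ≡ s ℕ.+ 2 ℕ.* q → + r ℤ.- + s ≡ + 2 ℤ.* (+ q ℤ.- + p)
  slope⇒rise p q r s eq = begin
    + r ℤ.- + s ≡⟨ l (+ r) (+ s) (+ p) ⟩
    (+ r ℤ.+ + 2 ℤ.* + p) ℤ.- + 2 ℤ.* + p ℤ.- + s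
      ≡⟨ cong (λ t → t ℤ.- + 2 ℤ.* + p ℤ.- + s) (trans (sym (pos-+2* r p)) (trans (cong +_ eq) (pos-+2* s q))) ⟩
    (+ s ℤ.+ + 2 ℤ.* + q) ℤ.- + 2 ℤ.* + p ℤ.- + s ≡⟨ m (+ q) (+ s) (+ p) ⟩
    + 2 ℤ.* (+ q ℤ.- + p) ∎
    where
    open ≡-Reasoning
    l : ∀ r s p → r ℤ.- s ≡ (r ℤ.+ + 2 ℤ.* p) ℤ.- + 2 ℤ.* p ℤ.- s
    l = ℤ-solver.solve-∀
    m : ∀ q s p → (s ℤ.+ + 2 ℤ.* q) ℤ.- + 2 ℤ.* p ℤ.- s ≡ + 2 ℤ.* (q ℤ.- p)
    m = ℤ-solver.solve-∀

  ·1 : ∀ c → c ℤ.* + 1 ≡ c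
  ·1 = ℤ.*-identityʳ

  ·2 : ∀ c → c ℤ.* + 2 ≡ + 2 ℤ.* c
  ·2 c = ℤ.*-comm c (+ 2)

  negate : ∀ a b → + a ℤ.- + b ≡ ℤ.- (+ b ℤ.- + a)
  negate a b = l (+ a) (+ b)
    where
    l : ∀ a b → a ℤ.- b ≡ ℤ.- (b ℤ.- a)
    l = ℤ-solver.solve-∀

  ·-2 : ∀ c → c ℤ.* -[1+ 1 ] ≡ + 2 ℤ.* (ℤ.- c)
  ·-2 = ℤ-solver.solve-∀

  2·- : ∀ c → + 2 ℤ.* (ℤ.- c) ≡ c ℤ.* -[1+ 1 ]
  2·- = ℤ-solver.solve-∀

  -·-1 : ∀ c → ℤ.- (c ℤ.* -[1+ 0 ]) ≡ c
  -·-1 = ℤ-solver.solve-∀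

-- The multiplier is read off from the coordinate that the move changes by ±1. A negative entry of
-- the move is absorbed by exchanging the two squares in one coordinate.
𝟙-isMultipleOf? : ∀ {n} j (z z′ : Square n) → let x , y = z ; x′ , y′ = z′ in
  𝟙 (isMultipleOf? j (displacement z z′)) ≡ onLine j (toℕ x) (toℕ y) (toℕ x′) (toℕ y′)
𝟙-isMultipleOf? 0F z@(x , y) z′@(x′ , y′) = 𝟙-⇔ (isMultipleOf? 0F (displacement z z′)) (_ ℕ.≟ _)
  (λ (c , eq) → let e₁ , e₂ = ,-injective eq in
    rise⇒slope c (toℕ x) (toℕ x′) (toℕ y′) (toℕ y) (trans e₁ (·1 c)) (trans e₂ (·2 c)))
  (λ eq → + toℕ x′ ℤ.- + toℕ x , cong₂ _,_ (sym (·1 _)) (trans (slope⇒rise (toℕ x) (toℕ x′) (toℕ y′) (toℕ y) eq) (sym (·2 _))))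
𝟙-isMultipleOf? 1F z@(x , y) z′@(x′ , y′) = 𝟙-⇔ (isMultipleOf? 1F (displacement z z′)) (_ ℕ.≟ _)
  (λ (c , eq) → let e₁ , e₂ = ,-injective eq in
    rise⇒slope c (toℕ y) (toℕ y′) (toℕ x′) (toℕ x) (trans e₂ (·1 c)) (trans e₁ (·2 c)))
  (λ eq → + toℕ y′ ℤ.- + toℕ y , cong₂ _,_ (trans (slope⇒rise (toℕ y) (toℕ y′) (toℕ x′) (toℕ x) eq) (sym (·2 _))) (sym (·1 _)))
𝟙-isMultipleOf? 2F z@(x , y) z′@(x′ , y′) = 𝟙-⇔ (isMultipleOf? 2F (displacement z z′)) (_ ℕ.≟ _)
  (λ (c , eq) → let e₁ , e₂ = ,-injective eq in
    rise⇒slope (ℤ.- c) (toℕ x′) (toℕ x) (toℕ y′) (toℕ y)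
      (trans (negate (toℕ x) (toℕ x′)) (cong ℤ.-_ (trans e₁ (·1 c)))) (trans e₂ (·-2 c)))
  (λ eq → + toℕ x′ ℤ.- + toℕ x , cong₂ _,_ (sym (·1 _)) (trans (slope⇒rise (toℕ x′) (toℕ x) (toℕ y′) (toℕ y) eq)
    (trans (cong (λ t → + 2 ℤ.* t) (negate (toℕ x) (toℕ x′))) (2·- _))))
𝟙-isMultipleOf? 3F z@(x , y) z′@(x′ , y′) = 𝟙-⇔ (isMultipleOf? 3F (displacement z z′)) (_ ℕ.≟ _)
  (λ (c , eq) → let e₁ , e₂ = ,-injective eq in
    rise⇒slope c (toℕ y′) (toℕ y) (toℕ x′) (toℕ x)
      (trans (negate (toℕ y) (toℕ y′)) (trans (cong ℤ.-_ e₂) (-·-1 c))) (trans e₁ (·2 c)))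
  (λ eq → + toℕ y ℤ.- + toℕ y′ , cong₂ _,_ (trans (slope⇒rise (toℕ y′) (toℕ y) (toℕ x′) (toℕ x) eq) (sym (·2 _)))
    (trans (negate (toℕ y′) (toℕ y)) (negated _)))
  where
  negated : ∀ c → ℤ.- c ≡ c ℤ.* -[1+ 0 ]
  negated = ℤ-solver.solve-∀

-- From collinear pairs of single moves to attacking pairs

determinant : Fin 4 → Fin 4 → ℤ
determinant i j = let a , b = knightMove i ; c , d = knightMove j in a ℤ.* d ℤ.- b ℤ.* c

-- Decided by evaluation over all sixteen pairs of moves.
determinant≢0 : ∀ i j → i ≢ j → determinant i j ≢ 0ℤ
determinant≢0 = from-yes (Fin.all? λ i → Fin.all? λ j → ¬? (i Fin.≟ j) →-dec ¬? (determinant i j ℤ.≟ 0ℤ))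

-- Cramer's rule: the multiplier times the determinant of the two moves is zero, and the determinant
-- is not.
multiples-distinct : ∀ {i j d} → i ≢ j → IsMultipleOf (knightMove i) d → IsMultipleOf (knightMove j) d → d ≡ (0ℤ , 0ℤ)
multiples-distinct {i} {j} i≢j (c , refl) (c′ , eq) with e₁ , e₂ ← ,-injective eq =
  cong (λ c → c · knightMove i) {y = 0ℤ} (independent (proj₁ (knightMove i)) (proj₂ (knightMove i))
    (proj₁ (knightMove j)) (proj₂ (knightMove j)) (determinant≢0 i j i≢j) e₁ e₂)
  where
  expand : ∀ c a b a′ b′ → c ℤ.* (a ℤ.* b′ ℤ.- b ℤ.* a′) ≡ (c ℤ.* a) ℤ.* b′ ℤ.- (c ℤ.* b) ℤ.* a′
  expand = ℤ-solver.solve-∀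
  vanish : ∀ c a b → (c ℤ.* a) ℤ.* b ℤ.- (c ℤ.* b) ℤ.* a ≡ 0ℤ
  vanish = ℤ-solver.solve-∀
  independent : ∀ a b a′ b′ → a ℤ.* b′ ℤ.- b ℤ.* a′ ≢ 0ℤ → c ℤ.* a ≡ c′ ℤ.* a′ → c ℤ.* b ≡ c′ ℤ.* b′ → c ≡ 0ℤ
  independent a b a′ b′ det≢0 e₁ e₂ = [ id , (λ det≡0 → contradiction det≡0 det≢0) ]′
    (ℤ.i*j≡0⇒i≡0∨j≡0 c {a ℤ.* b′ ℤ.- b ℤ.* a′} (trans (expand c a b a′ b′)
      (trans (cong₂ (λ s t → s ℤ.* b′ ℤ.- t ℤ.* a′) e₁ e₂) (vanish c′ a′ b′))))

displacement≡0 : ∀ {n} (z z′ : Square n) → displacement z z′ ≡ (0ℤ , 0ℤ) → z ≡ z′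
displacement≡0 (x , y) (x′ , y′) eq with e₁ , e₂ ← ,-injective eq = cong₂ _,_ (coordinate x x′ e₁) (coordinate y y′ e₂)
  where
  coordinate : ∀ {n} (i i′ : Fin n) → + toℕ i′ ℤ.- + toℕ i ≡ 0ℤ → i ≡ i′
  coordinate i i′ e = sym (Fin.toℕ-injective (ℤ.+-injective (ℤ.i-j≡0⇒i≡j _ _ e)))

equal? : ∀ {n} (z z′ : Square n) → Dec (proj₁ z ≡ proj₁ z′ × proj₂ z ≡ proj₂ z′)
equal? (x , y) (x′ , y′) = (x Fin.≟ x′) ×-dec (y Fin.≟ y′)

≤+4*𝟙 : {P : Set} (d : Dec P) {m l : ℕ} → (P → m ℕ.≤ 4) → (¬ P → m ℕ.≤ l) → m ℕ.≤ l ℕ.+ 4 ℕ.* 𝟙 d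
≤+4*𝟙 (yes p) b c = ℕ.≤-trans (b p) (ℕ.m≤n+m 4 _)
≤+4*𝟙 (no ¬p) b c = ℕ.≤-trans (c ¬p) (ℕ.m≤m+n _ 0)

module _ (N : PartialNightrider) where

  -- A square is reached from itself with multiplier 0, but this takes at least one move; the
  -- assumption 1 ≤ k enters here.
  Attacks-refl : ∀ {n} → ∃[ j ] j ∈ₛ N → Reflexive (Attacks N {n})
  Attacks-refl (j , j∈N) {x , y} = j , j∈N , 0ℤ , cong₂ _,_ (zero-by x (proj₁ (knightMove j))) (zero-by y (proj₂ (knightMove j)))
    where
    zero-by : ∀ {n} (x : Fin n) m → + toℕ x ℤ.- + toℕ x ≡ 0ℤ ℤ.* m
    zero-by x m = trans (ℤ.+-inverseʳ (+ toℕ x)) (sym (ℤ.*-zeroˡ m))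

  Attacks-sym : ∀ {n} → Symmetric (Attacks N {n})
  Attacks-sym {n} {x , y} {x′ , y′} (j , j∈N , c , eq) with e₁ , e₂ ← ,-injective eq =
    j , j∈N , ℤ.- c , cong₂ _,_ (reverse x x′ e₁) (reverse y y′ e₂)
    where
    reverse : ∀ (i i′ : Fin n) {m} → + toℕ i′ ℤ.- + toℕ i ≡ c ℤ.* m → + toℕ i ℤ.- + toℕ i′ ≡ ℤ.- c ℤ.* m
    reverse i i′ {m} e = trans (negate (toℕ i) (toℕ i′)) (trans (cong ℤ.-_ e) (ℤ.neg-distribˡ-* c m))

  Joins : ∀ {n} → Square n → Square n → Fin 4 → Set
  Joins z z′ j = j ∈ₛ N × IsMultipleOf (knightMove j) (displacement z z′)

  joins? : ∀ {n} (z z′ : Square n) j → Dec (Joins z z′ j)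
  joins? z z′ j = (j ∈? N) ×-dec isMultipleOf? j (displacement z z′)

  multiplicity : ∀ {n} → Square n → Square n → ℕ
  multiplicity z z′ = ℕΣ.∑ (allFin 4) λ j → 𝟙 (joins? z z′ j)

  attacks≤multiplicity : ∀ {n} (z z′ : Square n) → 𝟙 (attacks? N z z′) ℕ.≤ multiplicity z z′
  attacks≤multiplicity z z′ = 𝟙≤ (attacks? N z z′) λ (j , a) →
    ℕ.≤-trans (ℕ.≤-reflexive (sym (𝟙-yes (joins? z z′ j) a)))
              (∈⇒≤∑ (λ j → 𝟙 (joins? z z′ j)) (∈-allFin j))

  -- Two distinct squares are joined by at most one move, by `multiples-distinct`. Only equal
  -- squares are joined repeatedly, and over the board these n² pairs are of lower order.
  multiplicity≤ : ∀ {n} (z z′ : Square n) → multiplicity z z′ ℕ.≤ 𝟙 (attacks? N z z′) ℕ.+ 4 ℕ.* 𝟙 (equal? z z′)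
  multiplicity≤ z z′ = ≤+4*𝟙 (equal? z z′)
    (λ _ → ∑-bound (allFin 4) {λ j → 𝟙 (joins? z z′ j)} 1 λ j → 𝟙≤ (joins? z z′ j) λ _ → ℕ.≤-refl)
    λ z≢z′ → ≤𝟙 (attacks? N z z′)
      (λ (i , _ , a) → ℕ.≤-trans (∑-mono (allFin 4) λ j → 𝟙≤ (joins? z z′ j) λ (_ , a′) → only i a j a′ z≢z′) (ℕ.≤-reflexive (∑-≟ i)))
      (λ ¬a → ℕ.≤-reflexive (trans (ℕΣ.∑-cong (allFin 4) λ j → 𝟙-no (joins? z z′ j) λ a → ¬a (j , a)) (ℕΣ.∑-zero (allFin 4))))
    where
    ∑-≟ : ∀ i → ℕΣ.∑ (allFin 4) (λ j → 𝟙 (j Fin.≟ i)) ≡ 1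
    ∑-≟ 0F = refl
    ∑-≟ 1F = refl
    ∑-≟ 2F = refl
    ∑-≟ 3F = refl
    only : ∀ i → IsMultipleOf (knightMove i) (displacement z z′) →
           ∀ j → IsMultipleOf (knightMove j) (displacement z z′) →
           ¬ (proj₁ z ≡ proj₁ z′ × proj₂ z ≡ proj₂ z′) → 1 ℕ.≤ 𝟙 (j Fin.≟ i)
    only i a j a′ z≢z′ with j Fin.≟ i
    ... | yes _   = ℕ.≤-refl
    ... | no  j≢i = contradiction (,-injective (displacement≡0 z z′ (multiples-distinct j≢i a′ a))) z≢z′

∑-allFin : ∀ n (g : ℕ → ℕ) → ℕΣ.∑ (allFin n) (g ∘ toℕ) ≡ ∑< n g
∑-allFin n g = ∑-tabulate n id g λ _ → refl
  where
  ∑-tabulate : ∀ {A : Set} m (t : Fin m → A) {φ : A → ℕ} (g : ℕ → ℕ) → (∀ i → φ (t i) ≡ g (toℕ i)) →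
               ℕΣ.∑ (tabulate t) φ ≡ ∑< m g
  ∑-tabulate zero    t g e = refl
  ∑-tabulate (suc m) t g e = trans (cong₂ ℕ._+_ (e 0F) (∑-tabulate m (t ∘ suc) (g ∘ suc) (e ∘ suc))) (sym (∑<-suc m g))

∑-board : ∀ n (g : ℕ → ℕ → ℕ) → ℕΣ.∑ (board n) (λ (x , y) → g (toℕ x) (toℕ y)) ≡ ∑< n λ x → ∑< n (g x)
∑-board n g = trans (ℕΣ.∑-cartesianProduct (allFin n) (allFin n) (λ (x , y) → g (toℕ x) (toℕ y)))
  (trans (ℕΣ.∑-cong (allFin n) λ x → ∑-allFin n (g (toℕ x))) (∑-allFin n λ x → ∑< n (g x)))

∑₄ : ℕ → (ℕ → ℕ → ℕ → ℕ → ℕ) → ℕ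
∑₄ n g = ∑< n λ a → ∑< n λ b → ∑< n λ c → ∑< n λ d → g a b c d

private
  module _ (n : ℕ) (g : ℕ → ℕ → ℕ → ℕ → ℕ) where

    swap₁ : ∑₄ n g ≡ ∑₄ n (λ a b c d → g b a c d)
    swap₁ = ∑<-comm n n _

    swap₂ : ∑₄ n g ≡ ∑₄ n (λ a b c d → g a c b d)
    swap₂ = ∑<-≗ n λ a → ∑<-comm n n _

    swap₃ : ∑₄ n g ≡ ∑₄ n (λ a b c d → g a b d c)
    swap₃ = ∑<-≗ n λ a → ∑<-≗ n λ b → ∑<-comm n n _

-- Relabelling the four summation variables turns the equation of every move into that of (1 , 2).
∑₄-onLine : ∀ n j → ∑₄ n (onLine j) ≡ collinearPairs n
∑₄-onLine n 0F = trans (swap₂ n (onLine 0F)) (swap₃ n λ a b c d → slope a b d c)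
∑₄-onLine n 1F = trans (swap₁ n (onLine 1F)) (trans (swap₃ n λ a b c d → slope a d c b)
  (trans (swap₂ n λ a b c d → slope a c d b) (swap₃ n λ a b c d → slope a b d c)))
∑₄-onLine n 2F = trans (swap₁ n (onLine 2F)) (trans (swap₂ n λ a b c d → slope c b d a)
  (trans (swap₁ n λ a b c d → slope b c d a)
  (trans (swap₂ n λ a b c d → slope a c d b) (swap₃ n λ a b c d → slope a b d c))))
∑₄-onLine n 3F = trans (swap₃ n (onLine 3F)) (trans (swap₂ n λ a b c d → slope c b d a)
  (trans (swap₁ n λ a b c d → slope b c d a)
  (trans (swap₂ n λ a b c d → slope a c d b) (swap₃ n λ a b c d → slope a b d c))))

∑-multiples : ∀ n j → ℕΣ.∑ (board n) (λ z → ℕΣ.∑ (board n) λ z′ → 𝟙 (isMultipleOf? j (displacement z z′))) ≡ collinearPairs n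
∑-multiples n j = begin
  _ ≡⟨ ℕΣ.∑-cong (board n) (λ z → trans (ℕΣ.∑-cong (board n) λ z′ → 𝟙-isMultipleOf? j z z′)
         (∑-board n (onLine j (toℕ (proj₁ z)) (toℕ (proj₂ z))))) ⟩
  ℕΣ.∑ (board n) (λ (x , y) → ∑< n λ x′ → ∑< n λ y′ → onLine j (toℕ x) (toℕ y) x′ y′)
    ≡⟨ ∑-board n (λ x y → ∑< n λ x′ → ∑< n λ y′ → onLine j x y x′ y′) ⟩
  ∑₄ n (onLine j) ≡⟨ ∑₄-onLine n j ⟩
  collinearPairs n ∎
  where open ≡-Reasoning

-- The coordinate that the move changes by ±1 determines the other one, so each of its n values
-- gives at most one square.
line≤ : ∀ n j x y → ∑< n (λ x′ → ∑< n λ y′ → onLine j x y x′ y′) ℕ.≤ n ℕ.* 1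
line≤ n 0F x y = ∑<-bound n 1 λ x′ → ∑<-unique n (λ y′ → y′ ℕ.+ 2 ℕ.* x ℕ.≟ y ℕ.+ 2 ℕ.* x′)
  λ {i} {j} p q → ℕ.+-cancelʳ-≡ (2 ℕ.* x) i j (trans p (sym q))
line≤ n 1F x y = ℕ.≤-trans (ℕ.≤-reflexive (∑<-comm n n _)) (∑<-bound n 1 λ y′ → ∑<-unique n (λ x′ → x′ ℕ.+ 2 ℕ.* y ℕ.≟ x ℕ.+ 2 ℕ.* y′)
  λ {i} {j} p q → ℕ.+-cancelʳ-≡ (2 ℕ.* y) i j (trans p (sym q)))
line≤ n 2F x y = ∑<-bound n 1 λ x′ → ∑<-unique n (λ y′ → y′ ℕ.+ 2 ℕ.* x′ ℕ.≟ y ℕ.+ 2 ℕ.* x)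
  λ {i} {j} p q → ℕ.+-cancelʳ-≡ (2 ℕ.* x′) i j (trans p (sym q))
line≤ n 3F x y = ℕ.≤-trans (ℕ.≤-reflexive (∑<-comm n n _)) (∑<-bound n 1 λ y′ → ∑<-unique n (λ x′ → x′ ℕ.+ 2 ℕ.* y′ ℕ.≟ x ℕ.+ 2 ℕ.* y)
  λ {i} {j} p q → ℕ.+-cancelʳ-≡ (2 ℕ.* y′) i j (trans p (sym q)))

∑-equal : ∀ {n} (z : Square n) → ℕΣ.∑ (board n) (λ z′ → 𝟙 (equal? z z′)) ℕ.≤ 1
∑-equal {n} z@(x , y) = begin
  _ ≡⟨ ℕΣ.∑-cong (board n) (λ z′@(x′ , y′) → 𝟙-⇔ (equal? z z′) ((toℕ x′ ℕ.≟ toℕ x) ×-dec (toℕ y′ ℕ.≟ toℕ y))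
         (λ (e , e′) → cong toℕ (sym e) , cong toℕ (sym e′))
         (λ (e , e′) → sym (Fin.toℕ-injective e) , sym (Fin.toℕ-injective e′))) ⟩
  _ ≡⟨ ∑-board n (λ x′ y′ → 𝟙 ((x′ ℕ.≟ toℕ x) ×-dec (y′ ℕ.≟ toℕ y))) ⟩
  ∑< n (λ x′ → ∑< n λ y′ → 𝟙 ((x′ ℕ.≟ toℕ x) ×-dec (y′ ℕ.≟ toℕ y)))
    ≡⟨ ∑<-≗ n (λ x′ → factor x′) ⟩
  ∑< n (λ x′ → 𝟙 (x′ ℕ.≟ toℕ x) ℕ.* ∑< n λ y′ → 𝟙 (y′ ℕ.≟ toℕ y))
    ≤⟨ ∑<-≤ n (λ x′ → ℕ.≤-trans (ℕ.*-monoʳ-≤ (𝟙 (x′ ℕ.≟ toℕ x)) (∑<-unique n (λ y′ → y′ ℕ.≟ toℕ y) λ p q → trans p (sym q)))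
                                (ℕ.≤-reflexive (ℕ.*-identityʳ _))) ⟩
  ∑< n (λ x′ → 𝟙 (x′ ℕ.≟ toℕ x)) ≤⟨ ∑<-unique n (λ x′ → x′ ℕ.≟ toℕ x) (λ p q → trans p (sym q)) ⟩
  1 ∎
  where
  open ℕ.≤-Reasoning
  ∑<-≤ : ∀ m {g g′ : ℕ → ℕ} → (∀ i → g i ℕ.≤ g′ i) → ∑< m g ℕ.≤ ∑< m g′
  ∑<-≤ zero    b = z≤n
  ∑<-≤ (suc m) b = ℕ.+-mono-≤ (∑<-≤ m b) (b m)
  ∑<-* : ∀ m c (g : ℕ → ℕ) → ∑< m (λ i → c ℕ.* g i) ≡ c ℕ.* ∑< m g
  ∑<-* zero    c g = sym (ℕ.*-zeroʳ c)
  ∑<-* (suc m) c g = trans (cong (ℕ._+ c ℕ.* g m) (∑<-* m c g)) (sym (ℕ.*-distribˡ-+ c _ _))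
  factor : ∀ x′ → ∑< n (λ y′ → 𝟙 ((x′ ℕ.≟ toℕ x) ×-dec (y′ ℕ.≟ toℕ y))) ≡ 𝟙 (x′ ℕ.≟ toℕ x) ℕ.* ∑< n λ y′ → 𝟙 (y′ ℕ.≟ toℕ y)
  factor x′ = trans (∑<-≗ n λ y′ → 𝟙-× (x′ ℕ.≟ toℕ x) (y′ ℕ.≟ toℕ y)) (∑<-* n (𝟙 (x′ ℕ.≟ toℕ x)) _)

∑-size : ∀ {m} (N : Subset m) → ℕΣ.∑ (allFin m) (λ j → 𝟙 (j ∈? N)) ≡ size N
∑-size []      = refl
∑-size {suc m} (b ∷ N) = begin
  𝟙 (0F ∈? (b ∷ N)) ℕ.+ ℕΣ.∑ (tabulate suc) (λ j → 𝟙 (j ∈? (b ∷ N)))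
    ≡⟨ cong (λ l → 𝟙 (0F ∈? (b ∷ N)) ℕ.+ ℕΣ.∑ l (λ j → 𝟙 (j ∈? (b ∷ N)))) (List.map-tabulate id suc) ⟨
  𝟙 (0F ∈? (b ∷ N)) ℕ.+ ℕΣ.∑ (map suc (allFin m)) (λ j → 𝟙 (j ∈? (b ∷ N)))
    ≡⟨ cong (𝟙 (0F ∈? (b ∷ N)) ℕ.+_) (trans (ℕΣ.∑-map suc (allFin m) _) (∑-size N)) ⟩
  𝟙 (0F ∈? (b ∷ N)) ℕ.+ size N
    ≡⟨ head b ⟩
  size (b ∷ N) ∎
  where
  open ≡-Reasoning
  head : ∀ b → 𝟙 (0F ∈? (b ∷ N)) ℕ.+ size N ≡ size (b ∷ N)
  head inside  = refl
  head outside = refl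

module _ (N : PartialNightrider) (n : ℕ) where
  open ℕ.≤-Reasoning

  degree≤ : ∀ z → ℕΣ.∑ (board n) (λ z′ → 𝟙 (attacks? N z z′)) ℕ.≤ 4 ℕ.* n
  degree≤ z = begin
    _ ≤⟨ ∑-mono (board n) (attacks≤multiplicity N z) ⟩
    ℕΣ.∑ (board n) (λ z′ → ℕΣ.∑ (allFin 4) λ j → 𝟙 (joins? N z z′ j))
      ≡⟨ ℕΣ.∑-comm (board n) (allFin 4) (λ z′ j → 𝟙 (joins? N z z′ j)) ⟩
    ℕΣ.∑ (allFin 4) (λ j → ℕΣ.∑ (board n) λ z′ → 𝟙 (joins? N z z′ j))
      ≤⟨ ∑-bound (allFin 4) n (λ j → along j) ⟩
    4 ℕ.* n ∎
    where
    along : ∀ j → ℕΣ.∑ (board n) (λ z′ → 𝟙 (joins? N z z′ j)) ℕ.≤ n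
    along j = begin
      _ ≤⟨ ∑-mono (board n) (λ z′ → 𝟙≤ (joins? N z z′ j) λ (_ , a) → ℕ.≤-reflexive (sym (𝟙-yes (isMultipleOf? j (displacement z z′)) a))) ⟩
      ℕΣ.∑ (board n) (λ z′ → 𝟙 (isMultipleOf? j (displacement z z′)))
        ≡⟨ ℕΣ.∑-cong (board n) (𝟙-isMultipleOf? j z) ⟩
      _ ≡⟨ ∑-board n (onLine j (toℕ (proj₁ z)) (toℕ (proj₂ z))) ⟩
      _ ≤⟨ line≤ n j (toℕ (proj₁ z)) (toℕ (proj₂ z)) ⟩
      n ℕ.* 1 ≡⟨ ℕ.*-identityʳ n ⟩
      n ∎

  pairs : ℕ
  pairs = ℕΣ.∑ (board n) λ z → ℕΣ.∑ (board n) λ z′ → 𝟙 (attacks? N z z′)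

  ∑-multiplicity : ℕΣ.∑ (board n) (λ z → ℕΣ.∑ (board n) (multiplicity N z)) ≡ size N ℕ.* collinearPairs n
  ∑-multiplicity = begin-equality
    _ ≡⟨ trans (ℕΣ.∑-cong (board n) λ z → ℕΣ.∑-comm (board n) (allFin 4) λ z′ j → 𝟙 (joins? N z z′ j))
               (ℕΣ.∑-comm (board n) (allFin 4) λ z j → ℕΣ.∑ (board n) λ z′ → 𝟙 (joins? N z z′ j)) ⟩
    ℕΣ.∑ (allFin 4) (λ j → ℕΣ.∑ (board n) λ z → ℕΣ.∑ (board n) λ z′ → 𝟙 (joins? N z z′ j))
      ≡⟨ ℕΣ.∑-cong (allFin 4) along ⟩
    ℕΣ.∑ (allFin 4) (λ j → 𝟙 (j ∈? N) ℕ.* collinearPairs n)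
      ≡⟨ ℕΣ.∑-*ʳ (allFin 4) (collinearPairs n) (λ j → 𝟙 (j ∈? N)) ⟩
    ℕΣ.∑ (allFin 4) (λ j → 𝟙 (j ∈? N)) ℕ.* collinearPairs n
      ≡⟨ cong (ℕ._* collinearPairs n) (∑-size N) ⟩
    size N ℕ.* collinearPairs n ∎
    where
    along : ∀ j → ℕΣ.∑ (board n) (λ z → ℕΣ.∑ (board n) λ z′ → 𝟙 (joins? N z z′ j)) ≡ 𝟙 (j ∈? N) ℕ.* collinearPairs n
    along j = begin-equality
      _ ≡⟨ ℕΣ.∑-cong (board n) (λ z → trans (ℕΣ.∑-cong (board n) λ z′ → 𝟙-× (j ∈? N) (isMultipleOf? j (displacement z z′)))
                                            (ℕΣ.∑-* (board n) (𝟙 (j ∈? N)) _)) ⟩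
      _ ≡⟨ ℕΣ.∑-* (board n) (𝟙 (j ∈? N)) _ ⟩
      _ ≡⟨ cong (𝟙 (j ∈? N) ℕ.*_) (∑-multiples n j) ⟩
      𝟙 (j ∈? N) ℕ.* collinearPairs n ∎

  length-board : length (board n) ≡ n ℕ.* n
  length-board = begin-equality
    length (board n)                            ≡⟨ ℕ.*-identityʳ _ ⟨
    length (board n) ℕ.* 1                      ≡⟨ ∑-const (board n) 1 ⟨
    ℕΣ.∑ (board n) (λ _ → 1)                    ≡⟨ ∑-board n (λ _ _ → 1) ⟩
    ∑< n (λ _ → ∑< n λ _ → 1)                   ≡⟨ ∑<-const n _ ⟩
    n ℕ.* ∑< n (λ _ → 1)                        ≡⟨ cong (n ℕ.*_) (trans (∑<-const n 1) (ℕ.*-identityʳ n)) ⟩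
    n ℕ.* n                                     ∎

  pairs≤ : pairs ℕ.≤ size N ℕ.* collinearPairs n
  pairs≤ = ℕ.≤-trans (∑-mono (board n) λ z → ∑-mono (board n) (attacks≤multiplicity N z)) (ℕ.≤-reflexive ∑-multiplicity)

  pairs≥ : size N ℕ.* collinearPairs n ℕ.≤ pairs ℕ.+ 4 ℕ.* (n ℕ.* n)
  pairs≥ = begin
    size N ℕ.* collinearPairs n ≡⟨ ∑-multiplicity ⟨
    _ ≤⟨ ∑-mono (board n) (λ z → ∑-mono (board n) (multiplicity≤ N z)) ⟩
    ℕΣ.∑ (board n) (λ z → ℕΣ.∑ (board n) λ z′ → 𝟙 (attacks? N z z′) ℕ.+ 4 ℕ.* 𝟙 (equal? z z′))
      ≡⟨ trans (ℕΣ.∑-cong (board n) λ z → ℕΣ.∑-+ (board n) (λ z′ → 𝟙 (attacks? N z z′)) (λ z′ → 4 ℕ.* 𝟙 (equal? z z′))) (ℕΣ.∑-+ (board n) _ _) ⟩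
    pairs ℕ.+ ℕΣ.∑ (board n) (λ z → ℕΣ.∑ (board n) λ z′ → 4 ℕ.* 𝟙 (equal? z z′))
      ≤⟨ ℕ.+-monoʳ-≤ pairs (∑-bound (board n) 4 λ z → ℕ.≤-trans (ℕ.≤-reflexive (ℕΣ.∑-* (board n) 4 λ z′ → 𝟙 (equal? z z′))) (ℕ.*-monoʳ-≤ 4 (∑-equal z))) ⟩
    pairs ℕ.+ length (board n) ℕ.* 4 ≡⟨ cong (pairs ℕ.+_) (trans (cong (ℕ._* 4) length-board) (ℕ.*-comm (n ℕ.* n) 4)) ⟩
    pairs ℕ.+ 4 ℕ.* (n ℕ.* n) ∎

  pairs-lower : 5 ℕ.* size N ℕ.* (n ℕ.* (n ℕ.* n)) ℕ.≤ 12 ℕ.* pairs ℕ.+ 48 ℕ.* (n ℕ.* n)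
  pairs-lower = begin
    5 ℕ.* size N ℕ.* (n ℕ.* (n ℕ.* n)) ≡⟨ l (size N) (n ℕ.* (n ℕ.* n)) ⟩
    size N ℕ.* (5 ℕ.* (n ℕ.* (n ℕ.* n))) ≤⟨ ℕ.*-monoʳ-≤ (size N) (collinearPairs-lower n) ⟩
    size N ℕ.* (12 ℕ.* collinearPairs n) ≡⟨ m (size N) (collinearPairs n) ⟩
    12 ℕ.* (size N ℕ.* collinearPairs n) ≤⟨ ℕ.*-monoʳ-≤ 12 pairs≥ ⟩
    12 ℕ.* (pairs ℕ.+ 4 ℕ.* (n ℕ.* n)) ≡⟨ r pairs (n ℕ.* n) ⟩
    12 ℕ.* pairs ℕ.+ 48 ℕ.* (n ℕ.* n) ∎
    where
    l : ∀ k c → 5 ℕ.* k ℕ.* c ≡ k ℕ.* (5 ℕ.* c)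
    l = ℕ-solver.solve-∀
    m : ∀ k c → k ℕ.* (12 ℕ.* c) ≡ 12 ℕ.* (k ℕ.* c)
    m = ℕ-solver.solve-∀
    r : ∀ p s → 12 ℕ.* (p ℕ.+ 4 ℕ.* s) ≡ 12 ℕ.* p ℕ.+ 48 ℕ.* s
    r = ℕ-solver.solve-∀

  pairs-upper : 12 ℕ.* pairs ℕ.≤ 5 ℕ.* size N ℕ.* (n ℕ.* (n ℕ.* n)) ℕ.+ 12 ℕ.* size N ℕ.* (n ℕ.* n)
  pairs-upper = begin
    12 ℕ.* pairs ≤⟨ ℕ.*-monoʳ-≤ 12 pairs≤ ⟩
    12 ℕ.* (size N ℕ.* collinearPairs n) ≡⟨ m (size N) (collinearPairs n) ⟩
    size N ℕ.* (12 ℕ.* collinearPairs n) ≤⟨ ℕ.*-monoʳ-≤ (size N) (collinearPairs-upper n) ⟩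
    size N ℕ.* (5 ℕ.* (n ℕ.* (n ℕ.* n)) ℕ.+ 12 ℕ.* (n ℕ.* n)) ≡⟨ r (size N) (n ℕ.* (n ℕ.* n)) (n ℕ.* n) ⟩
    5 ℕ.* size N ℕ.* (n ℕ.* (n ℕ.* n)) ℕ.+ 12 ℕ.* size N ℕ.* (n ℕ.* n) ∎
    where
    m : ∀ k c → 12 ℕ.* (k ℕ.* c) ≡ k ℕ.* (12 ℕ.* c)
    m = ℕ-solver.solve-∀
    r : ∀ k c s → k ℕ.* (5 ℕ.* c ℕ.+ 12 ℕ.* s) ≡ 5 ℕ.* k ℕ.* c ℕ.+ 12 ℕ.* k ℕ.* s
    r = ℕ-solver.solve-∀

-- Asymptotics of the alternating sums

-- Recursion in this form makes `deg (double (suc i))` compute to `3 + deg (double i)`, which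
-- `2 * i` would not.
double : ℕ → ℕ
double zero    = zero
double (suc i) = suc (suc (double i))

deg-odd : ∀ i → deg (suc (double i)) ≡ suc (deg (double i))
deg-odd zero    = refl
deg-odd (suc i) = cong (3 ℕ.+_) (deg-odd i)

∣-∣≤ : ∀ {a b c d} → a ℕ.≤ b ℕ.+ c → b ℕ.≤ a ℕ.+ d → ℤ.∣ + a ℤ.- + b ∣ ℕ.≤ d ℕ.+ c
∣-∣≤ {a} {b} {c} {d} a≤ b≤ with ℕ.≤-total a b
... | inj₁ a≤b = ℕ.≤-trans (ℕ.≤-reflexive (trans (cong ℤ.∣_∣ (ℤ.m-n≡m⊖n a b)) (ℤ.∣⊖∣-≤ a≤b)))
                 (ℕ.≤-trans (ℕ.m≤n+o⇒m∸n≤o b a b≤) (ℕ.m≤m+n d c))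
... | inj₂ b≤a = ℕ.≤-trans (ℕ.≤-reflexive (trans (ℤ.∣i-j∣≡∣j-i∣ (+ a) (+ b)) (trans (cong ℤ.∣_∣ (ℤ.m-n≡m⊖n b a)) (ℤ.∣⊖∣-≤ b≤a))))
                 (ℕ.≤-trans (ℕ.m≤n+o⇒m∸n≤o a b a≤) (ℕ.m≤n+m c d))

module Placements (N : PartialNightrider) (nonempty : ∃[ j ] j ∈ₛ N) where

  module _ (n : ℕ) where
    open Reflexive-Symmetric (attacks? N {n}) (λ {z} → Attacks-refl N {n} nonempty {z}) (λ {z} {w} → Attacks-sym N {n} {z} {w}) public

  -- The W(s) of the overview is `W 0 s`; the argument `r` is the point at which the difference in q
  -- is taken.
  W : ℕ → ℕ → ℕ → ℤ
  W r s n = partial n (board n) r s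

  W-zero : ∀ q n → W q 0 n ≡ + ((q !) ℕ.* u N q n)
  W-zero q n = partial-zero n (board n) q

  W-suc : ∀ r s n → W r (suc s) n ≡ W (suc r) s n ℤ.- + (n ℕ.* n) ℤ.* W r s n
  W-suc r s n = trans (partial-suc n (board n) r s)
    (cong (λ l → W (suc r) s n ℤ.- + l ℤ.* W r s n) (length-board N n))

  module _ (n : ℕ) .{{_ : NonZero n}} where
    open Bounded-Degree (attacks? N {n}) (λ {z} → Attacks-refl N {n} nonempty {z}) (λ {z} {w} → Attacks-sym N {n} {z} {w})
      (board n) n 4 (length-board N n) (degree≤ N n) public
      using (∑ᵗ-f-base; ∑ᵗ-f-recurrence; ∣∑ᵗ-f∣≤)

  ∣W∣≤ : ∀ s n .{{_ : NonZero n}} → ℤ.∣ W 0 s n ∣ ℕ.≤ growthBound 4 s ℕ.* n ℕ.^ deg s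
  ∣W∣≤ s n = ∣∑ᵗ-f∣≤ n s

  private
    k = size N

  ∣pairs∣≤ : ∀ n → ℤ.∣ + 12 ℤ.* + pairs N n ℤ.- + (5 ℕ.* k) ℤ.* + (n ℕ.* (n ℕ.* n)) ∣ ℕ.≤ (48 ℕ.+ 12 ℕ.* k) ℕ.* (n ℕ.* n)
  ∣pairs∣≤ n = subst₂ ℕ._≤_
    (cong ℤ.∣_∣ (cong₂ ℤ._-_ (ℤ.pos-* 12 (pairs N n)) (ℤ.pos-* (5 ℕ.* k) (n ℕ.* (n ℕ.* n)))))
    (sym (ℕ.*-distribʳ-+ (n ℕ.* n) 48 (12 ℕ.* k)))
    (∣-∣≤ (pairs-upper N n) (pairs-lower N n))

  -- Passing from 0 to 2 entries is exact. Passing from 2i + 2 to 2i + 4 entries is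
  -- `∑ᵗ-f-recurrence` at s = 2i + 1.
  recurrenceConstant : ℕ → ℕ
  recurrenceConstant zero    = 0
  recurrenceConstant (suc i) = recurrenceBound 4 (suc (double i))

  -- The factor n on the left says that the error is one power of n below the main order n^(3i+3).
  -- It comes from 4 + `deg (2i + 1)` = 5 + 3i against `deg (2i + 4)` = 6 + 3i, one index further
  -- on.
  W-recurrence : ∀ i n .{{_ : NonZero n}} →
    n ℕ.* ℤ.∣ W 0 (double (suc i)) n ℤ.+ + suc (double i) ℤ.* (+ pairs N n ℤ.* W 0 (double i) n) ∣
    ℕ.≤ recurrenceConstant i ℕ.* n ℕ.^ deg (double (suc i))
  W-recurrence zero n = ℕ.≤-reflexive (trans (cong (λ w → n ℕ.* ℤ.∣ w ∣) (trans
    (cong (ℤ._+ (+ 1 ℤ.* (+ pairs N n ℤ.* + 1))) (∑ᵗ-f-base n)) (lemma (+ pairs N n)))) (ℕ.*-zeroʳ n))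
    where
    lemma : ∀ x → ℤ.- x ℤ.+ (+ 1 ℤ.* (x ℤ.* + 1)) ≡ 0ℤ
    lemma = ℤ-solver.solve-∀
  W-recurrence (suc i) n = begin
    _ ≤⟨ ℕ.*-monoʳ-≤ n (∑ᵗ-f-recurrence n (suc (double i))) ⟩
    n ℕ.* (recurrenceConstant (suc i) ℕ.* n ℕ.^ (4 ℕ.+ deg (suc (double i))))
      ≡⟨ cong (λ d → n ℕ.* (recurrenceConstant (suc i) ℕ.* n ℕ.^ (4 ℕ.+ d))) (deg-odd i) ⟩
    n ℕ.* (recurrenceConstant (suc i) ℕ.* n ℕ.^ (5 ℕ.+ deg (double i)))
      ≡⟨ lemma n (recurrenceConstant (suc i)) (n ℕ.^ (5 ℕ.+ deg (double i))) ⟩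
    recurrenceConstant (suc i) ℕ.* n ℕ.^ deg (double (suc (suc i))) ∎
    where
    open ℕ.≤-Reasoning
    lemma : ∀ n c N → n ℕ.* (c ℕ.* N) ≡ c ℕ.* (n ℕ.* N)
    lemma = ℕ-solver.solve-∀

  -- This is (-5k)^i (2i - 1)!!, the sign and number of perfect matchings with 5k per pair; the
  -- denominator 12^i is kept on the side of `W`.
  leading : ℕ → ℤ
  leading zero    = 1ℤ
  leading (suc i) = ℤ.- (+ suc (double i) ℤ.* (+ (5 ℕ.* k) ℤ.* leading i))

  leadingBound : ℕ → ℕ
  leadingBound zero    = 0
  leadingBound (suc i) = 12 ℕ.^ suc i ℕ.* recurrenceConstant i ℕ.+ suc (double i) ℕ.*
    ((48 ℕ.+ 12 ℕ.* k) ℕ.* (12 ℕ.^ i ℕ.* growthBound 4 (double i)) ℕ.+ 5 ℕ.* k ℕ.* leadingBound i)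

  -- The error has three sources: the failure `A` of the recurrence, the error `B` of the pair count
  -- multiplied by the growth bound for the previous sum, and the previous error `C` multiplied by
  -- 5kn³. Each is of the same order.
  W-leading : ∀ i n .{{_ : NonZero n}} →
    n ℕ.* ℤ.∣ + (12 ℕ.^ i) ℤ.* W 0 (double i) n ℤ.- leading i ℤ.* + (n ℕ.^ deg (double i)) ∣
    ℕ.≤ leadingBound i ℕ.* n ℕ.^ deg (double i)
  W-leading zero    n = ℕ.≤-reflexive (ℕ.*-zeroʳ n)
  W-leading (suc i) n = begin
    n ℕ.* ℤ.∣ + (12 ℕ.^ suc i) ℤ.* X′ ℤ.- leading (suc i) ℤ.* + (n ℕ.* (n ℕ.* (n ℕ.* n ℕ.^ d))) ∣
      ≡⟨ cong (λ t → n ℕ.* ℤ.∣ t ∣) split ⟩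
    n ℕ.* ℤ.∣ + (12 ℕ.^ suc i) ℤ.* A ℤ.- + m ℤ.* (B ℤ.* Y ℤ.+ + (5 ℕ.* k) ℤ.* + n³ ℤ.* C) ∣
      ≤⟨ ℕ.*-monoʳ-≤ n (ℕ.≤-trans (ℤ.∣i-j∣≤∣i∣+∣j∣ (+ (12 ℕ.^ suc i) ℤ.* A) _) (ℕ.+-mono-≤
           (ℕ.≤-reflexive (ℤ.abs-* (+ (12 ℕ.^ suc i)) A))
           (ℕ.≤-trans (ℕ.≤-reflexive (ℤ.abs-* (+ m) (B ℤ.* Y ℤ.+ + (5 ℕ.* k) ℤ.* + n³ ℤ.* C))) (ℕ.*-monoʳ-≤ m (ℕ.≤-trans (ℤ.∣i+j∣≤∣i∣+∣j∣ (B ℤ.* Y) _)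
             (ℕ.≤-reflexive (cong₂ ℕ._+_ (trans (ℤ.abs-* B Y) (cong (ℤ.∣ B ∣ ℕ.*_) (ℤ.abs-* (+ (12 ℕ.^ i)) X)))
               (trans (ℤ.abs-* (+ (5 ℕ.* k) ℤ.* + n³) C) (cong (ℕ._* ℤ.∣ C ∣) (ℤ.abs-* (+ (5 ℕ.* k)) (+ n³)))))))))))  ⟩
    n ℕ.* (12 ℕ.^ suc i ℕ.* ℤ.∣ A ∣ ℕ.+ m ℕ.* (ℤ.∣ B ∣ ℕ.* (12 ℕ.^ i ℕ.* ℤ.∣ X ∣) ℕ.+ 5 ℕ.* k ℕ.* n³ ℕ.* ℤ.∣ C ∣))
      ≡⟨ l₁ n (12 ℕ.^ suc i) (ℤ.∣ A ∣) m (ℤ.∣ B ∣ ℕ.* (12 ℕ.^ i ℕ.* ℤ.∣ X ∣)) (5 ℕ.* k) n³ (ℤ.∣ C ∣) ⟩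
    12 ℕ.^ suc i ℕ.* (n ℕ.* ℤ.∣ A ∣) ℕ.+ m ℕ.* (n ℕ.* (ℤ.∣ B ∣ ℕ.* (12 ℕ.^ i ℕ.* ℤ.∣ X ∣)) ℕ.+ 5 ℕ.* k ℕ.* n³ ℕ.* (n ℕ.* ℤ.∣ C ∣))
      ≤⟨ ℕ.+-mono-≤ (ℕ.*-monoʳ-≤ (12 ℕ.^ suc i) (W-recurrence i n))
           (ℕ.*-monoʳ-≤ m (ℕ.+-mono-≤ (ℕ.*-monoʳ-≤ n (ℕ.*-mono-≤ (∣pairs∣≤ n) (ℕ.*-monoʳ-≤ (12 ℕ.^ i) (∣W∣≤ (double i) n))))
             (ℕ.*-monoʳ-≤ (5 ℕ.* k ℕ.* n³) (W-leading i n)))) ⟩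
    12 ℕ.^ suc i ℕ.* (recurrenceConstant i ℕ.* (n ℕ.* (n ℕ.* (n ℕ.* n ℕ.^ d)))) ℕ.+ m ℕ.*
      (n ℕ.* ((48 ℕ.+ 12 ℕ.* k) ℕ.* (n ℕ.* n) ℕ.* (12 ℕ.^ i ℕ.* (growthBound 4 (double i) ℕ.* n ℕ.^ d)))
        ℕ.+ 5 ℕ.* k ℕ.* n³ ℕ.* (leadingBound i ℕ.* n ℕ.^ d))
      ≡⟨ l₂ n (12 ℕ.^ suc i) (recurrenceConstant i) (n ℕ.^ d) m (48 ℕ.+ 12 ℕ.* k) (12 ℕ.^ i) (growthBound 4 (double i)) (5 ℕ.* k) (leadingBound i) ⟩
    leadingBound (suc i) ℕ.* (n ℕ.* (n ℕ.* (n ℕ.* n ℕ.^ d))) ∎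
    where
    open ℕ.≤-Reasoning
    m d n³ : ℕ
    m  = suc (double i)
    d  = deg (double i)
    n³ = n ℕ.* (n ℕ.* n)
    X X′ A B Y C : ℤ
    X  = W 0 (double i) n
    X′ = W 0 (double (suc i)) n
    A  = X′ ℤ.+ + m ℤ.* (+ pairs N n ℤ.* X)
    B  = + 12 ℤ.* + pairs N n ℤ.- + (5 ℕ.* k) ℤ.* + n³
    Y  = + (12 ℕ.^ i) ℤ.* X
    C  = Y ℤ.- leading i ℤ.* + (n ℕ.^ d)
    identity : ∀ t X′ m p X k n³ L nᵈ →
      (+ 12 ℤ.* t) ℤ.* X′ ℤ.- (ℤ.- (m ℤ.* (k ℤ.* L))) ℤ.* (n³ ℤ.* nᵈ)
      ≡ (+ 12 ℤ.* t) ℤ.* (X′ ℤ.+ m ℤ.* (p ℤ.* X)) ℤ.- m ℤ.* ((+ 12 ℤ.* p ℤ.- k ℤ.* n³) ℤ.* (t ℤ.* X)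
          ℤ.+ k ℤ.* n³ ℤ.* (t ℤ.* X ℤ.- L ℤ.* nᵈ))
    identity = ℤ-solver.solve-∀
    split : + (12 ℕ.^ suc i) ℤ.* X′ ℤ.- leading (suc i) ℤ.* + (n ℕ.* (n ℕ.* (n ℕ.* n ℕ.^ d)))
            ≡ + (12 ℕ.^ suc i) ℤ.* A ℤ.- + m ℤ.* (B ℤ.* Y ℤ.+ + (5 ℕ.* k) ℤ.* + n³ ℤ.* C)
    split = trans (cong₂ (λ t w → t ℤ.* X′ ℤ.- leading (suc i) ℤ.* w) (ℤ.pos-* 12 (12 ℕ.^ i))
                     (trans (cong +_ (assoc n (n ℕ.^ d))) (ℤ.pos-* n³ (n ℕ.^ d))))
            (trans (identity (+ (12 ℕ.^ i)) X′ (+ m) (+ pairs N n) X (+ (5 ℕ.* k)) (+ n³) (leading i) (+ (n ℕ.^ d)))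
              (cong (λ t → t ℤ.* A ℤ.- + m ℤ.* (B ℤ.* Y ℤ.+ + (5 ℕ.* k) ℤ.* + n³ ℤ.* C)) (sym (ℤ.pos-* 12 (12 ℕ.^ i)))))
      where
      assoc : ∀ n N → n ℕ.* (n ℕ.* (n ℕ.* N)) ≡ n ℕ.* (n ℕ.* n) ℕ.* N
      assoc = ℕ-solver.solve-∀
    l₁ : ∀ n t a m b k n³ c → n ℕ.* (t ℕ.* a ℕ.+ m ℕ.* (b ℕ.+ k ℕ.* n³ ℕ.* c))
         ≡ t ℕ.* (n ℕ.* a) ℕ.+ m ℕ.* (n ℕ.* b ℕ.+ k ℕ.* n³ ℕ.* (n ℕ.* c))
    l₁ = ℕ-solver.solve-∀
    l₂ : ∀ n t′ r N m p t g k l →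
         t′ ℕ.* (r ℕ.* (n ℕ.* (n ℕ.* (n ℕ.* N)))) ℕ.+ m ℕ.* (n ℕ.* (p ℕ.* (n ℕ.* n) ℕ.* (t ℕ.* (g ℕ.* N))) ℕ.+ k ℕ.* (n ℕ.* (n ℕ.* n)) ℕ.* (l ℕ.* N))
         ≡ (t′ ℕ.* r ℕ.+ m ℕ.* (p ℕ.* (t ℕ.* g) ℕ.+ k ℕ.* l)) ℕ.* (n ℕ.* (n ℕ.* (n ℕ.* N)))
    l₂ = ℕ-solver.solve-∀

-- Rational numbers

ℚ-ring : AlmostCommutativeRing _ _
ℚ-ring = fromCommutativeRing ℚ.+-*-commutativeRing (λ x → dec⇒maybe (0ℚ ℚ.≟ x))

opaque

  toℚ : ℤ → ℚ
  toℚ i = i / 1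

  toℚ≡/1 : ∀ i → toℚ i ≡ i / 1
  toℚ≡/1 i = refl

  toℚ-1 : toℚ 1ℤ ≡ 1ℚ
  toℚ-1 = refl

  toℚ-0 : toℚ 0ℤ ≡ 0ℚ
  toℚ-0 = refl

  toℚᵘ-toℚ : ∀ i → toℚᵘ (toℚ i) ℚᵘ.≃ mkℚᵘ i 0
  toℚᵘ-toℚ i = ℚ.toℚᵘ-fromℚᵘ (mkℚᵘ i 0)

ν : ℕ → ℚ
ν n = toℚ (+ n)

fromℕ≡ν : ∀ n → fromℕ n ≡ ν n
fromℕ≡ν n = sym (toℚ≡/1 (+ n))

opaque
  unfolding toℚ

  toℚ-+ : ∀ i j → toℚ (i ℤ.+ j) ≡ toℚ i ℚ.+ toℚ j
  toℚ-+ i j = ℚ.toℚᵘ-injective (begin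
    toℚᵘ (toℚ (i ℤ.+ j))              ≈⟨ toℚᵘ-toℚ (i ℤ.+ j) ⟩
    mkℚᵘ (i ℤ.+ j) 0                  ≡⟨ cong₂ (λ a b → mkℚᵘ (a ℤ.+ b) 0) (ℤ.*-identityʳ i) (ℤ.*-identityʳ j) ⟨
    mkℚᵘ i 0 ℚᵘ.+ mkℚᵘ j 0            ≈⟨ ℚᵘ.+-cong (toℚᵘ-toℚ i) (toℚᵘ-toℚ j) ⟨
    toℚᵘ (toℚ i) ℚᵘ.+ toℚᵘ (toℚ j)    ≈⟨ ℚ.toℚᵘ-homo-+ (toℚ i) (toℚ j) ⟨
    toℚᵘ (toℚ i ℚ.+ toℚ j)            ∎)
    where open ℚᵘ.≃-Reasoning

  toℚ-* : ∀ i j → toℚ (i ℤ.* j) ≡ toℚ i ℚ.* toℚ j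
  toℚ-* i j = ℚ.toℚᵘ-injective (begin
    toℚᵘ (toℚ (i ℤ.* j))              ≈⟨ toℚᵘ-toℚ (i ℤ.* j) ⟩
    mkℚᵘ i 0 ℚᵘ.* mkℚᵘ j 0            ≈⟨ ℚᵘ.*-cong (toℚᵘ-toℚ i) (toℚᵘ-toℚ j) ⟨
    toℚᵘ (toℚ i) ℚᵘ.* toℚᵘ (toℚ j)    ≈⟨ ℚ.toℚᵘ-homo-* (toℚ i) (toℚ j) ⟨
    toℚᵘ (toℚ i ℚ.* toℚ j)            ∎)
    where open ℚᵘ.≃-Reasoning

  toℚ-neg : ∀ i → toℚ (ℤ.- i) ≡ ℚ.- toℚ i
  toℚ-neg i = ℚ.toℚᵘ-injective (begin
    toℚᵘ (toℚ (ℤ.- i))    ≈⟨ toℚᵘ-toℚ (ℤ.- i) ⟩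
    ℚᵘ.- mkℚᵘ i 0         ≈⟨ ℚᵘ.-‿cong (toℚᵘ-toℚ i) ⟨
    ℚᵘ.- toℚᵘ (toℚ i)     ≈⟨ ℚ.toℚᵘ-homo‿- (toℚ i) ⟨
    toℚᵘ (ℚ.- toℚ i)      ∎)
    where open ℚᵘ.≃-Reasoning

  ∣toℚ∣ : ∀ i → ℚ.∣ toℚ i ∣ ≡ ν ℤ.∣ i ∣
  ∣toℚ∣ i = ℚ.toℚᵘ-injective (begin
    toℚᵘ ℚ.∣ toℚ i ∣            ≈⟨ ℚ.toℚᵘ-homo-∣-∣ (toℚ i) ⟩
    ℚᵘ.∣ toℚᵘ (toℚ i) ∣       ≈⟨ ℚᵘ.∣-∣-cong (toℚᵘ-toℚ i) ⟩
    ℚᵘ.∣ mkℚᵘ i 0 ∣           ≈⟨ toℚᵘ-toℚ (+ ℤ.∣ i ∣) ⟨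
    toℚᵘ (ν ℤ.∣ i ∣)      ∎)
    where open ℚᵘ.≃-Reasoning

  ν-mono-≤ : ∀ {m n} → m ℕ.≤ n → ν m ℚ.≤ ν n
  ν-mono-≤ {m} {n} m≤n = ℚ.toℚᵘ-cancel-≤ (begin
    toℚᵘ (ν m) ≃⟨ toℚᵘ-toℚ (+ m) ⟩
    mkℚᵘ (+ m) 0   ≤⟨ *≤* (ℤ.*-monoʳ-≤-nonNeg (+ 1) (ℤ.+≤+ m≤n)) ⟩
    mkℚᵘ (+ n) 0   ≃⟨ toℚᵘ-toℚ (+ n) ⟨
    toℚᵘ (ν n) ∎)
    where open ℚᵘ.≤-Reasoning

  ν-mono-< : ∀ {m n} → m ℕ.< n → ν m ℚ.< ν n
  ν-mono-< {m} {n} m<n = ℚ.toℚᵘ-cancel-< (begin-strict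
    toℚᵘ (ν m) ≃⟨ toℚᵘ-toℚ (+ m) ⟩
    mkℚᵘ (+ m) 0   <⟨ ℚᵘ.*<* (ℤ.*-monoʳ-<-pos (+ 1) (ℤ.+<+ m<n)) ⟩
    mkℚᵘ (+ n) 0   ≃⟨ toℚᵘ-toℚ (+ n) ⟨
    toℚᵘ (ν n) ∎)
    where open ℚᵘ.≤-Reasoning

  ν-nonNeg : ∀ n → ℚ.NonNegative (ν n)
  ν-nonNeg n = ℚ.normalize-nonNeg n 1

  ν-pos : ∀ {n} → 1 ℕ.≤ n → ℚ.Positive (ν n)
  ν-pos {suc n} _ = ℚ.normalize-pos (suc n) 1

  /-* : ∀ i d .{{_ : ℕ.NonZero d}} → (i / d) ℚ.* ν d ≡ toℚ i
  /-* i (suc d) = ℚ.toℚᵘ-injective (begin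
    toℚᵘ ((i / suc d) ℚ.* ν (suc d))           ≈⟨ ℚ.toℚᵘ-homo-* (i / suc d) (ν (suc d)) ⟩
    toℚᵘ (i / suc d) ℚᵘ.* toℚᵘ (ν (suc d))     ≈⟨ ℚᵘ.*-cong (ℚ.toℚᵘ-fromℚᵘ (mkℚᵘ i d)) (toℚᵘ-toℚ (+ suc d)) ⟩
    mkℚᵘ i d ℚᵘ.* mkℚᵘ (+ suc d) 0                 ≈⟨ *≡* (trans (ℤ.*-identityʳ _) (cong (λ t → i ℤ.* + t) (sym (ℕ.*-identityʳ (suc d))))) ⟩
    mkℚᵘ i 0                                       ≈⟨ toℚᵘ-toℚ i ⟨
    toℚᵘ (toℚ i)                                   ∎)
    where open ℚᵘ.≃-Reasoning

toℚ-minus : ∀ i j → toℚ (i ℤ.- j) ≡ toℚ i ℚ.- toℚ j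
toℚ-minus i j = trans (toℚ-+ i (ℤ.- j)) (cong (toℚ i ℚ.+_) (toℚ-neg j))

ν-+ : ∀ m n → ν (m ℕ.+ n) ≡ ν m ℚ.+ ν n
ν-+ m n = toℚ-+ (+ m) (+ n)

ν-* : ∀ m n → ν (m ℕ.* n) ≡ ν m ℚ.* ν n
ν-* m n = trans (cong toℚ (ℤ.pos-* m n)) (toℚ-* (+ m) (+ n))

/-*ˡ : ∀ i d .{{_ : ℕ.NonZero d}} → ν d ℚ.* (i / d) ≡ toℚ i
/-*ˡ i d = trans (ℚ.*-comm (ν d) (i / d)) (/-* i d)

ν-cancelˡ : ∀ d .{{_ : ℕ.NonZero d}} {x y} → ν d ℚ.* x ≡ ν d ℚ.* y → x ≡ y
ν-cancelˡ d {x} {y} eq = begin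
  x                                  ≡⟨ ℚ.*-identityˡ x ⟨
  1ℚ ℚ.* x                           ≡⟨ cong (ℚ._* x) (trans (/-* (+ 1) d) toℚ-1) ⟨
  (+ 1 / d) ℚ.* ν d ℚ.* x        ≡⟨ ℚ.*-assoc (+ 1 / d) (ν d) x ⟩
  (+ 1 / d) ℚ.* (ν d ℚ.* x)      ≡⟨ cong ((+ 1 / d) ℚ.*_) eq ⟩
  (+ 1 / d) ℚ.* (ν d ℚ.* y)      ≡⟨ ℚ.*-assoc (+ 1 / d) (ν d) y ⟨
  (+ 1 / d) ℚ.* ν d ℚ.* y        ≡⟨ cong (ℚ._* y) (trans (/-* (+ 1) d) toℚ-1) ⟩
  1ℚ ℚ.* y                           ≡⟨ ℚ.*-identityˡ y ⟩
  y                                  ∎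
  where open ≡-Reasoning

bounded-by-ℕ : ∀ r → ∃[ m ] r ℚ.≤ ν m
bounded-by-ℕ r@record{} = ℤ.∣ ℚ.↥ r ∣ , ℚ.toℚᵘ-cancel-≤ (begin
  toℚᵘ r                      ≤⟨ bound (toℚᵘ r) ⟩
  mkℚᵘ (+ ℤ.∣ ℚ.↥ r ∣) 0      ≃⟨ toℚᵘ-toℚ (+ ℤ.∣ ℚ.↥ r ∣) ⟨
  toℚᵘ (ν ℤ.∣ ℚ.↥ r ∣)    ∎)
  where
  open ℚᵘ.≤-Reasoning
  bound : ∀ p → p ℚᵘ.≤ mkℚᵘ (+ ℤ.∣ ℚᵘ.↥ p ∣) 0
  bound (mkℚᵘ (+ a)     d) = *≤* (ℤ.*-monoˡ-≤-nonNeg (+ a) (ℤ.+≤+ (s≤s z≤n)))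
  bound (mkℚᵘ -[1+ a ]  d) = *≤* ℤ.-≤+

-- Take the denominator for `b`: the numerator is a nonzero integer, hence at least 1 in absolute
-- value.
nonzero-bound : ∀ x → x ≢ 0ℚ → ∃[ b ] 1ℚ ℚ.≤ ν b ℚ.* ℚ.∣ x ∣
nonzero-bound x x≢0 = ℚ.↧ₙ x , (begin
  1ℚ                                          ≤⟨ subst (ℚ._≤ ν ℤ.∣ ℚ.↥ x ∣) toℚ-1 (ν-mono-≤ (1≤∣↥∣ x x≢0)) ⟩
  ν ℤ.∣ ℚ.↥ x ∣                           ≡⟨ ∣toℚ∣ (ℚ.↥ x) ⟨
  ℚ.∣ toℚ (ℚ.↥ x) ∣                             ≡⟨ cong ℚ.∣_∣ (/-*ˡ (ℚ.↥ x) (ℚ.↧ₙ x)) ⟨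
  ℚ.∣ ν (ℚ.↧ₙ x) ℚ.* (ℚ.↥ x / ℚ.↧ₙ x) ∣     ≡⟨ cong (λ y → ℚ.∣ ν (ℚ.↧ₙ x) ℚ.* y ∣) (ℚ.↥p/↧p≡p x) ⟩
  ℚ.∣ ν (ℚ.↧ₙ x) ℚ.* x ∣                    ≡⟨ ℚ.∣p*q∣≡∣p∣*∣q∣ (ν (ℚ.↧ₙ x)) x ⟩
  ℚ.∣ ν (ℚ.↧ₙ x) ∣ ℚ.* ℚ.∣ x ∣                ≡⟨ cong (ℚ._* ℚ.∣ x ∣) (∣toℚ∣ (+ ℚ.↧ₙ x)) ⟩
  ν (ℚ.↧ₙ x) ℚ.* ℚ.∣ x ∣                    ∎)
  where
  open ℚ.≤-Reasoning
  1≤∣↥∣ : ∀ x → x ≢ 0ℚ → 1 ℕ.≤ ℤ.∣ ℚ.↥ x ∣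
  1≤∣↥∣ x@(mkℚ +0 _ _)       x≢0 = contradiction (ℚ.↥p≡0⇒p≡0 x refl) x≢0
  1≤∣↥∣ (mkℚ +[1+ _ ] _ _)   x≢0 = s≤s z≤n
  1≤∣↥∣ (mkℚ (-[1+ _ ]) _ _) x≢0 = s≤s z≤n

-- If |x| ≥ 1/b and B ≤ m, any n ≥ (m + 1) b gives n|x| ≥ m + 1 > B. Arbitrarily large n are all
-- that can be asked for, since the bound will come from a single residue class.
archimedean : ∀ x B → (∀ t → ∃[ n ] (t ℕ.≤ n × ν n ℚ.* ℚ.∣ x ∣ ℚ.≤ B)) → x ≡ 0ℚ
archimedean x B unbounded with x ℚ.≟ 0ℚ
... | yes x≡0 = x≡0
... | no  x≢0 with b , 1≤b∣x∣ ← nonzero-bound x x≢0 | m , B≤m ← bounded-by-ℕ B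
              with n , t≤n , n∣x∣≤B ← unbounded (suc m ℕ.* b) = contradiction (begin-strict
  ν m                             <⟨ ν-mono-< (ℕ.n<1+n m) ⟩
  ν (suc m)                       ≡⟨ ℚ.*-identityʳ _ ⟨
  ν (suc m) ℚ.* 1ℚ                ≤⟨ ℚ.*-monoˡ-≤-nonNeg (ν (suc m)) {{ ν-nonNeg (suc m) }} 1≤b∣x∣ ⟩
  ν (suc m) ℚ.* (ν b ℚ.* ℚ.∣ x ∣) ≡⟨ ℚ.*-assoc (ν (suc m)) (ν b) ℚ.∣ x ∣ ⟨
  ν (suc m) ℚ.* ν b ℚ.* ℚ.∣ x ∣ ≡⟨ cong (ℚ._* ℚ.∣ x ∣) (ν-* (suc m) b) ⟨
  ν (suc m ℕ.* b) ℚ.* ℚ.∣ x ∣       ≤⟨ ℚ.*-monoʳ-≤-nonNeg ℚ.∣ x ∣ {{ ℚ.∣-∣-nonNeg x }} (ν-mono-≤ t≤n) ⟩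
  ν n ℚ.* ℚ.∣ x ∣                   ≤⟨ n∣x∣≤B ⟩
  B                                   ≤⟨ B≤m ⟩
  ν m                             ∎) (ℚ.<-irrefl refl)
  where open ℚ.≤-Reasoning

-- Coefficients of quasipolynomials of small growth

-- E 0 nᵈ + E 1 nᵈ⁻¹ + ⋯ + E d
poly : (ℕ → ℚ) → ℕ → ℕ → ℚ
poly E zero    n = E 0 ℚ.* ν 1
poly E (suc d) n = E 0 ℚ.* ν (n ℕ.^ suc d) ℚ.+ poly (E ∘ suc) d n

poly≡∑ : ∀ (E : ℕ → ℚ) d n → poly E d n ≡ (∑[ j < suc d ] (E (toℕ j) ℚ.* ν (n ℕ.^ (d ∸ toℕ j))))
poly≡∑ E zero    n = sym (ℚ.+-identityʳ _)
poly≡∑ E (suc d) n = cong (E 0 ℚ.* ν (n ℕ.^ suc d) ℚ.+_) (poly≡∑ (E ∘ suc) d n)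

poly-cong : ∀ {E E′ : ℕ → ℚ} d n → (∀ j → j ℕ.≤ d → E j ≡ E′ j) → poly E d n ≡ poly E′ d n
poly-cong zero    n eq = cong (ℚ._* ν 1) (eq 0 z≤n)
poly-cong (suc d) n eq = cong₂ ℚ._+_ (cong (ℚ._* ν (n ℕ.^ suc d)) (eq 0 z≤n)) (poly-cong d n λ j j≤d → eq (suc j) (s≤s j≤d))

poly-+ : ∀ (E E′ : ℕ → ℚ) d n → poly (λ j → E j ℚ.+ E′ j) d n ≡ poly E d n ℚ.+ poly E′ d n
poly-+ E E′ zero    n = ℚ.*-distribʳ-+ (ν 1) (E 0) (E′ 0)
poly-+ E E′ (suc d) n = trans (cong ((E 0 ℚ.+ E′ 0) ℚ.* ν (n ℕ.^ suc d) ℚ.+_) (poly-+ (E ∘ suc) (E′ ∘ suc) d n))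
  (lemma (E 0) (E′ 0) (ν (n ℕ.^ suc d)) (poly (E ∘ suc) d n) (poly (E′ ∘ suc) d n))
  where
  lemma : ∀ a b x p q → (a ℚ.+ b) ℚ.* x ℚ.+ (p ℚ.+ q) ≡ a ℚ.* x ℚ.+ p ℚ.+ (b ℚ.* x ℚ.+ q)
  lemma = solve-∀ ℚ-ring

poly-* : ∀ c (E : ℕ → ℚ) d n → poly (λ j → c ℚ.* E j) d n ≡ c ℚ.* poly E d n
poly-* c E zero    n = ℚ.*-assoc c (E 0) (ν 1)
poly-* c E (suc d) n = trans (cong (c ℚ.* E 0 ℚ.* ν (n ℕ.^ suc d) ℚ.+_) (poly-* c (E ∘ suc) d n))
  (lemma c (E 0) (ν (n ℕ.^ suc d)) (poly (E ∘ suc) d n))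
  where
  lemma : ∀ c a x p → c ℚ.* a ℚ.* x ℚ.+ c ℚ.* p ≡ c ℚ.* (a ℚ.* x ℚ.+ p)
  lemma = solve-∀ ℚ-ring

poly-minus : ∀ (E E′ : ℕ → ℚ) d n → poly (λ j → E j ℚ.- E′ j) d n ≡ poly E d n ℚ.- poly E′ d n
poly-minus E E′ d n = trans (poly-cong d n λ j _ → cong (E j ℚ.+_) (neg (E′ j)))
  (trans (poly-+ E _ d n) (cong (poly E d n ℚ.+_) (trans (poly-* (ℚ.- 1ℚ) E′ d n) (sym (neg (poly E′ d n))))))
  where
  neg : ∀ x → ℚ.- x ≡ ℚ.- 1ℚ ℚ.* x
  neg = solve-∀ ℚ-ring

-- Coefficients are indexed from the top, so a factor n raises the degree without moving them. Two
-- applications absorb the n² in `W-suc`.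
poly-suc : ∀ (E : ℕ → ℚ) d n → E (suc d) ≡ 0ℚ → poly E (suc d) n ≡ ν n ℚ.* poly E d n
poly-suc E zero n eq rewrite eq | ℕ.*-identityʳ n = lemma (E 0) (ν n) (ν 1) toℚ-1
  where
  lemma : ∀ a x o → o ≡ 1ℚ → a ℚ.* x ℚ.+ 0ℚ ℚ.* o ≡ x ℚ.* (a ℚ.* o)
  lemma a x _ refl = unit a x
    where
    unit : ∀ a x → a ℚ.* x ℚ.+ 0ℚ ℚ.* 1ℚ ≡ x ℚ.* (a ℚ.* 1ℚ)
    unit = solve-∀ ℚ-ring
poly-suc E (suc d) n eq = trans (cong₂ ℚ._+_ (cong (E 0 ℚ.*_) (ν-* n (n ℕ.^ suc d))) (poly-suc (E ∘ suc) d n eq))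
  (lemma (E 0) (ν n) (ν (n ℕ.^ suc d)) (poly (E ∘ suc) d n))
  where
  lemma : ∀ a x y p → a ℚ.* (x ℚ.* y) ℚ.+ x ℚ.* p ≡ x ℚ.* (a ℚ.* y ℚ.+ p)
  lemma = solve-∀ ℚ-ring

-- Writes a single power of n as a `poly`, so that the predicted main term can be subtracted
-- coefficientwise.
kronecker : ℕ → ℕ → ℚ
kronecker zero    zero    = 1ℚ
kronecker zero    (suc j) = 0ℚ
kronecker (suc i) zero    = 0ℚ
kronecker (suc i) (suc j) = kronecker i j

kronecker-refl : ∀ i → kronecker i i ≡ 1ℚ
kronecker-refl zero    = refl
kronecker-refl (suc i) = kronecker-refl i

poly-zero : ∀ d n → poly (λ _ → 0ℚ) d n ≡ 0ℚ
poly-zero d n = trans (poly-* 0ℚ (λ _ → 1ℚ) d n) (ℚ.*-zeroˡ (poly (λ _ → 1ℚ) d n))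

poly-kronecker : ∀ i d n → i ℕ.≤ d → poly (kronecker i) d n ≡ ν (n ℕ.^ (d ∸ i))
poly-kronecker zero    zero    n _ = ℚ.*-identityˡ _
poly-kronecker zero    (suc d) n _ = trans (cong₂ ℚ._+_ (ℚ.*-identityˡ (ν (n ℕ.^ suc d))) (poly-zero d n)) (ℚ.+-identityʳ _)
poly-kronecker (suc i) (suc d) n (s≤s i≤d) =
  trans (cong₂ ℚ._+_ (ℚ.*-zeroˡ (ν (n ℕ.^ suc d))) (poly-kronecker i d n i≤d)) (ℚ.+-identityˡ _)

private
  ν-monoˡ : ∀ c {x y} → x ℚ.≤ y → ν c ℚ.* x ℚ.≤ ν c ℚ.* y
  ν-monoˡ c = ℚ.*-monoˡ-≤-nonNeg (ν c) {{ ν-nonNeg c }}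

  ∣ν∣ : ∀ n → ℚ.∣ ν n ∣ ≡ ν n
  ∣ν∣ n = ∣toℚ∣ (+ n)

  ∣x∣*ν : ∀ x n → ℚ.∣ x ℚ.* ν n ∣ ≡ ℚ.∣ x ∣ ℚ.* ν n
  ∣x∣*ν x n = trans (ℚ.∣p*q∣≡∣p∣*∣q∣ x (ν n)) (cong (ℚ.∣ x ∣ ℚ.*_) (∣ν∣ n))

coefficientSum : (ℕ → ℚ) → ℕ → ℚ
coefficientSum E zero    = ℚ.∣ E 0 ∣
coefficientSum E (suc d) = ℚ.∣ E 0 ∣ ℚ.+ coefficientSum (E ∘ suc) d

∣poly∣≤ : ∀ E d n → 1 ℕ.≤ n → ℚ.∣ poly E d n ∣ ℚ.≤ coefficientSum E d ℚ.* ν (n ℕ.^ d)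
∣poly∣≤ E zero    n _ = ℚ.≤-reflexive (∣x∣*ν (E 0) 1)
∣poly∣≤ E (suc d) n@(suc _) 1≤n = begin
  ℚ.∣ E 0 ℚ.* ν (n ℕ.^ suc d) ℚ.+ poly (E ∘ suc) d n ∣
    ≤⟨ ℚ.∣p+q∣≤∣p∣+∣q∣ (E 0 ℚ.* ν (n ℕ.^ suc d)) (poly (E ∘ suc) d n) ⟩
  ℚ.∣ E 0 ℚ.* ν (n ℕ.^ suc d) ∣ ℚ.+ ℚ.∣ poly (E ∘ suc) d n ∣
    ≤⟨ ℚ.+-mono-≤ (ℚ.≤-reflexive (∣x∣*ν (E 0) (n ℕ.^ suc d))) (∣poly∣≤ (E ∘ suc) d n 1≤n) ⟩
  ℚ.∣ E 0 ∣ ℚ.* ν (n ℕ.^ suc d) ℚ.+ S ℚ.* ν (n ℕ.^ d)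
    ≤⟨ ℚ.+-monoʳ-≤ (ℚ.∣ E 0 ∣ ℚ.* ν (n ℕ.^ suc d)) (ℚ.*-monoˡ-≤-nonNeg S {{ nonNeg (E ∘ suc) d }} (ν-mono-≤ (ℕ.m≤n*m (n ℕ.^ d) n))) ⟩
  ℚ.∣ E 0 ∣ ℚ.* ν (n ℕ.^ suc d) ℚ.+ S ℚ.* ν (n ℕ.^ suc d)
    ≡⟨ ℚ.*-distribʳ-+ (ν (n ℕ.^ suc d)) ℚ.∣ E 0 ∣ S ⟨
  coefficientSum E (suc d) ℚ.* ν (n ℕ.^ suc d) ∎
  where
  open ℚ.≤-Reasoning
  S = coefficientSum (E ∘ suc) d
  nonNeg : ∀ E d → ℚ.NonNegative (coefficientSum E d)
  nonNeg E zero    = ℚ.∣-∣-nonNeg (E 0)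
  nonNeg E (suc d) = ℚ.nonNeg+nonNeg⇒nonNeg ℚ.∣ E 0 ∣ {{ ℚ.∣-∣-nonNeg (E 0) }} (coefficientSum (E ∘ suc) d) {{ nonNeg (E ∘ suc) d }}

tailSum : (ℕ → ℚ) → ℕ → ℚ
tailSum E zero    = 0ℚ
tailSum E (suc d) = coefficientSum (E ∘ suc) d

∣poly-lead∣≤ : ∀ E d n → 1 ℕ.≤ n →
  ν n ℚ.* ℚ.∣ poly E d n ℚ.- E 0 ℚ.* ν (n ℕ.^ d) ∣ ℚ.≤ tailSum E d ℚ.* ν (n ℕ.^ d)
∣poly-lead∣≤ E zero n _ = ℚ.≤-reflexive (trans (cong (λ x → ν n ℚ.* ℚ.∣ x ∣) (ℚ.+-inverseʳ (E 0 ℚ.* ν 1)))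
  (trans (ℚ.*-zeroʳ (ν n)) (sym (ℚ.*-zeroˡ (ν 1)))))
∣poly-lead∣≤ E (suc d) n 1≤n = begin
  ν n ℚ.* ℚ.∣ E 0 ℚ.* ν (n ℕ.^ suc d) ℚ.+ poly (E ∘ suc) d n ℚ.- E 0 ℚ.* ν (n ℕ.^ suc d) ∣
    ≡⟨ cong (λ x → ν n ℚ.* ℚ.∣ x ∣) (lemma (E 0 ℚ.* ν (n ℕ.^ suc d)) (poly (E ∘ suc) d n)) ⟩
  ν n ℚ.* ℚ.∣ poly (E ∘ suc) d n ∣         ≤⟨ ν-monoˡ n (∣poly∣≤ (E ∘ suc) d n 1≤n) ⟩
  ν n ℚ.* (S ℚ.* ν (n ℕ.^ d))            ≡⟨ comm (ν n) S (ν (n ℕ.^ d)) ⟩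
  S ℚ.* (ν n ℚ.* ν (n ℕ.^ d))            ≡⟨ cong (S ℚ.*_) (ν-* n (n ℕ.^ d)) ⟨
  S ℚ.* ν (n ℕ.^ suc d)                  ∎
  where
  open ℚ.≤-Reasoning
  S = coefficientSum (E ∘ suc) d
  lemma : ∀ a b → a ℚ.+ b ℚ.- a ≡ b
  lemma = solve-∀ ℚ-ring
  comm : ∀ a b c → a ℚ.* (b ℚ.* c) ≡ b ℚ.* (a ℚ.* c)
  comm = solve-∀ ℚ-ring

-- The size is C n^(m-1), with n moved to the left to avoid the exponent m - 1.
SmallInfinitelyOften : (ℕ → ℚ) → ℕ → ℕ → ℕ → Set
SmallInfinitelyOften E d C m = ∀ t → ∃[ n ] (t ℕ.≤ n × 1 ℕ.≤ n × ν n ℚ.* ℚ.∣ poly E d n ∣ ℚ.≤ ν (C ℕ.* n ℕ.^ m))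

-- Up to the lower terms `E 0` n^d is the polynomial itself. After multiplication by n both
-- contributions are at most constants times n^d, so n|`E 0`| is bounded for arbitrarily large n.
lead≡0 : ∀ E d C m → m ℕ.≤ d → SmallInfinitelyOften E d C m → E 0 ≡ 0ℚ
lead≡0 E d C m m≤d small = archimedean (E 0) (ν C ℚ.+ tailSum E d) λ t →
  let n , t≤n , 1≤n , le = small t in n , t≤n , bound n 1≤n le
  where
  bound : ∀ n → 1 ℕ.≤ n → ν n ℚ.* ℚ.∣ poly E d n ∣ ℚ.≤ ν (C ℕ.* n ℕ.^ m) → ν n ℚ.* ℚ.∣ E 0 ∣ ℚ.≤ ν C ℚ.+ tailSum E d
  bound n@(suc _) 1≤n le = ℚ.*-cancelʳ-≤-pos (ν (n ℕ.^ d)) {{ ν-pos (ℕ.m^n>0 n d) }} (begin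
    ν n ℚ.* ℚ.∣ E 0 ∣ ℚ.* ν (n ℕ.^ d) ≡⟨ ℚ.*-assoc (ν n) ℚ.∣ E 0 ∣ (ν (n ℕ.^ d)) ⟩
    ν n ℚ.* (ℚ.∣ E 0 ∣ ℚ.* ν (n ℕ.^ d)) ≡⟨ cong (ν n ℚ.*_) (∣x∣*ν (E 0) (n ℕ.^ d)) ⟨
    ν n ℚ.* ℚ.∣ L ∣ ≡⟨ cong (λ x → ν n ℚ.* ℚ.∣ x ∣) (split p L) ⟩
    ν n ℚ.* ℚ.∣ p ℚ.- (p ℚ.- L) ∣ ≤⟨ ν-monoˡ n (ℚ.∣p-q∣≤∣p∣+∣q∣ p (p ℚ.- L)) ⟩
    ν n ℚ.* (ℚ.∣ p ∣ ℚ.+ ℚ.∣ p ℚ.- L ∣) ≡⟨ ℚ.*-distribˡ-+ (ν n) ℚ.∣ p ∣ ℚ.∣ p ℚ.- L ∣ ⟩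
    ν n ℚ.* ℚ.∣ p ∣ ℚ.+ ν n ℚ.* ℚ.∣ p ℚ.- L ∣ ≤⟨ ℚ.+-mono-≤ le (∣poly-lead∣≤ E d n 1≤n) ⟩
    ν (C ℕ.* n ℕ.^ m) ℚ.+ tailSum E d ℚ.* ν (n ℕ.^ d)
      ≤⟨ ℚ.+-monoˡ-≤ (tailSum E d ℚ.* ν (n ℕ.^ d)) (ν-mono-≤ (ℕ.*-monoʳ-≤ C (ℕ.^-monoʳ-≤ n m≤d))) ⟩
    ν (C ℕ.* n ℕ.^ d) ℚ.+ tailSum E d ℚ.* ν (n ℕ.^ d) ≡⟨ cong (ℚ._+ tailSum E d ℚ.* ν (n ℕ.^ d)) (ν-* C (n ℕ.^ d)) ⟩
    ν C ℚ.* ν (n ℕ.^ d) ℚ.+ tailSum E d ℚ.* ν (n ℕ.^ d) ≡⟨ ℚ.*-distribʳ-+ (ν (n ℕ.^ d)) (ν C) (tailSum E d) ⟨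
    (ν C ℚ.+ tailSum E d) ℚ.* ν (n ℕ.^ d) ∎)
    where
    open ℚ.≤-Reasoning
    p = poly E d n
    L = E 0 ℚ.* ν (n ℕ.^ d)
    split : ∀ p L → L ≡ p ℚ.- (p ℚ.- L)
    split = solve-∀ ℚ-ring

-- Once the top coefficient is known to vanish, the polynomial of degree one less takes the same
-- values and inherits the bound; repeat j times.
coefficient≡0 : ∀ j E d C m → m ℕ.+ j ℕ.≤ d → SmallInfinitelyOften E d C m → E j ≡ 0ℚ
coefficient≡0 zero    E d C m le small = lead≡0 E d C m (subst (ℕ._≤ d) (ℕ.+-identityʳ m) le) small
coefficient≡0 (suc j) E d C m le small rewrite ℕ.+-suc m j with d | le | small
... | suc d′ | s≤s le′ | small = coefficient≡0 j (E ∘ suc) d′ C m le′ λ t →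
  let n , t≤n , 1≤n , b = small t in n , t≤n , 1≤n , subst (λ x → ν n ℚ.* ℚ.∣ x ∣ ℚ.≤ ν (C ℕ.* n ℕ.^ m)) (drop n) b
  where
  drop : ∀ n → poly E (suc d′) n ≡ poly (E ∘ suc) d′ n
  drop n = trans (cong (λ a → a ℚ.* ν (n ℕ.^ suc d′) ℚ.+ poly (E ∘ suc) d′ n)
      (lead≡0 E (suc d′) C m (ℕ.m≤n⇒m≤1+n (ℕ.≤-trans (ℕ.m≤m+n m j) le′)) small))
    (trans (cong (ℚ._+ poly (E ∘ suc) d′ n) (ℚ.*-zeroˡ (ν (n ℕ.^ suc d′)))) (ℚ.+-identityˡ _))

-- Periodic coefficients and residue classes

Periodic-* : ∀ {f : ℕ → ℚ} p → (∀ n → f (n ℕ.+ p) ≡ f n) → ∀ t n → f (n ℕ.+ t ℕ.* p) ≡ f n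
Periodic-* {f} p per zero    n = cong f (ℕ.+-identityʳ n)
Periodic-* {f} p per (suc t) n = trans (cong f (sym (ℕ.+-assoc n p (t ℕ.* p)))) (trans (Periodic-* {f} p per t (n ℕ.+ p)) (per n))

Periodic-const : ∀ c → Periodic (λ _ → c)
Periodic-const c = 1 , ℕ.≤-refl , λ _ → refl

Periodic-map₂ : ∀ (_⊙_ : ℚ → ℚ → ℚ) {f g} → Periodic f → Periodic g → Periodic (λ n → f n ⊙ g n)
Periodic-map₂ _⊙_ {f} {g} (p , 1≤p , f-per) (q , 1≤q , g-per) = p ℕ.* q , ℕ.*-mono-≤ 1≤p 1≤q , λ n → cong₂ _⊙_
  (trans (cong (λ t → f (n ℕ.+ t)) (ℕ.*-comm p q)) (Periodic-* {f} p f-per q n)) (Periodic-* {g} q g-per p n)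

commonPeriod : ∀ (c : ℕ → ℕ → ℚ) → (∀ j → Periodic (c j)) → ∀ d →
  ∃[ p ] (1 ℕ.≤ p × (∀ j → j ℕ.≤ d → ∀ n → c j (n ℕ.+ p) ≡ c j n))
commonPeriod c per zero with p , 1≤p , pr ← per 0 = p , 1≤p , λ { .0 z≤n → pr }
commonPeriod c per (suc d) with p , 1≤p , pr ← per (suc d) | q , 1≤q , qr ← commonPeriod c per d =
  p ℕ.* q , ℕ.*-mono-≤ 1≤p 1≤q , pq
  where
  pq : ∀ j → j ℕ.≤ suc d → ∀ n → c j (n ℕ.+ p ℕ.* q) ≡ c j n
  pq j j≤ n with ℕ.m≤n⇒m<n∨m≡n j≤
  ... | inj₁ (s≤s j≤d) = Periodic-* {c j} q (qr j j≤d) p n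
  ... | inj₂ refl      = trans (cong (λ t → c j (n ℕ.+ t)) (ℕ.*-comm p q)) (Periodic-* {c j} p pr q n)

-- Along the class of n₀ modulo a common period the coefficients keep their values at n₀, which
-- leaves an ordinary polynomial with constant coefficients.
quasipolynomial-small : ∀ (c : ℕ → ℕ → ℚ) → (∀ j → Periodic (c j)) → ∀ d C m →
  (∀ n → 1 ℕ.≤ n → ν n ℚ.* ℚ.∣ poly (λ j → c j n) d n ∣ ℚ.≤ ν (C ℕ.* n ℕ.^ m)) →
  ∀ j → m ℕ.+ j ℕ.≤ d → ∀ n → c j n ≡ 0ℚ
quasipolynomial-small c per d C m small j le n₀ with p , 1≤p , pr ← commonPeriod c per d =
  coefficient≡0 j (λ j → c j n₀) d C m le λ t →
    -- `suc t` keeps n positive also for n₀ = 0, where the size bound is not assumed.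
    let n = n₀ ℕ.+ suc t ℕ.* p in
    n , ℕ.≤-trans (ℕ.n≤1+n t) (st≤ t) , ℕ.≤-trans (s≤s z≤n) (st≤ t) ,
    subst (λ x → ν n ℚ.* ℚ.∣ x ∣ ℚ.≤ ν (C ℕ.* n ℕ.^ m))
      (poly-cong d n λ j j≤d → Periodic-* {c j} p (pr j j≤d) (suc t) n₀)
      (small n (ℕ.≤-trans (s≤s z≤n) (st≤ t)))
  where
  st≤ : ∀ t → suc t ℕ.≤ n₀ ℕ.+ suc t ℕ.* p
  st≤ t = ℕ.≤-trans (ℕ.m≤m*n (suc t) p {{ ℕ.>-nonZero 1≤p }}) (ℕ.m≤n+m _ n₀)

-- Newton interpolation

∑ℚ : ℕ → (ℕ → ℚ) → ℚ
∑ℚ zero    a = 0ℚ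
∑ℚ (suc m) a = a 0 ℚ.+ ∑ℚ m (a ∘ suc)

∑ℚ≡∑ : ∀ m (a : ℕ → ℚ) → ∑ℚ m a ≡ (∑[ s < m ] a (toℕ s))
∑ℚ≡∑ zero    a = refl
∑ℚ≡∑ (suc m) a = cong (a 0 ℚ.+_) (∑ℚ≡∑ m (a ∘ suc))

∑ℚ-cong : ∀ m {a b : ℕ → ℚ} → (∀ s → s ℕ.< m → a s ≡ b s) → ∑ℚ m a ≡ ∑ℚ m b
∑ℚ-cong zero    eq = refl
∑ℚ-cong (suc m) eq = cong₂ ℚ._+_ (eq 0 (s≤s z≤n)) (∑ℚ-cong m λ s s<m → eq (suc s) (s≤s s<m))

∑ℚ-+ : ∀ m (a b : ℕ → ℚ) → ∑ℚ m (λ s → a s ℚ.+ b s) ≡ ∑ℚ m a ℚ.+ ∑ℚ m b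
∑ℚ-+ zero    a b = refl
∑ℚ-+ (suc m) a b = trans (cong (a 0 ℚ.+ b 0 ℚ.+_) (∑ℚ-+ m (a ∘ suc) (b ∘ suc)))
  (lemma (a 0) (b 0) (∑ℚ m (a ∘ suc)) (∑ℚ m (b ∘ suc)))
  where
  lemma : ∀ a b p q → a ℚ.+ b ℚ.+ (p ℚ.+ q) ≡ a ℚ.+ p ℚ.+ (b ℚ.+ q)
  lemma = solve-∀ ℚ-ring

∑ℚ-* : ∀ m c (a : ℕ → ℚ) → ∑ℚ m (λ s → c ℚ.* a s) ≡ c ℚ.* ∑ℚ m a
∑ℚ-* zero    c a = sym (ℚ.*-zeroʳ c)
∑ℚ-* (suc m) c a = trans (cong (c ℚ.* a 0 ℚ.+_) (∑ℚ-* m c (a ∘ suc))) (sym (ℚ.*-distribˡ-+ c (a 0) _))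

∑ℚ-zero : ∀ m → ∑ℚ m (λ _ → 0ℚ) ≡ 0ℚ
∑ℚ-zero zero    = refl
∑ℚ-zero (suc m) = trans (ℚ.+-identityˡ _) (∑ℚ-zero m)

∑ℚ-comm : ∀ m l (a : ℕ → ℕ → ℚ) → ∑ℚ m (λ s → ∑ℚ l (a s)) ≡ ∑ℚ l (λ j → ∑ℚ m (λ s → a s j))
∑ℚ-comm zero    l a = sym (∑ℚ-zero l)
∑ℚ-comm (suc m) l a = trans (cong (∑ℚ l (a 0) ℚ.+_) (∑ℚ-comm m l (a ∘ suc))) (sym (∑ℚ-+ l (a 0) _))

∑ℚ-last : ∀ m (a : ℕ → ℚ) → ∑ℚ (suc m) a ≡ ∑ℚ m a ℚ.+ a m
∑ℚ-last zero    a = ℚ.+-comm (a 0) 0ℚ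
∑ℚ-last (suc m) a = trans (cong (a 0 ℚ.+_) (∑ℚ-last m (a ∘ suc))) (sym (ℚ.+-assoc (a 0) _ _))

∂ : (ℕ → ℚ) → ℕ → ℚ
∂ c r = c (suc r) ℚ.- c r

-- Differencing the sequence before recursing suits the induction of `newton`; `Δ-suc` gives the
-- opposite order, which is that of `W-suc`.
Δ : ℕ → (ℕ → ℚ) → ℕ → ℚ
Δ zero    c r = c r
Δ (suc s) c r = Δ s (∂ c) r

Δ-suc : ∀ s c r → Δ (suc s) c r ≡ Δ s c (suc r) ℚ.- Δ s c r
Δ-suc zero    c r = refl
Δ-suc (suc s) c r = Δ-suc s (∂ c) r

binomial : ℕ → ℕ → ℚ
binomial q       zero    = 1ℚ
binomial zero    (suc s) = 0ℚ
binomial (suc q) (suc s) = binomial q (suc s) ℚ.+ binomial q s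

-- Induction on q: expand `c q` and `∂ c q` in c (q + 1) = c q + ∂ c q and combine them by Pascal's
-- rule. The differences of `∂ c` vanish one step earlier, hence the smaller m.
newton : ∀ q m (c : ℕ → ℚ) → (∀ s → m ℕ.≤ s → Δ s c 0 ≡ 0ℚ) → c q ≡ ∑ℚ m (λ s → binomial q s ℚ.* Δ s c 0)
newton zero    zero    c v = v 0 z≤n
newton zero    (suc m) c v = begin
  c 0                                        ≡⟨ ring (c 0) ⟩
  1ℚ ℚ.* c 0 ℚ.+ 0ℚ                          ≡⟨ cong (1ℚ ℚ.* c 0 ℚ.+_) (trans (∑ℚ-cong m λ s _ → ℚ.*-zeroˡ (Δ s (∂ c) 0)) (∑ℚ-zero m)) ⟨
  1ℚ ℚ.* c 0 ℚ.+ ∑ℚ m (λ s → 0ℚ ℚ.* Δ s (∂ c) 0) ∎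
  where
  open ≡-Reasoning
  ring : ∀ x → x ≡ 1ℚ ℚ.* x ℚ.+ 0ℚ
  ring = solve-∀ ℚ-ring
newton (suc q) zero    c v = trans (step (c (suc q)) (c q))
  (cong₂ ℚ._+_ (newton q zero c v) (newton q zero (∂ c) λ s _ → v (suc s) z≤n))
  where
  step : ∀ x y → x ≡ y ℚ.+ (x ℚ.- y)
  step = solve-∀ ℚ-ring
newton (suc q) (suc m) c v = begin
  c (suc q)
    ≡⟨ step (c (suc q)) (c q) ⟩
  c q ℚ.+ ∂ c q
    ≡⟨ cong₂ ℚ._+_ (newton q (suc m) c v) (newton q m (∂ c) λ s m≤s → v (suc s) (s≤s m≤s)) ⟩
  1ℚ ℚ.* c 0 ℚ.+ ∑ℚ m (λ s → binomial q (suc s) ℚ.* Δ s (∂ c) 0) ℚ.+ ∑ℚ m (λ s → binomial q s ℚ.* Δ s (∂ c) 0)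
    ≡⟨ ℚ.+-assoc (1ℚ ℚ.* c 0) _ _ ⟩
  1ℚ ℚ.* c 0 ℚ.+ (∑ℚ m (λ s → binomial q (suc s) ℚ.* Δ s (∂ c) 0) ℚ.+ ∑ℚ m (λ s → binomial q s ℚ.* Δ s (∂ c) 0))
    ≡⟨ cong (1ℚ ℚ.* c 0 ℚ.+_) (trans (∑ℚ-cong m λ s _ → ℚ.*-distribʳ-+ (Δ s (∂ c) 0) (binomial q (suc s)) (binomial q s))
         (∑ℚ-+ m (λ s → binomial q (suc s) ℚ.* Δ s (∂ c) 0) _)) ⟨
  1ℚ ℚ.* c 0 ℚ.+ ∑ℚ m (λ s → (binomial q (suc s) ℚ.+ binomial q s) ℚ.* Δ s (∂ c) 0) ∎
  where
  open ≡-Reasoning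
  step : ∀ x y → x ≡ y ℚ.+ (x ℚ.- y)
  step = solve-∀ ℚ-ring

-- The factor q - s is taken in ℚ; where it is negative the binomial coefficient is 0. This identity
-- is the source of the recursion defining `β`.
binomial-absorb : ∀ q s → ν (suc s) ℚ.* binomial q (suc s) ≡ (ν q ℚ.- ν s) ℚ.* binomial q s
binomial-absorb zero zero    = trans (ℚ.*-zeroʳ (ν 1)) (sym (trans (cong (ℚ._* 1ℚ) (ℚ.+-inverseʳ (ν 0))) refl))
binomial-absorb zero (suc s) = trans (ℚ.*-zeroʳ (ν (suc (suc s)))) (sym (ℚ.*-zeroʳ (ν 0 ℚ.- ν (suc s))))
binomial-absorb (suc q) zero = begin
  ν 1 ℚ.* (binomial q 1 ℚ.+ 1ℚ)          ≡⟨ ℚ.*-distribˡ-+ (ν 1) (binomial q 1) 1ℚ ⟩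
  ν 1 ℚ.* binomial q 1 ℚ.+ ν 1 ℚ.* 1ℚ    ≡⟨ cong (ℚ._+ ν 1 ℚ.* 1ℚ) (binomial-absorb q 0) ⟩
  (ν q ℚ.- ν 0) ℚ.* 1ℚ ℚ.+ ν 1 ℚ.* 1ℚ    ≡⟨ ring (ν q) (ν 0) (ν 1) ⟩
  (ν 1 ℚ.+ ν q ℚ.- ν 0) ℚ.* 1ℚ           ≡⟨ cong (λ t → (t ℚ.- ν 0) ℚ.* 1ℚ) (ν-+ 1 q) ⟨
  (ν (suc q) ℚ.- ν 0) ℚ.* 1ℚ             ∎
  where
  open ≡-Reasoning
  ring : ∀ q z o → (q ℚ.- z) ℚ.* 1ℚ ℚ.+ o ℚ.* 1ℚ ≡ (o ℚ.+ q ℚ.- z) ℚ.* 1ℚ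
  ring = solve-∀ ℚ-ring
binomial-absorb (suc q) (suc s) = begin
  ν (2 ℕ.+ s) ℚ.* (b₂ ℚ.+ b₁)
    ≡⟨ ℚ.*-distribˡ-+ (ν (2 ℕ.+ s)) b₂ b₁ ⟩
  ν (2 ℕ.+ s) ℚ.* b₂ ℚ.+ ν (2 ℕ.+ s) ℚ.* b₁
    ≡⟨ cong₂ ℚ._+_ (binomial-absorb q (suc s)) (cong (ℚ._* b₁) (ν-+ 1 (suc s))) ⟩
  (ν q ℚ.- ν (suc s)) ℚ.* b₁ ℚ.+ (ν 1 ℚ.+ ν (suc s)) ℚ.* b₁
    ≡⟨ ring₁ (ν q) (ν (suc s)) (ν 1) b₁ ⟩
  (ν 1 ℚ.+ ν q ℚ.- ν (suc s)) ℚ.* b₁ ℚ.+ ν (suc s) ℚ.* b₁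
    ≡⟨ cong ((ν 1 ℚ.+ ν q ℚ.- ν (suc s)) ℚ.* b₁ ℚ.+_) (binomial-absorb q s) ⟩
  (ν 1 ℚ.+ ν q ℚ.- ν (suc s)) ℚ.* b₁ ℚ.+ (ν q ℚ.- ν s) ℚ.* b₀
    ≡⟨ cong (λ t → (ν 1 ℚ.+ ν q ℚ.- t) ℚ.* b₁ ℚ.+ (ν q ℚ.- ν s) ℚ.* b₀) (ν-+ 1 s) ⟩
  (ν 1 ℚ.+ ν q ℚ.- (ν 1 ℚ.+ ν s)) ℚ.* b₁ ℚ.+ (ν q ℚ.- ν s) ℚ.* b₀
    ≡⟨ ring₂ (ν 1) (ν q) (ν s) b₁ b₀ ⟩
  (ν 1 ℚ.+ ν q ℚ.- (ν 1 ℚ.+ ν s)) ℚ.* (b₁ ℚ.+ b₀)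
    ≡⟨ cong₂ (λ t w → (t ℚ.- w) ℚ.* (b₁ ℚ.+ b₀)) (ν-+ 1 q) (ν-+ 1 s) ⟨
  (ν (suc q) ℚ.- ν (suc s)) ℚ.* (b₁ ℚ.+ b₀) ∎
  where
  open ≡-Reasoning
  b₀ b₁ b₂ : ℚ
  b₀ = binomial q s
  b₁ = binomial q (suc s)
  b₂ = binomial q (suc (suc s))
  ring₁ : ∀ q s o b → (q ℚ.- s) ℚ.* b ℚ.+ (o ℚ.+ s) ℚ.* b ≡ (o ℚ.+ q ℚ.- s) ℚ.* b ℚ.+ s ℚ.* b
  ring₁ = solve-∀ ℚ-ring
  ring₂ : ∀ o q s b₁ b₀ → (o ℚ.+ q ℚ.- (o ℚ.+ s)) ℚ.* b₁ ℚ.+ (q ℚ.- s) ℚ.* b₀ ≡ (o ℚ.+ q ℚ.- (o ℚ.+ s)) ℚ.* (b₁ ℚ.+ b₀)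
  ring₂ = solve-∀ ℚ-ring

inv : ℕ → ℚ
inv s = + 1 / suc s

ν*inv : ∀ s → ν (suc s) ℚ.* inv s ≡ 1ℚ
ν*inv s = trans (/-*ˡ (+ 1) (suc s)) toℚ-1

-- The coefficient of qʲ in the binomial coefficient q(q − 1)⋯(q − s + 1) / s!.
β : ℕ → ℕ → ℚ
β zero    zero    = 1ℚ
β zero    (suc j) = 0ℚ
β (suc s) zero    = inv s ℚ.* (ℚ.- (ν s ℚ.* β s 0))
β (suc s) (suc j) = inv s ℚ.* (β s j ℚ.- ν s ℚ.* β s (suc j))

β-vanishing : ∀ s j → s ℕ.< j → β s j ≡ 0ℚ
β-vanishing zero    (suc j) _         = refl
β-vanishing (suc s) (suc j) (s≤s s<j) rewrite β-vanishing s j s<j | β-vanishing s (suc j) (ℕ.m<n⇒m<1+n s<j) = ring (inv s) (ν s)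
  where
  ring : ∀ i s → i ℚ.* (0ℚ ℚ.- s ℚ.* 0ℚ) ≡ 0ℚ
  ring = solve-∀ ℚ-ring

β-diagonal : ∀ s → β (suc s) (suc s) ≡ inv s ℚ.* β s s
β-diagonal s rewrite β-vanishing s (suc s) (ℕ.n<1+n s) = ring (inv s) (ν s) (β s s)
  where
  ring : ∀ i s b → i ℚ.* (b ℚ.- s ℚ.* 0ℚ) ≡ i ℚ.* b
  ring = solve-∀ ℚ-ring

-- The upper limit is left open so that one m serves all binomial coefficients of the Newton sum at
-- once, which allows the two sums to be exchanged.
∑-β : ∀ s m q → s ℕ.< m → ∑ℚ m (λ j → β s j ℚ.* ν (q ℕ.^ j)) ≡ binomial q s
∑-β zero    (suc m) q _ = trans (cong₂ ℚ._+_ (trans (ℚ.*-identityˡ (ν 1)) toℚ-1)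
  (trans (∑ℚ-cong m λ j _ → ℚ.*-zeroˡ (ν (q ℕ.^ suc j))) (∑ℚ-zero m))) refl
∑-β (suc s) (suc m) q (s≤s s<m) = begin
  inv s ℚ.* (ℚ.- (ν s ℚ.* β s 0)) ℚ.* ν 1 ℚ.+ ∑ℚ m (λ j → inv s ℚ.* (β s j ℚ.- ν s ℚ.* β s (suc j)) ℚ.* ν (q ℕ.^ suc j))
    ≡⟨ cong (inv s ℚ.* (ℚ.- (ν s ℚ.* β s 0)) ℚ.* ν 1 ℚ.+_) (trans (∑ℚ-cong m split)
         (trans (∑ℚ-+ m _ _) (cong₂ ℚ._+_ (∑ℚ-* m (inv s ℚ.* ν q) _) (∑ℚ-* m (ℚ.- (inv s ℚ.* ν s)) _)))) ⟩
  inv s ℚ.* (ℚ.- (ν s ℚ.* β s 0)) ℚ.* ν 1 ℚ.+ (inv s ℚ.* ν q ℚ.* A ℚ.+ ℚ.- (inv s ℚ.* ν s) ℚ.* B)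
    ≡⟨ ring (inv s) (ν s) (β s 0) (ν 1) (ν q) A B ⟩
  inv s ℚ.* (ν q ℚ.* A ℚ.- ν s ℚ.* (β s 0 ℚ.* ν 1 ℚ.+ B))
    ≡⟨ cong₂ (λ a b → inv s ℚ.* (ν q ℚ.* a ℚ.- ν s ℚ.* b)) (∑-β s m q s<m) (∑-β s (suc m) q (ℕ.m<n⇒m<1+n s<m)) ⟩
  inv s ℚ.* (ν q ℚ.* binomial q s ℚ.- ν s ℚ.* binomial q s)
    ≡⟨ cong (inv s ℚ.*_) (trans (factor (ν q) (ν s) (binomial q s)) (sym (binomial-absorb q s))) ⟩
  inv s ℚ.* (ν (suc s) ℚ.* binomial q (suc s))
    ≡⟨ assoc (inv s) (ν (suc s)) (binomial q (suc s)) ⟩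
  ν (suc s) ℚ.* inv s ℚ.* binomial q (suc s)
    ≡⟨ trans (cong (ℚ._* binomial q (suc s)) (ν*inv s)) (ℚ.*-identityˡ _) ⟩
  binomial q (suc s) ∎
  where
  open ≡-Reasoning
  A B : ℚ
  A = ∑ℚ m (λ j → β s j ℚ.* ν (q ℕ.^ j))
  B = ∑ℚ m (λ j → β s (suc j) ℚ.* ν (q ℕ.^ suc j))
  distrib : ∀ i b s c x y → i ℚ.* (b ℚ.- s ℚ.* c) ℚ.* (x ℚ.* y) ≡ i ℚ.* x ℚ.* (b ℚ.* y) ℚ.+ ℚ.- (i ℚ.* s) ℚ.* (c ℚ.* (x ℚ.* y))
  distrib = solve-∀ ℚ-ring
  split : ∀ j → j ℕ.< m → inv s ℚ.* (β s j ℚ.- ν s ℚ.* β s (suc j)) ℚ.* ν (q ℕ.^ suc j)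
          ≡ inv s ℚ.* ν q ℚ.* (β s j ℚ.* ν (q ℕ.^ j)) ℚ.+ ℚ.- (inv s ℚ.* ν s) ℚ.* (β s (suc j) ℚ.* ν (q ℕ.^ suc j))
  split j _ rewrite ν-* q (q ℕ.^ j) = distrib (inv s) (β s j) (ν s) (β s (suc j)) (ν q) (ν (q ℕ.^ j))
  ring : ∀ i s b o q A B → i ℚ.* (ℚ.- (s ℚ.* b)) ℚ.* o ℚ.+ (i ℚ.* q ℚ.* A ℚ.+ ℚ.- (i ℚ.* s) ℚ.* B) ≡ i ℚ.* (q ℚ.* A ℚ.- s ℚ.* (b ℚ.* o ℚ.+ B))
  ring = solve-∀ ℚ-ring
  factor : ∀ q s b → q ℚ.* b ℚ.- s ℚ.* b ≡ (q ℚ.- s) ℚ.* b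
  factor = solve-∀ ℚ-ring
  assoc : ∀ i s b → i ℚ.* (s ℚ.* b) ≡ s ℚ.* i ℚ.* b
  assoc = solve-∀ ℚ-ring

-- The coefficients of the counting quasipolynomials

double≡2* : ∀ i → double i ≡ 2 ℕ.* i
double≡2* zero    = refl
double≡2* (suc i) = trans (cong (2 ℕ.+_) (double≡2* i)) (sym (ℕ.*-suc 2 i))

2*deg≤3* : ∀ s → 2 ℕ.* deg s ℕ.≤ 3 ℕ.* s
2*deg≤3* 0             = z≤n
2*deg≤3* 1             = s≤s (s≤s z≤n)
2*deg≤3* (suc (suc s)) = subst₂ ℕ._≤_ (sym (ℕ.*-distribˡ-+ 2 3 (deg s))) (sym (ℕ.*-distribˡ-+ 3 2 s)) (ℕ.+-monoʳ-≤ 6 (2*deg≤3* s))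

-- The threshold of the proof: for s > 2i the power n^(2s-i) lies above the growth n^`deg s`.
-- Doubling avoids the floor in `deg`.
1+deg+i≤2* : ∀ {s i} → 2 ℕ.* i ℕ.< s → suc (deg s) ℕ.+ i ℕ.≤ 2 ℕ.* s
1+deg+i≤2* {s} {i} 2i<s = ℕ.≤-pred (ℕ.*-cancelˡ-< 2 _ _ (begin-strict
  2 ℕ.* (suc (deg s) ℕ.+ i)               ≡⟨ l (deg s) i ⟩
  2 ℕ.* deg s ℕ.+ (1 ℕ.+ suc (2 ℕ.* i))   ≤⟨ ℕ.+-mono-≤ (2*deg≤3* s) (ℕ.+-monoʳ-≤ 1 2i<s) ⟩
  3 ℕ.* s ℕ.+ (1 ℕ.+ s)                 <⟨ ℕ.n<1+n _ ⟩
  suc (3 ℕ.* s ℕ.+ (1 ℕ.+ s))           ≡⟨ r s ⟩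
  2 ℕ.* suc (2 ℕ.* s)                   ∎))
  where
  open ℕ.≤-Reasoning
  l : ∀ e i → 2 ℕ.* (suc e ℕ.+ i) ≡ 2 ℕ.* e ℕ.+ (1 ℕ.+ suc (2 ℕ.* i))
  l = ℕ-solver.solve-∀
  r : ∀ s → suc (3 ℕ.* s ℕ.+ (1 ℕ.+ s)) ≡ 2 ℕ.* suc (2 ℕ.* s)
  r = ℕ-solver.solve-∀

-- The borderline s = 2i, where n^(2s-i) has exactly the exponent 3i of the growth bound.
deg-double+ : ∀ i → deg (double i) ℕ.+ i ≡ 2 ℕ.* double i
deg-double+ zero    = refl
deg-double+ (suc i) = trans (l (deg (double i)) i) (trans (cong (4 ℕ.+_) (deg-double+ i)) (sym (ℕ.*-distribˡ-+ 2 2 (double i))))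
  where
  l : ∀ e i → 3 ℕ.+ e ℕ.+ suc i ≡ 4 ℕ.+ (e ℕ.+ i)
  l = ℕ-solver.solve-∀

module Coefficients (N : PartialNightrider) (nonempty : ∃[ j ] j ∈ₛ N) (γ : ℕ → ℕ → ℕ → ℚ)
                    (quasi : ∀ q → IsQuasipolynomial (u N q) (2 ℕ.* q) (γ q)) where

  open Placements N nonempty
  open IsQuasipolynomial

  c : ℕ → ℕ → ℕ → ℚ
  c i n q = ν (q !) ℚ.* γ q i n

  w : ℕ → ℕ → ℕ → ℚ
  w s i n = Δ s (c i n) 0

  Δ-periodic : ∀ s i r → Periodic (λ n → Δ s (c i n) r)
  Δ-periodic zero    i r = Periodic-map₂ ℚ._*_ (Periodic-const (ν (r !))) (periodic (quasi r) i)
  Δ-periodic (suc s) i r with p , 1≤p , per ← Periodic-map₂ ℚ._-_ (Δ-periodic s i (suc r)) (Δ-periodic s i r) =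
    p , 1≤p , λ n → trans (Δ-suc s (c i (n ℕ.+ p)) r) (trans (per n) (sym (Δ-suc s (c i n) r)))

  -- The s-th difference at r involves at most s + r pieces, whose counts have degree at most 2 (s +
  -- r). The zeros beyond it let `poly-suc` apply in `W-expansion`.
  Δ-vanishing : ∀ s i n r → 2 ℕ.* (s ℕ.+ r) ℕ.< i → Δ s (c i n) r ≡ 0ℚ
  Δ-vanishing zero    i n r <i = trans (cong (ν (r !) ℚ.*_) (vanishing (quasi r) i <i n)) (ℚ.*-zeroʳ (ν (r !)))
  Δ-vanishing (suc s) i n r <i = trans (Δ-suc s (c i n) r) (cong₂ ℚ._-_
    (Δ-vanishing s i n (suc r) (subst (λ t → 2 ℕ.* t ℕ.< i) (sym (ℕ.+-suc s r)) <i))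
    (Δ-vanishing s i n r (ℕ.<-≤-trans (s≤s (ℕ.*-monoʳ-≤ 2 (ℕ.n≤1+n (s ℕ.+ r)))) <i)))

  -- Counting from the top, coefficient i of n² `W r s` is coefficient i of `W r s`, and the degree
  -- agrees with that of `W (suc r) s`. So `W-suc` becomes the plain difference in r of each
  -- coefficient.
  W-expansion : ∀ s r n → 1 ℕ.≤ n → toℚ (W r s n) ≡ poly (λ i → Δ s (c i n) r) (2 ℕ.* (s ℕ.+ r)) n
  W-expansion zero r n 1≤n = begin
    toℚ (W r 0 n)                             ≡⟨ cong toℚ (W-zero r n) ⟩
    ν ((r !) ℕ.* u N r n)                     ≡⟨ ν-* (r !) (u N r n) ⟩
    ν (r !) ℚ.* ν (u N r n)                   ≡⟨ cong (ν (r !) ℚ.*_) (trans (sym (fromℕ≡ν (u N r n))) (expansion (quasi r) n 1≤n)) ⟩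
    ν (r !) ℚ.* (∑[ i < suc (2 ℕ.* r) ] (γ r (toℕ i) n ℚ.* fromℕ (n ℕ.^ (2 ℕ.* r ∸ toℕ i))))
      ≡⟨ cong (ν (r !) ℚ.*_) (trans (sum-cong-≗ {suc (2 ℕ.* r)} λ i → cong (γ r (toℕ i) n ℚ.*_) (fromℕ≡ν (n ℕ.^ (2 ℕ.* r ∸ toℕ i))))
           (sym (poly≡∑ (λ i → γ r i n) (2 ℕ.* r) n))) ⟩
    ν (r !) ℚ.* poly (λ i → γ r i n) (2 ℕ.* r) n ≡⟨ poly-* (ν (r !)) (λ i → γ r i n) (2 ℕ.* r) n ⟨
    poly (λ i → c i n r) (2 ℕ.* r) n          ∎
    where
    open ≡-Reasoning
  W-expansion (suc s) r n 1≤n = begin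
    toℚ (W r (suc s) n) ≡⟨ cong toℚ (W-suc r s n) ⟩
    toℚ (W (suc r) s n ℤ.- + (n ℕ.* n) ℤ.* W r s n)
      ≡⟨ trans (toℚ-minus (W (suc r) s n) _) (cong (λ t → toℚ (W (suc r) s n) ℚ.- t)
           (trans (toℚ-* (+ (n ℕ.* n)) (W r s n)) (cong (ℚ._* toℚ (W r s n)) (ν-* n n)))) ⟩
    toℚ (W (suc r) s n) ℚ.- ν n ℚ.* ν n ℚ.* toℚ (W r s n)
      ≡⟨ cong₂ (λ x y → x ℚ.- ν n ℚ.* ν n ℚ.* y)
           (trans (W-expansion s (suc r) n 1≤n) (cong (λ d → poly E₁ d n) degree))
           (W-expansion s r n 1≤n) ⟩
    poly E₁ (2 ℕ.+ d) n ℚ.- ν n ℚ.* ν n ℚ.* poly E₀ d n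
      ≡⟨ cong (λ t → poly E₁ (2 ℕ.+ d) n ℚ.- t) (trans (ℚ.*-assoc (ν n) (ν n) (poly E₀ d n)) (sym (trans
           (poly-suc E₀ (suc d) n (Δ-vanishing s (2 ℕ.+ d) n r (ℕ.m<n⇒m<1+n (ℕ.n<1+n d))))
           (cong (ν n ℚ.*_) (poly-suc E₀ d n (Δ-vanishing s (suc d) n r (ℕ.n<1+n d))))))) ⟩
    poly E₁ (2 ℕ.+ d) n ℚ.- poly E₀ (2 ℕ.+ d) n
      ≡⟨ poly-minus E₁ E₀ (2 ℕ.+ d) n ⟨
    poly (λ i → E₁ i ℚ.- E₀ i) (2 ℕ.+ d) n
      ≡⟨ poly-cong (2 ℕ.+ d) n (λ i _ → Δ-suc s (c i n) r) ⟨
    poly (λ i → Δ (suc s) (c i n) r) (2 ℕ.+ d) n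
      ≡⟨ cong (λ d → poly (λ i → Δ (suc s) (c i n) r) d n) (ℕ.*-suc 2 (s ℕ.+ r)) ⟨
    poly (λ i → Δ (suc s) (c i n) r) (2 ℕ.* (suc s ℕ.+ r)) n ∎
    where
    open ≡-Reasoning
    d : ℕ
    d = 2 ℕ.* (s ℕ.+ r)
    E₀ E₁ : ℕ → ℚ
    E₀ i = Δ s (c i n) r
    E₁ i = Δ s (c i n) (suc r)
    degree : 2 ℕ.* (s ℕ.+ suc r) ≡ 2 ℕ.+ d
    degree = trans (cong (2 ℕ.*_) (ℕ.+-suc s r)) (ℕ.*-suc 2 (s ℕ.+ r))

  w-expansion : ∀ s n → 1 ℕ.≤ n → toℚ (W 0 s n) ≡ poly (λ i → w s i n) (2 ℕ.* s) n
  w-expansion s n 1≤n = trans (W-expansion s 0 n 1≤n) (cong (λ d → poly (λ i → w s i n) (2 ℕ.* d) n) (ℕ.+-identityʳ s))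

  -- The growth bound, multiplied by n to fit `quasipolynomial-small`, has exponent `suc (deg s)`,
  -- and `1+deg+i≤2*` places coefficient i above it.
  w≡0 : ∀ {s i} n → 2 ℕ.* i ℕ.< s → w s i n ≡ 0ℚ
  w≡0 {s} {i} n 2i<s = quasipolynomial-small (w s) (λ i → Δ-periodic s i 0) (2 ℕ.* s) (growthBound 4 s) (suc (deg s))
    (λ { n@(suc _) 1≤n → subst (λ x → ν n ℚ.* ℚ.∣ x ∣ ℚ.≤ ν (growthBound 4 s ℕ.* n ℕ.^ suc (deg s))) (w-expansion s n 1≤n)
      (subst (ℚ._≤ ν (growthBound 4 s ℕ.* n ℕ.^ suc (deg s))) (trans (ν-* n ℤ.∣ W 0 s n ∣) (cong (ν n ℚ.*_) (sym (∣toℚ∣ (W 0 s n)))))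
        (ν-mono-≤ (ℕ.≤-trans (ℕ.*-monoʳ-≤ n (∣W∣≤ s n)) (ℕ.≤-reflexive (comm n (growthBound 4 s) (n ℕ.^ deg s)))))) })
    i (1+deg+i≤2* 2i<s) n
    where
    comm : ∀ a b c → a ℕ.* (b ℕ.* c) ≡ b ℕ.* (a ℕ.* c)
    comm = ℕ-solver.solve-∀

  -- Subtract the predicted monomial from 12^i `W`: the remainder is small by `W-leading`, so its
  -- coefficient at n^(3i), which is the difference of the two sides, vanishes.
  w-leading : ∀ i n → ν (12 ℕ.^ i) ℚ.* w (double i) i n ≡ toℚ (leading i)
  w-leading i n = x∙y⁻¹≈ε⇒x≈y _ _ (trans (cong (λ t → ν (12 ℕ.^ i) ℚ.* w s i n ℚ.- t)
      (sym (trans (cong (toℚ (leading i) ℚ.*_) (kronecker-refl i)) (ℚ.*-identityʳ _))))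
    (quasipolynomial-small E
      (λ j → Periodic-map₂ ℚ._-_ (Periodic-map₂ ℚ._*_ (Periodic-const (ν (12 ℕ.^ i))) (Δ-periodic s j 0)) (Periodic-const _))
      (2 ℕ.* s) (leadingBound i) (deg s)
      (λ { n@(suc _) 1≤n → subst (λ x → ν n ℚ.* ℚ.∣ x ∣ ℚ.≤ ν (leadingBound i ℕ.* n ℕ.^ deg s)) (difference n 1≤n)
        (subst (ℚ._≤ ν (leadingBound i ℕ.* n ℕ.^ deg s)) (trans (ν-* n _) (cong (ν n ℚ.*_) (sym (∣toℚ∣ _))))
          (ν-mono-≤ (W-leading i n))) })
      i (ℕ.≤-reflexive (deg-double+ i)) n))
    where
    s = double i
    E : ℕ → ℕ → ℚ
    E j n = ν (12 ℕ.^ i) ℚ.* w s j n ℚ.- toℚ (leading i) ℚ.* kronecker i j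
    difference : ∀ n → 1 ℕ.≤ n → toℚ (+ (12 ℕ.^ i) ℤ.* W 0 s n ℤ.- leading i ℤ.* + (n ℕ.^ deg s)) ≡ poly (λ j → E j n) (2 ℕ.* s) n
    difference n 1≤n = begin
      toℚ (+ (12 ℕ.^ i) ℤ.* W 0 s n ℤ.- leading i ℤ.* + (n ℕ.^ deg s))
        ≡⟨ trans (toℚ-minus (+ (12 ℕ.^ i) ℤ.* W 0 s n) _) (cong₂ ℚ._-_ (toℚ-* (+ (12 ℕ.^ i)) (W 0 s n)) (toℚ-* (leading i) _)) ⟩
      ν (12 ℕ.^ i) ℚ.* toℚ (W 0 s n) ℚ.- toℚ (leading i) ℚ.* ν (n ℕ.^ deg s)
        ≡⟨ cong₂ (λ x d → ν (12 ℕ.^ i) ℚ.* x ℚ.- toℚ (leading i) ℚ.* ν (n ℕ.^ d)) (w-expansion s n 1≤n)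
             (trans (sym (ℕ.m+n∸n≡m (deg s) i)) (cong (_∸ i) (deg-double+ i))) ⟩
      ν (12 ℕ.^ i) ℚ.* poly (λ j → w s j n) (2 ℕ.* s) n ℚ.- toℚ (leading i) ℚ.* ν (n ℕ.^ (2 ℕ.* s ∸ i))
        ≡⟨ cong (λ x → ν (12 ℕ.^ i) ℚ.* poly (λ j → w s j n) (2 ℕ.* s) n ℚ.- toℚ (leading i) ℚ.* x)
             (poly-kronecker i (2 ℕ.* s) n (subst (i ℕ.≤_) (deg-double+ i) (ℕ.m≤n+m i (deg s)))) ⟨
      ν (12 ℕ.^ i) ℚ.* poly (λ j → w s j n) (2 ℕ.* s) n ℚ.- toℚ (leading i) ℚ.* poly (kronecker i) (2 ℕ.* s) n
        ≡⟨ trans (poly-minus (λ j → ν (12 ℕ.^ i) ℚ.* w s j n) _ (2 ℕ.* s) n)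
             (cong₂ ℚ._-_ (poly-* (ν (12 ℕ.^ i)) (λ j → w s j n) (2 ℕ.* s) n) (poly-* (toℚ (leading i)) (kronecker i) (2 ℕ.* s) n)) ⟨
      poly (λ j → E j n) (2 ℕ.* s) n ∎
      where open ≡-Reasoning

  coefficientOf : ℕ → ℕ → ℕ → ℚ
  coefficientOf i j n = ∑ℚ (suc (2 ℕ.* i)) λ s → w s i n ℚ.* β s j

  coefficientOf-periodic : ∀ i j → Periodic (coefficientOf i j)
  coefficientOf-periodic i j = go (suc (2 ℕ.* i)) (λ s n → w s i n ℚ.* β s j)
    λ s → Periodic-map₂ ℚ._*_ (Δ-periodic s i 0) (Periodic-const (β s j))
    where
    go : ∀ m (a : ℕ → ℕ → ℚ) → (∀ s → Periodic (a s)) → Periodic (λ n → ∑ℚ m λ s → a s n)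
    go zero    a per = Periodic-const 0ℚ
    go (suc m) a per = Periodic-map₂ ℚ._+_ (per 0) (go m (a ∘ suc) (per ∘ suc))

  c-polynomial : ∀ i q n → c i n q ≡ ∑ℚ (suc (2 ℕ.* i)) λ j → coefficientOf i j n ℚ.* ν (q ℕ.^ j)
  c-polynomial i q n = begin
    c i n q
      ≡⟨ newton q m (c i n) (λ s m≤s → w≡0 n m≤s) ⟩
    ∑ℚ m (λ s → binomial q s ℚ.* w s i n)
      ≡⟨ ∑ℚ-cong m (λ s s<m → trans (ℚ.*-comm (binomial q s) (w s i n))
           (trans (cong (w s i n ℚ.*_) (sym (∑-β s m q s<m))) (sym (∑ℚ-* m (w s i n) λ j → β s j ℚ.* ν (q ℕ.^ j))))) ⟩
    ∑ℚ m (λ s → ∑ℚ m λ j → w s i n ℚ.* (β s j ℚ.* ν (q ℕ.^ j)))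
      ≡⟨ ∑ℚ-comm m m (λ s j → w s i n ℚ.* (β s j ℚ.* ν (q ℕ.^ j))) ⟩
    ∑ℚ m (λ j → ∑ℚ m λ s → w s i n ℚ.* (β s j ℚ.* ν (q ℕ.^ j)))
      ≡⟨ ∑ℚ-cong m (λ j _ → trans (∑ℚ-cong m λ s _ → swap (w s i n) (β s j) (ν (q ℕ.^ j)))
           (trans (∑ℚ-* m (ν (q ℕ.^ j)) λ s → w s i n ℚ.* β s j) (ℚ.*-comm (ν (q ℕ.^ j)) (coefficientOf i j n)))) ⟩
    ∑ℚ m (λ j → coefficientOf i j n ℚ.* ν (q ℕ.^ j)) ∎
    where
    open ≡-Reasoning
    m = suc (2 ℕ.* i)
    swap : ∀ a b x → a ℚ.* (b ℚ.* x) ≡ x ℚ.* (a ℚ.* b)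
    swap = solve-∀ ℚ-ring

  -- Binomial coefficients with s < 2i have degree below 2i in q, so only the last Newton term
  -- reaches q^(2i).
  coefficientOf-leading : ∀ i n → coefficientOf i (2 ℕ.* i) n ≡ w (2 ℕ.* i) i n ℚ.* β (2 ℕ.* i) (2 ℕ.* i)
  coefficientOf-leading i n = trans (∑ℚ-last (2 ℕ.* i) λ s → w s i n ℚ.* β s (2 ℕ.* i)) (trans (cong (ℚ._+ top) (trans
    (∑ℚ-cong (2 ℕ.* i) λ s s<2i → trans (cong (w s i n ℚ.*_) (β-vanishing s (2 ℕ.* i) s<2i)) (ℚ.*-zeroʳ (w s i n)))
    (∑ℚ-zero (2 ℕ.* i)))) (ℚ.+-identityˡ top))
    where top = w (2 ℕ.* i) i n ℚ.* β (2 ℕ.* i) (2 ℕ.* i)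

  private
    k = size N
    θ : ℚ
    θ = ℚ.- (+ (5 ℕ.* k) / 24)

  leadingTerm : ℕ → ℚ
  leadingTerm i = θ ^ i ℚ.* (_/_ (+ 1) (i !) {{ i ℕ.!≢0 }})

  1/suc! : ∀ i → (_/_ (+ 1) (suc i !) {{ suc i ℕ.!≢0 }}) ≡ inv i ℚ.* (_/_ (+ 1) (i !) {{ i ℕ.!≢0 }})
  1/suc! i = ν-cancelˡ (suc i !) {{ suc i ℕ.!≢0 }} (trans (/-*ˡ (+ 1) (suc i !) {{ suc i ℕ.!≢0 }})
    (sym (trans (cong (ℚ._* (inv i ℚ.* r)) (ν-* (suc i) (i !))) (trans (swap (ν (suc i)) (ν (i !)) (inv i) r)
      (trans (cong₂ ℚ._*_ (ν*inv i) (/-*ˡ (+ 1) (i !) {{ i ℕ.!≢0 }})) (ℚ.*-identityˡ (toℚ 1ℤ)))))))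
    where
    r = _/_ (+ 1) (i !) {{ i ℕ.!≢0 }}
    swap : ∀ a b x y → a ℚ.* b ℚ.* (x ℚ.* y) ≡ a ℚ.* x ℚ.* (b ℚ.* y)
    swap = solve-∀ ℚ-ring

  2*inv : ∀ i → ν 2 ℚ.* inv (suc (double i)) ≡ inv i
  2*inv i = ν-cancelˡ (suc i) (trans (sym (ℚ.*-assoc (ν (suc i)) (ν 2) _)) (trans (cong (ℚ._* inv (suc (double i)))
    (trans (sym (ν-* (suc i) 2)) (cong ν (trans (ℕ.*-comm (suc i) 2) (sym (double≡2* (suc i)))))))
    (trans (ν*inv (suc (double i))) (sym (ν*inv i)))))

  -- Since `β s s` = 1/s!, this is (2i - 1)!! / (2i)! = 1 / (2^i i!). In the induction 2i + 1
  -- cancels against (2i + 1)(2i + 2), which leaves 1 / (2 (i + 1)).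
  leading*β : ∀ i → toℚ (leading i) ℚ.* β (double i) (double i) ≡ ν (12 ℕ.^ i) ℚ.* leadingTerm i
  leading*β zero = refl
  leading*β (suc i) = begin
    toℚ (leading (suc i)) ℚ.* β (double (suc i)) (double (suc i))
      ≡⟨ cong₂ ℚ._*_ cast (trans (β-diagonal (suc (double i))) (cong (inv (suc (double i)) ℚ.*_) (β-diagonal (double i)))) ⟩
    ℚ.- (ν (suc (double i)) ℚ.* (ν (5 ℕ.* k) ℚ.* toℚ (leading i))) ℚ.* (inv (suc (double i)) ℚ.* (inv (double i) ℚ.* β (double i) (double i)))
      -- Write 5k as 12 · 2 · (5k/24): the 12 extends 12^i, and the 2 turns 1/(2i + 2) into 1/(i +
      -- 1).
      ≡⟨ cong (λ t → ℚ.- (ν (suc (double i)) ℚ.* (t ℚ.* toℚ (leading i))) ℚ.* (inv (suc (double i)) ℚ.* (inv (double i) ℚ.* β (double i) (double i))))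
           (trans (sym (/-*ˡ (+ (5 ℕ.* k)) 24)) (cong (ℚ._* x) (ν-* 12 2))) ⟩
    ℚ.- (ν (suc (double i)) ℚ.* (ν 12 ℚ.* ν 2 ℚ.* x ℚ.* toℚ (leading i))) ℚ.* (inv (suc (double i)) ℚ.* (inv (double i) ℚ.* β (double i) (double i)))
      ≡⟨ ring₁ (ν (suc (double i))) (ν 12) (ν 2) x (toℚ (leading i)) (inv (suc (double i))) (inv (double i)) (β (double i) (double i)) ⟩
    (ν (suc (double i)) ℚ.* inv (double i)) ℚ.* (ν 2 ℚ.* inv (suc (double i))) ℚ.* (ν 12 ℚ.* ℚ.- x) ℚ.* (toℚ (leading i) ℚ.* β (double i) (double i))
      ≡⟨ cong₂ (λ a b → a ℚ.* (ν 12 ℚ.* ℚ.- x) ℚ.* b) (trans (cong₂ ℚ._*_ (ν*inv (double i)) (2*inv i)) (ℚ.*-identityˡ (inv i))) (leading*β i) ⟩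
    inv i ℚ.* (ν 12 ℚ.* ℚ.- x) ℚ.* (ν (12 ℕ.^ i) ℚ.* (θ ^ i ℚ.* r))
      ≡⟨ ring₂ (inv i) (ν 12) (ℚ.- x) (ν (12 ℕ.^ i)) (θ ^ i) r ⟩
    ν 12 ℚ.* ν (12 ℕ.^ i) ℚ.* (ℚ.- x ℚ.* θ ^ i ℚ.* (inv i ℚ.* r))
      ≡⟨ cong₂ (λ a b → a ℚ.* (ℚ.- x ℚ.* θ ^ i ℚ.* b)) (ν-* 12 (12 ℕ.^ i)) (1/suc! i) ⟨
    ν (12 ℕ.^ suc i) ℚ.* leadingTerm (suc i) ∎
    where
    open ≡-Reasoning
    x r : ℚ
    x = + (5 ℕ.* k) / 24
    r = _/_ (+ 1) (i !) {{ i ℕ.!≢0 }}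
    cast : toℚ (leading (suc i)) ≡ ℚ.- (ν (suc (double i)) ℚ.* (ν (5 ℕ.* k) ℚ.* toℚ (leading i)))
    cast = trans (toℚ-neg (+ suc (double i) ℤ.* (+ (5 ℕ.* k) ℤ.* leading i))) (cong ℚ.-_ (trans (toℚ-* (+ suc (double i)) _)
      (cong (ν (suc (double i)) ℚ.*_) (toℚ-* (+ (5 ℕ.* k)) (leading i)))))
    ring₁ : ∀ a t w x L i j b → ℚ.- (a ℚ.* (t ℚ.* w ℚ.* x ℚ.* L)) ℚ.* (i ℚ.* (j ℚ.* b)) ≡ (a ℚ.* j) ℚ.* (w ℚ.* i) ℚ.* (t ℚ.* ℚ.- x) ℚ.* (L ℚ.* b)
    ring₁ = solve-∀ ℚ-ring
    ring₂ : ∀ i t y p q r → i ℚ.* (t ℚ.* y) ℚ.* (p ℚ.* (q ℚ.* r)) ≡ t ℚ.* p ℚ.* (y ℚ.* q ℚ.* (i ℚ.* r))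
    ring₂ = solve-∀ ℚ-ring

  top-coefficient : ∀ i n → coefficientOf i (2 ℕ.* i) n ≡ leadingTerm i
  top-coefficient i n = trans (coefficientOf-leading i n) (trans
    (cong (λ s → w s i n ℚ.* β s s) (sym (double≡2* i)))
    (ν-cancelˡ (12 ℕ.^ i) {{ ℕ.m^n≢0 12 i }} (trans (sym (ℚ.*-assoc (ν (12 ℕ.^ i)) _ _))
      (trans (cong (ℚ._* β (double i) (double i)) (w-leading i n)) (leading*β i)))))

  module _ (1≤k : 1 ℕ.≤ k) where

    θ≢0 : θ ≢ 0ℚ
    θ≢0 θ≡0 = ℚ.<-irrefl (sym ν5k≡ν0) (ν-mono-< (ℕ.*-mono-≤ (s≤s {n = 4} z≤n) 1≤k))
      where
      ν5k≡ν0 : ν (5 ℕ.* k) ≡ ν 0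
      ν5k≡ν0 = trans (sym (/-*ˡ (+ (5 ℕ.* k)) 24)) (trans (cong (ν 24 ℚ.*_) (ℚ.neg-injective {p = + (5 ℕ.* k) / 24} {q = 0ℚ} θ≡0))
        (trans (ℚ.*-zeroʳ (ν 24)) (sym toℚ-0)))

    *≢0 : ∀ {x y} → x ≢ 0ℚ → y ≢ 0ℚ → x ℚ.* y ≢ 0ℚ
    *≢0 {x} {y} x≢0 y≢0 xy≡0 = y≢0 (begin
      y                          ≡⟨ ℚ.*-identityˡ y ⟨
      1ℚ ℚ.* y                   ≡⟨ cong (ℚ._* y) (ℚ.*-inverseˡ x) ⟨
      (ℚ.1/ x) ℚ.* x ℚ.* y       ≡⟨ ℚ.*-assoc (ℚ.1/ x) x y ⟩
      (ℚ.1/ x) ℚ.* (x ℚ.* y)     ≡⟨ cong ((ℚ.1/ x) ℚ.*_) xy≡0 ⟩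
      (ℚ.1/ x) ℚ.* 0ℚ            ≡⟨ ℚ.*-zeroʳ (ℚ.1/ x) ⟩
      0ℚ                         ∎)
      where
      open ≡-Reasoning
      instance _ = ℚ.≢-nonZero x≢0

    leadingTerm≢0 : ∀ i → leadingTerm i ≢ 0ℚ
    leadingTerm≢0 i = *≢0 (^≢0 i) λ r≡0 → 1≢0 (trans (sym (trans (/-*ˡ (+ 1) (i !) {{ i ℕ.!≢0 }}) toℚ-1))
        (trans (cong (ν (i !) ℚ.*_) r≡0) (ℚ.*-zeroʳ (ν (i !)))))
      where
      1≢0 : 1ℚ ≢ 0ℚ
      1≢0 ()
      ^≢0 : ∀ i → θ ^ i ≢ 0ℚ
      ^≢0 zero    = 1≢0
      ^≢0 (suc i) = *≢0 θ≢0 (^≢0 i)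

open import Data.Fin.Subset using (∣_∣)
open import Data.Nat.Properties using (_!≢0)
open import Data.Rational.Base using (_*_; -_)

theorem9p1 : ∀ (k : ℕ) → 1 ≤ k → k ≤ 4 →
    ∀ (N : PartialNightrider) → ∣ N ∣ ≡ k →
    ∀ (γ : ℕ → ℕ → ℕ → ℚ) →
    (∀ q → IsQuasipolynomial (u N q) (2 ℕ.* q) (γ q)) →
    ∀ (i : ℕ) →
    IsPolynomialWithLeadingTerm
    (λ q n → fromℕ (q !) * γ q i n)
    ((- (+ (5 ℕ.* k) / 24)) ^ i * (_/_ (+ 1) (i !) {{ i !≢0 }}))
    (2 ℕ.* i)
theorem9p1 _ 1≤k _ N refl γ quasi i = record
  { coefficient = λ j n → coefficientOf i (toℕ j) n
  ; periodic    = λ j → coefficientOf-periodic i (toℕ j)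
  ; evaluation  = λ q n → begin
      fromℕ (q !) ℚ.* γ q i n
        ≡⟨ cong (ℚ._* γ q i n) (fromℕ≡ν (q !)) ⟩
      ν (q !) ℚ.* γ q i n
        ≡⟨ c-polynomial i q n ⟩
      ∑ℚ (suc (2 ℕ.* i)) (λ j → coefficientOf i j n ℚ.* ν (q ℕ.^ j))
        ≡⟨ ∑ℚ≡∑ (suc (2 ℕ.* i)) (λ j → coefficientOf i j n ℚ.* ν (q ℕ.^ j)) ⟩
      (∑[ j < suc (2 ℕ.* i) ] (coefficientOf i (toℕ j) n ℚ.* ν (q ℕ.^ toℕ j)))
        ≡⟨ sum-cong-≗ {suc (2 ℕ.* i)} (λ j → cong (coefficientOf i (toℕ j) n ℚ.*_) (fromℕ≡ν (q ℕ.^ toℕ j))) ⟨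
      (∑[ j < suc (2 ℕ.* i) ] (coefficientOf i (toℕ j) n ℚ.* fromℕ (q ℕ.^ toℕ j))) ∎
  ; leading     = λ n → trans (cong (λ j → coefficientOf i j n) (Fin.toℕ-fromℕ (2 ℕ.* i)))
                              (top-coefficient i n)
  ; nonzero     = leadingTerm≢0 1≤k i
  }
  where
  open ≡-Reasoning
  nonempty : Nonempty N
  nonempty with Subset.nonempty? N
  ... | yes ne = ne
  ... | no empty = contradiction 1≤k (ℕ.<⇒≱ (s≤s (ℕ.≤-reflexive (trans (cong ∣_∣ (Subset.Empty-unique empty)) (Subset.∣⊥∣≡0 4)))))
  open Coefficients N nonempty γ quasi
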